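{- Let $H$ be a finite simple graph. The class $\mathrm{Excl}(H)$ of connected finite simple graphs that do not contain $H$ as a contraction is well-quasi-ordered by the contraction relation if and only if $H$ is a contraction of the diamond.
   Context: All graphs are finite, simple and undirected, considered up to isomorphism. Contracting an edge $\{u,v\}$ of a graph means adding a new vertex adjacent to all neighbours of $u$ and $v$ (other than $u,v$) and then deleting $u$ and $v$. A graph $H$ is a contraction of $G$ if $H$ can be obtained from $G$ by a (possibly empty) sequence of edge contractions; $G$ is $H$-contraction-free if $H$ is not a contraction of $G$. The diamond is the graph obtained from $K_4$ by deleting one edge. A quasi-order is a well-quasi-order if it has no infinite strictly decreasing sequence and no infinite antichain (infinite set of pairwise incomparable elements). -}

module Defs where

open import Data.Nat using (ℕ; zero; suc; _≤_)
open import Data.Fin using (Fin; zero; suc)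
open import Data.Bool using (Bool; true; false)
open import Data.Product using (Σ; ∃; ∃-syntax; _×_; _,_)
open import Data.Sum using (_⊎_)
open import Relation.Nullary using (¬_)
open import Relation.Binary.PropositionalEquality using (_≡_; _≢_)
open import Relation.Binary.Construct.Closure.ReflexiveTransitive using (Star)

record Graph : Set where
  field
    n     : ℕ
    adj   : Fin n → Fin n → Bool
    adj-sym   : ∀ x y → adj x y ≡ adj y x
    adj-irr   : ∀ x → adj x x ≡ false
open Graph public

Edge : (G : Graph) → Fin (n G) → Fin (n G) → Set
Edge G x y = adj G x y ≡ true

record Iso (G H : Graph) : Set where
  field
    to      : Fin (n G) → Fin (n H)
    from    : Fin (n H) → Fin (n G)
    from-to : ∀ x → from (to x) ≡ x
    to-from : ∀ y → to (from y) ≡ y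
    adj-pres : ∀ x y → adj G x y ≡ adj H (to x) (to y)

-- H is (isomorphic to) the graph obtained from G by contracting one edge {u,v}:
-- the quotient map f identifies exactly u and v, and two distinct vertices of H
-- are adjacent iff some preimages are adjacent in G.
record ContractEdge (G H : Graph) : Set where
  field
    u v     : Fin (n G)
    uv-edge : Edge G u v
    f       : Fin (n G) → Fin (n H)
    f-surj  : ∀ a → ∃[ x ] f x ≡ a
    f-uv    : f u ≡ f v
    f-only-uv : ∀ x y → f x ≡ f y →
                x ≡ y ⊎ ((x ≡ u × y ≡ v) ⊎ (x ≡ v × y ≡ u))
    edge-to   : ∀ a b → Edge H a b →
                a ≢ b × ∃[ x ] ∃[ y ] (f x ≡ a × f y ≡ b × Edge G x y)
    edge-from : ∀ a b → a ≢ b → ∀ x y → f x ≡ a → f y ≡ b → Edge G x y →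
                Edge H a b

data Step (G H : Graph) : Set where
  iso      : Iso G H → Step G H
  contract : ContractEdge G H → Step G H

_≼_ : Graph → Graph → Set
H ≼ G = Star Step G H

Connected : Graph → Set
Connected G = 1 ≤ n G × (∀ x y → Star (Edge G) x y)

Excl : Graph → Graph → Set
Excl H G = Connected G × ¬ (H ≼ G)

WQO : (Graph → Set) → Set
WQO P =
  ¬ (Σ (ℕ → Graph) λ s → (∀ i → P (s i)) ×
       (∀ i → (s (suc i) ≼ s i) × ¬ (s i ≼ s (suc i))))
  × ¬ (Σ (ℕ → Graph) λ s → (∀ i → P (s i)) ×
       (∀ i j → i ≢ j → ¬ (s i ≼ s j)))

-- The diamond: K4 minus the edge {2,3}.
diamondAdj : Fin 4 → Fin 4 → Bool
diamondAdj zero zero = false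
diamondAdj (suc (suc zero)) (suc (suc (suc zero))) = false
diamondAdj (suc (suc (suc zero))) (suc (suc zero)) = false
diamondAdj (suc zero) (suc zero) = false
diamondAdj (suc (suc zero)) (suc (suc zero)) = false
diamondAdj (suc (suc (suc zero))) (suc (suc (suc zero))) = false
diamondAdj _ _ = true

diamond : Graph
diamond = record
  { n = 4 ; adj = diamondAdj
  ; adj-sym = sy ; adj-irr = ir }
  where
  sy : ∀ x y → diamondAdj x y ≡ diamondAdj y x
  sy zero zero = _≡_.refl
  sy zero (suc zero) = _≡_.refl
  sy zero (suc (suc zero)) = _≡_.refl
  sy zero (suc (suc (suc zero))) = _≡_.refl
  sy (suc zero) zero = _≡_.refl
  sy (suc zero) (suc zero) = _≡_.refl
  sy (suc zero) (suc (suc zero)) = _≡_.refl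
  sy (suc zero) (suc (suc (suc zero))) = _≡_.refl
  sy (suc (suc zero)) zero = _≡_.refl
  sy (suc (suc zero)) (suc zero) = _≡_.refl
  sy (suc (suc zero)) (suc (suc zero)) = _≡_.refl
  sy (suc (suc zero)) (suc (suc (suc zero))) = _≡_.refl
  sy (suc (suc (suc zero))) zero = _≡_.refl
  sy (suc (suc (suc zero))) (suc zero) = _≡_.refl
  sy (suc (suc (suc zero))) (suc (suc zero)) = _≡_.refl
  sy (suc (suc (suc zero))) (suc (suc (suc zero))) = _≡_.refl
  ir : ∀ x → diamondAdj x x ≡ false
  ir zero = _≡_.refl
  ir (suc zero) = _≡_.refl
  ir (suc (suc zero)) = _≡_.refl
  ir (suc (suc (suc zero))) = _≡_.refl

{-# OPTIONS --safe #-}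
-- If H is not a contraction of the diamond, then one of two antichains avoids H.  Contracting an edge
-- of K₂,ᵣ creates a dominating vertex, so the graphs K₂,ᵣ form an antichain, and a proper contraction
-- of one of them has two (possibly equal) dominating vertices meeting all edges.  Complements of
-- cycles have no independent triple, and a cycle contains no 4-cycle, so that they form an antichain
-- as well.  The graphs with both properties are exactly the contractions of the diamond.
--
-- Conversely, a connected graph without diamond contraction is a tree of blocks that are cliques or
-- cycles: take a connected K with connected complement and a vertex a of K with a neighbour outside.
-- At most one component M of K - a contains further such vertices, and by induction M is a clique or
-- a path of pieces; adding the piece of a yields a longer clique or path, or else a diamond.  Rooted
-- graphs of this kind are coded by trees with two labels, contraction is implied by the tree
-- embedding, and Kruskal's theorem applies.  The latter is proved by bar induction: the trees in a
-- class generated by a grammar which avoid one of its members t lie in a class with a smaller grammar.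
module Submission where

open import Defs
open import Data.Bool using (Bool; true; false; not)
open import Data.Bool.Properties using () renaming (_≟_ to _≟ᵇ_)
open import Data.Empty using (⊥; ⊥-elim)
open import Data.Fin using (Fin; zero; suc; punchIn; punchOut; toℕ; fromℕ; fromℕ<; inject₁; opposite)
open import Data.Fin.Patterns using (0F; 1F; 2F; 3F)
open import Data.Fin.Properties using (_≟_; any?; punchIn-punchOut; punchOut-punchIn; punchInᵢ≢i; punchIn-injective; injective⇒≤; toℕ-injective; toℕ<n; toℕ-fromℕ<; toℕ-fromℕ; toℕ-inject₁; all?; ¬∀⟶∃¬; ≤fromℕ; opposite-involutive; opposite-prop; inject₁-injective; fromℕ≢inject₁)
open import Data.Fin.Relation.Unary.Top using (view; ‵fromℕ; ‵inject₁)
open import Data.Fin.Subset using (Subset; _∈_; _∉_; _⊆_; ∣_∣; _∩_; _∪_; ∁; ⁅_⁆) renaming (⊤ to full)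
open import Data.Fin.Subset.Properties using (_∈?_; x∈⁅x⁆; x∈⁅y⁆⇒x≡y; x∈p∩q⁺; x∈p∩q⁻; x∈p∪q⁺; x∈p∪q⁻; x∈∁p⇒x∉p; x∉p⇒x∈∁p; p⊂q⇒∣p∣<∣q∣; p⊆q⇒∣p∣≤∣q∣; ∈⊤; ∣⁅x⁆∣≡1)
open import Data.List using (List; []; _∷_; _++_; map; length; lookup; tabulate)
open import Data.List.Membership.Propositional using (find) renaming (_∈_ to _∈ₗ_)
open import Data.List.Relation.Binary.Sublist.Heterogeneous using (Sublist; []; _∷_; _∷ʳ_; minimum)
open import Data.List.Relation.Binary.Sublist.Heterogeneous.Properties using (sublist?; ++⁺)
open import Data.List.Relation.Unary.All as All using (All; []; _∷_)
open import Data.List.Relation.Unary.All.Properties using (¬All⇒Any¬)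
open import Data.List.Relation.Unary.Any as Any using (Any; here; there)
open import Data.List.Relation.Unary.Any.Properties using (tabulate⁻)
open import Data.Maybe using (Maybe; just; nothing)
open import Data.Maybe.Relation.Binary.Pointwise as MP using (just; nothing)
open import Data.Maybe.Relation.Unary.All as MA using (just; nothing)
open import Data.Nat using (ℕ; zero; suc; _+_; _≤_; _<_; z≤n; s≤s; _∸_; _*_)
open import Data.Nat.Induction using (<-wellFounded)
open import Data.Nat.Properties using (≤-refl; ≤-trans; m≤n⇒m≤1+n; ≰⇒>; _≤?_; ≤-pred; <-irrefl; ≤-reflexive; ≤-total; ≤-antisym; +-suc; +-identityʳ; m≤m+n; n≤1+n; suc-injective; m+[n∸m]≡n; 1+n≢n; 1+n≢0; +-monoˡ-≤; m≤n+m; +-assoc; +-comm; +-cancelˡ-≡; <⇒≢; *-distribʳ-+)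
open import Data.Product using (Σ; ∃-syntax; _×_; _,_; proj₁; proj₂)
open import Data.Sum using (_⊎_; inj₁; inj₂; [_,_]′)
open import Data.Sum.Properties using (≡-dec)
open import Data.Unit using (⊤; tt)
open import Function using (_∘_; id)
open import Induction.WellFounded using (Acc; acc)
open import Relation.Binary.Construct.Closure.ReflexiveTransitive as Star using (Star; ε; _◅_; _◅◅_)
open import Relation.Binary.PropositionalEquality using (_≡_; _≢_; refl; sym; trans; cong; cong₂; subst; subst₂; module ≡-Reasoning)
open import Relation.Nullary using (¬_; Dec; yes; no; does)
open import Relation.Nullary.Decidable using (_×-dec_; ¬?; dec-true; _⊎-dec_; map′; _→-dec_)

-- Wqo classes of trees

-- `WQO` is negative, so decreasing sequences and antichains only have to be refuted. The usual
-- minimal bad sequence argument is not constructive, though, and the absence of bad sequences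
-- supports no induction; hence the inductive predicate `WQ`, and a grammar argument in place of
-- minimality.
--
-- Ordered trees suffice as codes because the root breaks the symmetry of a block: a cycle is cut
-- open at its root, and for a clique any order of the vertices will do. Leaving out children of a
-- clique or cycle node corresponds to contracting to a smaller clique or cycle.
--
-- Contraction sequences are traded for maps with connected fibres, which restrict to parts of a
-- graph, compose, and can be assembled piece by piece.
--
-- In the structure proof the connected complement of K acts as one more vertex. A diamond found
-- among the parts of K and this vertex is thus a contraction of the whole graph. Paths are taken to
-- have at least three pieces: if both sides see both ends of a two-piece path, the result is K₄ and
-- not a diamond, so one or two pieces are treated as a clique.

module Residual {A : Set} (_≲_ : A → A → Set) where

  _∖_ : (A → Set) → A → A → Set
  (X ∖ t) u = X u × ¬ (t ≲ u)

  -- A bad sequence passes from each class to a residual of it, so it would be an infinite branch of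
  -- this well-founded tree. In this form closure under unions is a plain double induction, with no
  -- Ramsey argument.
  data WQ (X : A → Set) : Set where
    wq : (∀ {t} → X t → WQ (X ∖ t)) → WQ X

  wq-⊆ : ∀ {X Y} → (∀ {u} → Y u → X u) → WQ X → WQ Y
  wq-⊆ Y⊆X (wq h) = wq λ Yt → wq-⊆ (λ (Yu , t⋦u) → Y⊆X Yu , t⋦u) (h (Y⊆X Yt))

  wq-∅ : ∀ {X} → (∀ {u} → ¬ X u) → WQ X
  wq-∅ ∅ = wq λ Xt → ⊥-elim (∅ Xt)

  wq-∪ : ∀ {X Y} → WQ X → WQ Y → WQ (λ u → X u ⊎ Y u)
  wq-∪ wX@(wq hX) wY@(wq hY) = wq λ where
    (inj₁ Xt) → wq-⊆ (λ { (inj₁ Xu , n) → inj₁ (Xu , n) ; (inj₂ Yu , _) → inj₂ Yu })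
                     (wq-∪ (hX Xt) wY)
    (inj₂ Yt) → wq-⊆ (λ { (inj₁ Xu , _) → inj₁ Xu ; (inj₂ Yu , n) → inj₂ (Yu , n) })
                     (wq-∪ wX (hY Yt))

  wq-⋃ : ∀ {I : Set} (is : List I) {F : I → A → Set} → (∀ {i} → i ∈ₗ is → WQ (F i)) →
         WQ (λ u → ∃[ i ] (i ∈ₗ is × F i u))
  wq-⋃ []       h = wq-∅ λ { (_ , () , _) }
  wq-⋃ (i ∷ is) h =
    wq-⊆ (λ { (_ , here refl , Fu) → inj₁ Fu ; (j , there j∈ , Fu) → inj₂ (j , j∈ , Fu) })
         (wq-∪ (h (here refl)) (wq-⋃ is (λ j∈ → h (there j∈))))

  no-bad-sequence : ∀ {X} → WQ X → (s : ℕ → A) → (∀ i → X (s i)) →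
                    ¬ (∀ i j → i < j → ¬ (s i ≲ s j))
  no-bad-sequence (wq h) s Xs bad =
    no-bad-sequence (h (Xs 0)) (λ i → s (suc i))
      (λ i → Xs (suc i) , bad 0 (suc i) (s≤s z≤n))
      (λ i j i<j → bad (suc i) (suc j) (s≤s i<j))

-- Higman's lemma in residual form

module Higman {A : Set} (_≲_ : A → A → Set) (_≲?_ : ∀ x y → Dec (x ≲ y)) where

  open Residual _≲_
  open Residual (Sublist _≲_) using () renaming
    (_∖_ to _∖*_; WQ to WQ*; wq to wq*; wq-⊆ to wq*-⊆; wq-∪ to wq*-∪; wq-∅ to wq*-∅)

  Cat : (List A → Set) → (A → Set) → (List A → Set) → List A → Set
  Cat P X Q w = ∃[ w₀ ] ∃[ a ] ∃[ w₁ ] (w ≡ w₀ ++ a ∷ w₁ × P w₀ × X a × Q w₁)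

  -- If all three factors of a word lie above those of `w₀ ++ a ∷ w₁`, so does the word. Avoidance
  -- therefore puts one factor into a residual, and the induction is on the three proofs together.
  wq-Cat : ∀ {P X Q} → WQ* P → WQ X → WQ* Q → WQ* (Cat P X Q)
  wq-Cat {P} {X} {Q} wP@(wq* hP) wX@(wq hX) wQ@(wq* hQ) =
    wq* λ { (w₀ , a , w₁ , refl , Pw , Xa , Qw) →
      wq*-⊆ (cover w₀ a w₁)
        (wq*-∪ (wq-Cat (hP Pw) wX wQ) (wq*-∪ (wq-Cat wP (hX Xa) wQ) (wq-Cat wP wX (hQ Qw)))) }
    where
    cover : ∀ w₀ a w₁ {u} → (Cat P X Q ∖* (w₀ ++ a ∷ w₁)) u →
            Cat (P ∖* w₀) X Q u ⊎ Cat P (X ∖ a) Q u ⊎ Cat P X (Q ∖* w₁) u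
    cover w₀ a w₁ ((v₀ , b , v₁ , refl , Pv , Xb , Qv) , avoids)
      with sublist? _≲?_ w₀ v₀ | a ≲? b | sublist? _≲?_ w₁ v₁
    ... | no n  | _     | _     = inj₁ (v₀ , b , v₁ , refl , (Pv , n) , Xb , Qv)
    ... | yes _ | no n  | _     = inj₂ (inj₁ (v₀ , b , v₁ , refl , Pv , (Xb , n) , Qv))
    ... | yes _ | yes _ | no n  = inj₂ (inj₂ (v₀ , b , v₁ , refl , Pv , Xb , (Qv , n)))
    ... | yes p | yes q | yes r = ⊥-elim (avoids (++⁺ p (q ∷ r)))

  higman : ∀ {X} → WQ X → WQ* (All X)
  -- Nested induction: passing to letters that avoid `x` shrinks the proof for the alphabet, and
  -- over a fixed alphabet the avoided word gets shorter.
  higman-∖ : ∀ {X} → WQ X → ∀ {w} → All X w → WQ* (All X ∖* w)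

  higman wX = wq* (higman-∖ wX)

  higman-∖ wX [] = wq*-∅ λ (_ , n) → n (minimum _)
  higman-∖ {X} wX@(wq h) {x ∷ w} (Xx ∷ Xw) =
    wq*-⊆ (λ (Xu , n) → cover Xu n)
      (wq*-∪ (higman (h Xx)) (wq-Cat (higman (h Xx)) wX (higman-∖ wX Xw)))
    where
    -- Cut a word at its first letter above x.
    cover : ∀ {u} → All X u → ¬ Sublist _≲_ (x ∷ w) u →
            All (X ∖ x) u ⊎ Cat (All (X ∖ x)) X (All X ∖* w) u
    cover [] _ = inj₁ []
    cover {a ∷ u} (Xa ∷ Xu) n with x ≲? a
    ... | yes p = inj₂ ([] , a , u , refl , [] , Xa , (Xu , λ q → n (p ∷ q)))
    ... | no x⋦a with cover Xu (λ q → n (a ∷ʳ q))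
    ...   | inj₁ all = inj₁ ((Xa , x⋦a) ∷ all)
    ...   | inj₂ (w₀ , b , w₁ , refl , P , R) = inj₂ (a ∷ w₀ , b , w₁ , refl , (Xa , x⋦a) ∷ P , R)

-- Labelled trees and Kruskal's theorem

data Label : Set where
  clique cycle : Label

_≟ᴸ_ : (f g : Label) → Dec (f ≡ g)
clique ≟ᴸ clique = yes refl
clique ≟ᴸ cycle  = no λ ()
cycle  ≟ᴸ clique = no λ ()
cycle  ≟ᴸ cycle  = yes refl

data Tree : Set where
  node : Label → List Tree → Tree

-- Siblings keep their order because it records the order around a cycle; `same` keeps the label
-- because a clique need not contract to a cycle, nor a cycle to a clique.
data _⊑_ : Tree → Tree → Set where
  down : ∀ {t f us} → Any (t ⊑_) us → t ⊑ node f us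
  same : ∀ {f ts us} → Sublist _⊑_ ts us → node f ts ⊑ node f us

_⊑?_ : ∀ t u → Dec (t ⊑ u)
⊑-any? : ∀ t us → Dec (Any (t ⊑_) us)
⊑-sublist? : ∀ ts us → Dec (Sublist _⊑_ ts us)

node f ts ⊑? node g us with ⊑-any? (node f ts) us | f ≟ᴸ g | ⊑-sublist? ts us
... | yes p | _        | _     = yes (down p)
... | no ¬p | yes refl | yes q = yes (same q)
... | no ¬p | yes refl | no ¬q = no λ { (down p) → ¬p p ; (same q) → ¬q q }
... | no ¬p | no f≢g   | _     = no λ { (down p) → ¬p p ; (same q) → f≢g refl }

⊑-any? t []       = no λ ()
⊑-any? t (u ∷ us) = map′ Any.fromSum Any.toSum ((t ⊑? u) ⊎-dec ⊑-any? t us)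

⊑-sublist? []       us       = yes (minimum us)
⊑-sublist? (t ∷ ts) []       = no λ ()
⊑-sublist? (t ∷ ts) (u ∷ us) with ⊑-sublist? (t ∷ ts) us | t ⊑? u | ⊑-sublist? ts us
... | yes p | _     | _     = yes (u ∷ʳ p)
... | no ¬p | yes q | yes r = yes (q ∷ r)
... | no ¬p | yes q | no ¬r = no λ { (_ ∷ʳ p) → ¬p p ; (q ∷ r) → ¬r r }
... | no ¬p | no ¬q | _     = no λ { (_ ∷ʳ p) → ¬p p ; (q ∷ r) → ¬q q }

-- A context is a word of trees with holes (nothing).
Ctx : Set
Ctx = List (Maybe Tree)

_≤ᴹ_ : Maybe Tree → Maybe Tree → Set
_≤ᴹ_ = MP.Pointwise _⊑_

_≤ᴹ?_ : ∀ c d → Dec (c ≤ᴹ d)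
_≤ᴹ?_ = MP.dec _⊑?_

_≤ᶜ_ : Ctx → Ctx → Set
_≤ᶜ_ = Sublist _≤ᴹ_

open Residual _⊑_
open Residual _≤ᶜ_ using () renaming (_∖_ to _∖ᶜ_; WQ to WQᶜ; wq to wqᶜ; wq-⊆ to wqᶜ-⊆)
private module M = Residual _≤ᴹ_

holes : Ctx → ℕ
holes []            = 0
holes (just _ ∷ c)  = holes c
holes (nothing ∷ c) = suc (holes c)

wq-Maybe : ∀ {Y} → WQ Y → M.WQ (MA.All Y)
wq-Maybe {Y} wY =
  M.wq-⊆ (λ { (just Yy) → inj₂ (_ , refl , Yy) ; nothing → inj₁ refl })
    (M.wq-∪ wq-nothing (wq-just wY))
  where
  wq-nothing : M.WQ (_≡ nothing)
  wq-nothing = M.wq λ { refl → M.wq-∅ λ { (refl , n) → n nothing } }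

  wq-just : ∀ {Y : Tree → Set} → WQ Y → M.WQ (λ m → ∃[ y ] (m ≡ just y × Y y))
  wq-just (wq h) = M.wq λ { (_ , refl , Yy) →
    M.wq-⊆ (λ { ((z , refl , Yz) , n) → z , refl , Yz , (λ p → n (just p)) }) (wq-just (h Yy)) }

Over : (Tree → Set) → ℕ → Ctx → Set
Over Y b c = All (MA.All Y) c × holes c < b

wq-Over : ∀ {Y b} → WQ Y → WQᶜ (Over Y b)
wq-Over wY = wqᶜ-⊆ proj₁ (Higman.higman _≤ᴹ_ _≤ᴹ?_ (wq-Maybe wY))

-- A code is a production of a tree grammar: free f allows any list of children below f, bounded f
-- only lists fitting a context of the language X (fewer than b holes, other letters from Y).
data Code : Set₁ where
  free    : Label → Code
  bounded : Label → (b : ℕ) (Y : Tree → Set) (X : Ctx → Set) →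
            WQ Y → WQᶜ X → (∀ c → X c → Over Y b c) → Code

-- A lexicographic order: free codes on top, then the hole bound, then residuals of the language. A
-- drop of the hole bound may change everything else, which is why each code carries its own wqo
-- proofs.
data _≺_ : Code → Code → Set₁ where
  bounded-free : ∀ {f g b Y X wY wX X⊆} → bounded f b Y X wY wX X⊆ ≺ free g
  fewer-holes  : ∀ {f g b b′ Y Y′ X X′ wY wY′ wX wX′ X⊆ X′⊆} → b′ < b →
                 bounded f b′ Y′ X′ wY′ wX′ X′⊆ ≺ bounded g b Y X wY wX X⊆
  fewer-words  : ∀ {f b c} {Y : Tree → Set} {X : Ctx → Set} {wY wY′ wX wX′ X⊆ X′⊆} → X c →
                 bounded f b Y (X ∖ᶜ c) wY′ wX′ X′⊆ ≺ bounded f b Y X wY wX X⊆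

≺-acc-bounded : ∀ {f b Y X wY wX X⊆} → Acc _<_ b → WQᶜ X → Acc _≺_ (bounded f b Y X wY wX X⊆)
≺-acc-below : ∀ {f b Y X wY wX X⊆ q} → Acc _<_ b → WQᶜ X →
              q ≺ bounded f b Y X wY wX X⊆ → Acc _≺_ q

≺-acc-bounded a w = acc (≺-acc-below a w)

≺-acc-below (acc r) w (fewer-holes {wX′ = wX′} b′<b) = ≺-acc-bounded (r b′<b) wX′
≺-acc-below a (wqᶜ h) (fewer-words Xc)               = ≺-acc-bounded a (h Xc)

≺-wellFounded : ∀ p → Acc _≺_ p
≺-wellFounded (free f) = acc λ { (bounded-free {b = b} {wX = wX}) → ≺-acc-bounded (<-wellFounded b) wX }
≺-wellFounded (bounded f b Y X wY wX X⊆) = ≺-acc-bounded (<-wellFounded b) wX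

replace : (ps : List Code) → Fin (length ps) → List Code → List Code
replace (p ∷ ps) zero    qs = qs ++ ps
replace (p ∷ ps) (suc o) qs = p ∷ replace ps o qs

-- One step of the multiset extension of `_≺_`: a code gives way to finitely many smaller ones.
-- Well-foundedness is the usual nested accessibility argument.
data _⊰_ : List Code → List Code → Set₁ where
  here  : ∀ {p ps qs} → All (_≺ p) qs → (qs ++ ps) ⊰ (p ∷ ps)
  there : ∀ {p ps qs} → qs ⊰ ps → (p ∷ qs) ⊰ (p ∷ ps)

⊰-acc-∷ : ∀ {p ps} → Acc _≺_ p → Acc _⊰_ ps → Acc _⊰_ (p ∷ ps)
⊰-acc-below : ∀ {p ps qs} → Acc _≺_ p → Acc _⊰_ ps → qs ⊰ (p ∷ ps) → Acc _⊰_ qs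
⊰-acc-++ : ∀ {p ps qs} → Acc _≺_ p → Acc _⊰_ ps → All (_≺ p) qs → Acc _⊰_ (qs ++ ps)

⊰-acc-∷ ap aps = acc (⊰-acc-below ap aps)

⊰-acc-below ap aps       (here qs≺p) = ⊰-acc-++ ap aps qs≺p
⊰-acc-below ap (acc rps) (there qs⊰) = ⊰-acc-∷ ap (rps qs⊰)

⊰-acc-++ ap            aps []           = aps
⊰-acc-++ ap@(acc rp) aps (q≺p ∷ qs≺p) = ⊰-acc-∷ (rp q≺p) (⊰-acc-++ ap aps qs≺p)

⊰-wellFounded : ∀ ps → Acc _⊰_ ps
⊰-wellFounded []       = acc λ ()
⊰-wellFounded (p ∷ ps) = ⊰-acc-∷ (≺-wellFounded p) (⊰-wellFounded ps)

replace-⊰ : ∀ ps o {qs} → All (_≺ lookup ps o) qs → replace ps o qs ⊰ ps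
replace-⊰ (p ∷ ps) zero    qs≺ = here qs≺
replace-⊰ (p ∷ ps) (suc o) qs≺ = there (replace-⊰ ps o qs≺)

_∈ᶜ_ : Code → List Code → Set₁
p ∈ᶜ ps = ∃[ o ] lookup ps o ≡ p

∈ᶜ-there : ∀ {p q ps} → p ∈ᶜ ps → p ∈ᶜ (q ∷ ps)
∈ᶜ-there (o , eq) = suc o , eq

∈ᶜ-++ˡ : ∀ {p} qs ps → p ∈ᶜ qs → p ∈ᶜ (qs ++ ps)
∈ᶜ-++ˡ (q ∷ qs) ps (zero , eq)  = zero , eq
∈ᶜ-++ˡ (q ∷ qs) ps (suc o , eq) = ∈ᶜ-there (∈ᶜ-++ˡ qs ps (o , eq))

∈ᶜ-++ʳ : ∀ {p} qs ps → p ∈ᶜ ps → p ∈ᶜ (qs ++ ps)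
∈ᶜ-++ʳ []       ps p∈ = p∈
∈ᶜ-++ʳ (q ∷ qs) ps p∈ = ∈ᶜ-there (∈ᶜ-++ʳ qs ps p∈)

replace-new : ∀ ps o {qs p} → p ∈ᶜ qs → p ∈ᶜ replace ps o qs
replace-new (p ∷ ps) zero    {qs} q∈ = ∈ᶜ-++ˡ qs ps q∈
replace-new (p ∷ ps) (suc o)      q∈ = ∈ᶜ-there (replace-new ps o q∈)

replace-old : ∀ ps o {qs} o′ → o′ ≡ o ⊎ lookup ps o′ ∈ᶜ replace ps o qs
replace-old (p ∷ ps) zero {qs} zero     = inj₁ refl
replace-old (p ∷ ps) zero {qs} (suc o′) = inj₂ (∈ᶜ-++ʳ qs ps (o′ , refl))
replace-old (p ∷ ps) (suc o) zero       = inj₂ (zero , refl)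
replace-old (p ∷ ps) (suc o) {qs} (suc o′) with replace-old ps o {qs} o′
... | inj₁ refl = inj₁ refl
... | inj₂ p∈   = inj₂ (∈ᶜ-there p∈)

-- A marked word: inj₂ letters sit in holes, inj₁ letters belong to the context.
Marked : Set
Marked = List (Tree ⊎ Tree)

erase : Tree ⊎ Tree → Maybe Tree
erase (inj₁ a) = just a
erase (inj₂ a) = nothing

unwrap : Tree ⊎ Tree → Tree
unwrap (inj₁ a) = a
unwrap (inj₂ a) = a

context : Marked → Ctx
context = map erase

word : Marked → List Tree
word = map unwrap

Shape : Code → Label → Ctx → Set
Shape (free g)                f c = f ≡ g × All (_≡ nothing) c
Shape (bounded g b Y X _ _ _) f c = f ≡ g × X c

-- Only the letters in holes are derived further; all other letters lie in the wqo class `Y` of the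
-- code.
data Gen (ps : List Code) : Tree → Set where
  gen : ∀ o {f} ms → Shape (lookup ps o) f (context ms) →
        (∀ {a} → inj₂ a ∈ₗ ms → Gen ps a) → Gen ps (node f (word ms))

Gen-code : ∀ {ps p f} → p ∈ᶜ ps → ∀ ms → Shape p f (context ms) →
           (∀ {a} → inj₂ a ∈ₗ ms → Gen ps a) → Gen ps (node f (word ms))
Gen-code (o , refl) = gen o

-- Holes of ms′ that fail to dominate some hole of ms are closed.
module Remark (ms : Marked) where

  _below_ : Tree ⊎ Tree → Tree → Set
  inj₁ _ below a = ⊤
  inj₂ y below a = y ⊑ a

  _below?_ : ∀ m a → Dec (m below a)
  inj₁ _ below? a = yes tt
  inj₂ y below? a = y ⊑? a

  -- A letter above every hole letter of `ms` can receive any of them, so embeddings need no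
  -- matching of particular holes.
  Dom : Tree → Set
  Dom a = All (_below a) ms

  dom? : ∀ a → Dec (Dom a)
  dom? a = All.all? (_below? a) ms

  witness : ∀ {a} → ¬ Dom a → ∃[ m ] (m ∈ₗ ms × ∃[ y ] (m ≡ inj₂ y × ¬ (y ⊑ a)))
  witness {a} ¬dom with find (¬All⇒Any¬ (_below? a) ms ¬dom)
  ... | inj₁ _ , _  , n = ⊥-elim (n tt)
  ... | inj₂ y , m∈ , n = inj₂ y , m∈ , y , refl , n

  remark₁ : Tree ⊎ Tree → Tree ⊎ Tree
  remark₁ (inj₁ a) = inj₁ a
  remark₁ (inj₂ a) with dom? a
  ... | yes _ = inj₂ a
  ... | no  _ = inj₁ a

  remark : Marked → Marked
  remark = map remark₁

  word-remark : ∀ ms′ → word (remark ms′) ≡ word ms′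
  word-remark []             = refl
  word-remark (inj₁ a ∷ ms′) = cong (a ∷_) (word-remark ms′)
  word-remark (inj₂ a ∷ ms′) with dom? a
  ... | yes _ = cong (a ∷_) (word-remark ms′)
  ... | no  _ = cong (a ∷_) (word-remark ms′)

  holes-remark : ∀ ms′ → holes (context (remark ms′)) ≤ holes (context ms′)
  holes-remark []             = z≤n
  holes-remark (inj₁ a ∷ ms′) = holes-remark ms′
  holes-remark (inj₂ a ∷ ms′) with dom? a
  ... | yes _ = s≤s (holes-remark ms′)
  ... | no  _ = m≤n⇒m≤1+n (holes-remark ms′)

  ∈-remark : ∀ ms′ {a} → inj₂ a ∈ₗ remark ms′ → inj₂ a ∈ₗ ms′
  ∈-remark (inj₁ a ∷ ms′) (there p) = there (∈-remark ms′ p)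
  ∈-remark (inj₂ a ∷ ms′) p with dom? a
  ∈-remark (inj₂ a ∷ ms′) (here refl) | yes _ = here refl
  ∈-remark (inj₂ a ∷ ms′) (there p)   | yes _ = there (∈-remark ms′ p)
  ∈-remark (inj₂ a ∷ ms′) (there p)   | no  _ = there (∈-remark ms′ p)

  remark-closed : ∀ {Y Z : Tree → Set} → (∀ {a} → Y a → Z a) → ∀ ms′ →
    (∀ {a} → inj₂ a ∈ₗ ms′ → ¬ Dom a → Z a) →
    All (MA.All Y) (context ms′) → All (MA.All Z) (context (remark ms′))
  remark-closed Y⊆Z []             h []              = []
  remark-closed Y⊆Z (inj₁ a ∷ ms′) h (just Ya ∷ Yms) =
    just (Y⊆Z Ya) ∷ remark-closed Y⊆Z ms′ (λ p → h (there p)) Yms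
  remark-closed Y⊆Z (inj₂ a ∷ ms′) h (_ ∷ Yms) with dom? a
  ... | yes _   = nothing ∷ remark-closed Y⊆Z ms′ (λ p → h (there p)) Yms
  ... | no ¬dom = just (h (here refl) ¬dom) ∷ remark-closed Y⊆Z ms′ (λ p → h (there p)) Yms

  -- The dichotomy of the bounded case: a strict drop feeds `fewer-holes`, and otherwise
  -- `embed-aligned` applies.
  fewer-or-dom : ∀ ms′ → holes (context (remark ms′)) < holes (context ms′) ⊎
                         (∀ {a} → inj₂ a ∈ₗ ms′ → Dom a)
  fewer-or-dom [] = inj₂ λ ()
  fewer-or-dom (inj₁ a ∷ ms′) with fewer-or-dom ms′
  ... | inj₁ lt = inj₁ lt
  ... | inj₂ h  = inj₂ λ { (there p) → h p }
  fewer-or-dom (inj₂ a ∷ ms′) with dom? a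
  ... | no _ = inj₁ (s≤s (holes-remark ms′))
  ... | yes d with fewer-or-dom ms′
  ...   | inj₁ lt = inj₁ (s≤s lt)
  ...   | inj₂ h  = inj₂ λ { (here refl) → d ; (there p) → h p }

  -- Every hole left open lies above every letter of `ts`, so a greedy embedding succeeds by
  -- counting alone.
  embed-many : ∀ ts ms′ → (∀ {y} → y ∈ₗ ts → inj₂ y ∈ₗ ms) →
               length ts ≤ holes (context (remark ms′)) → Sublist _⊑_ ts (word ms′)
  embed-many []       ms′            h le = minimum _
  embed-many (t ∷ ts) (inj₁ a ∷ ms′) h le = a ∷ʳ embed-many (t ∷ ts) ms′ h le
  embed-many (t ∷ ts) (inj₂ a ∷ ms′) h le with dom? a
  embed-many (t ∷ ts) (inj₂ a ∷ ms′) h (s≤s le) | yes d =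
    All.lookup d (h (here refl)) ∷ embed-many ts ms′ (λ p → h (there p)) le
  embed-many (t ∷ ts) (inj₂ a ∷ ms′) h le | no _ = a ∷ʳ embed-many (t ∷ ts) ms′ h le

  embed-aligned : ∀ ns ms′ → (∀ {y} → inj₂ y ∈ₗ ns → inj₂ y ∈ₗ ms) →
                  (∀ {a} → inj₂ a ∈ₗ ms′ → Dom a) →
                  context ns ≤ᶜ context ms′ → Sublist _⊑_ (word ns) (word ms′)
  embed-aligned []            ms′            sub d e         = minimum _
  embed-aligned (n ∷ ns)      (m ∷ ms′)      sub d (_ ∷ʳ e)  =
    unwrap m ∷ʳ embed-aligned (n ∷ ns) ms′ sub (λ p → d (there p)) e
  embed-aligned (inj₁ y ∷ ns) (inj₁ a ∷ ms′) sub d (just p ∷ e) =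
    p ∷ embed-aligned ns ms′ (λ p → sub (there p)) (λ p → d (there p)) e
  embed-aligned (inj₂ y ∷ ns) (inj₂ a ∷ ms′) sub d (nothing ∷ e) =
    All.lookup (d (here refl)) (sub (here refl)) ∷
    embed-aligned ns ms′ (λ p → sub (there p)) (λ p → d (there p)) e

module _ {ps : List Code} {f : Label} {ms : Marked} where

  open Remark ms

  private
    t : Tree
    t = node f (word ms)

  -- The class of the letters in closed holes. It is a finite union of residuals at hole letters of
  -- `t`, each wqo by induction on the derivation of `t`.
  Undominated : Tree → Set
  Undominated a = ∃[ m ] (m ∈ₗ ms × ∃[ y ] (m ≡ inj₂ y × (Gen ps ∖ y) a))

  undominated : ∀ {a} → Gen ps a → ¬ Dom a → Undominated a
  undominated g ¬dom with witness ¬dom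
  ... | m , m∈ , y , eq , n = m , m∈ , y , eq , g , n

  wq-Undominated : (∀ {y} → inj₂ y ∈ₗ ms → WQ (Gen ps ∖ y)) → WQ Undominated
  wq-Undominated h = wq-⋃ ms λ
    { {inj₁ _} _  → wq-∅ λ { (_ , () , _) }
    ; {inj₂ y} y∈ → wq-⊆ (λ { (_ , refl , g) → g }) (h y∈) }

  -- By `down`, avoidance of `t` is inherited by subtrees; hence a whole derivation can be rewritten
  -- from its root downwards.
  ⋢-child : ∀ {g ms′ a} → inj₂ a ∈ₗ ms′ → ¬ (t ⊑ node g (word ms′)) → ¬ (t ⊑ a)
  ⋢-child {g} {ms′} {a} a∈ n p = n (down (find-in ms′ a∈))
    where
    find-in : ∀ ms′ → inj₂ a ∈ₗ ms′ → Any (t ⊑_) (word ms′)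
    find-in (_ ∷ _)   (here refl) = here p
    find-in (_ ∷ ms′) (there q)   = there (find-in ms′ q)

  -- Local correctness of replacing a code. The new marking of the same word may close holes but
  -- opens none, so the derivations below the holes can be reused.
  Covers : Code → List Code → Set₁
  Covers p qs = ∀ {g} ms′ → Shape p g (context ms′) → (∀ {a} → inj₂ a ∈ₗ ms′ → Gen ps a) →
    ¬ (t ⊑ node g (word ms′)) →
    ∃[ q ] (q ∈ᶜ qs × ∃[ ns ] (word ns ≡ word ms′ × Shape q g (context ns) ×
                               (∀ {a} → inj₂ a ∈ₗ ns → inj₂ a ∈ₗ ms′)))

  cover-Gen : ∀ o {qs} → Covers (lookup ps o) qs → ∀ {u} → (Gen ps ∖ t) u → Gen (replace ps o qs) u
  cover-Gen o {qs} cov (gu , n) = go gu n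
    where
    go : ∀ {u} → Gen ps u → ¬ (t ⊑ u) → Gen (replace ps o qs) u
    go (gen o′ ms′ sh h) n with replace-old ps o {qs} o′
    ... | inj₂ p∈ = Gen-code p∈ ms′ sh (λ a∈ → go (h a∈) (⋢-child a∈ n))
    ... | inj₁ refl with cov ms′ sh h n
    ...   | q , q∈ , ns , eq , sh′ , sub =
      subst (λ w → Gen (replace ps o qs) (node _ w)) eq
        (Gen-code (replace-new ps o q∈) ns sh′
          (λ a∈ → go (h (sub a∈)) (⋢-child (sub a∈) n)))

  Successors : Code → Set₁
  Successors p = ∃[ qs ] (All (_≺ p) qs × Covers p qs)

  -- For a free code, `length ms` dominating holes would make `t` embed, so fewer stay open. For a
  -- bounded code, either the context stays in the residual language, or some hole fails to dominate
  -- and is closed, which lowers the bound; comparable contexts with only dominating holes would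
  -- again embed `t`.
  successors : ∀ p → Shape p f (context ms) → WQ Undominated → Successors p
  successors (free g) (refl , free-ms) wY′ =
    (bounded f (length ms) Undominated (Over Undominated (length ms)) wY′ (wq-Over wY′) (λ _ z → z) ∷ []) ,
    bounded-free ∷ [] , cov
    where
    all-holes : ∀ ns → All (_≡ nothing) (context ns) → ∀ {Y} → All (MA.All Y) (context ns)
    all-holes []            []         = []
    all-holes (inj₂ _ ∷ ns) (refl ∷ p) = nothing ∷ all-holes ns p
    unmarked : ∀ ns → All (_≡ nothing) (context ns) → ∀ {y} → y ∈ₗ word ns → inj₂ y ∈ₗ ns
    unmarked (inj₂ _ ∷ ns) (_ ∷ p) (here refl) = here refl
    unmarked (inj₂ _ ∷ ns) (_ ∷ p) (there q)   = there (unmarked ns p q)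
    length-word : ∀ (ns : Marked) → length (word ns) ≡ length ns
    length-word []       = refl
    length-word (_ ∷ ns) = cong suc (length-word ns)
    cov : Covers (free g) _
    cov {g} ms′ (refl , free-ms′) h n with length ms ≤? holes (context (remark ms′))
    ... | yes le = ⊥-elim (n (same (embed-many (word ms) ms′ (unmarked ms free-ms)
                     (≤-trans (≤-reflexive (length-word ms)) le))))
    ... | no nle = _ , (zero , refl) , remark ms′ , word-remark ms′ ,
          (refl , remark-closed {Y = λ _ → ⊥} (λ ()) ms′ (λ a∈ → undominated (h a∈)) (all-holes ms′ free-ms′) , ≰⇒> nle) ,
          ∈-remark ms′
  -- The number of holes lies strictly below the bound, so bound zero admits no word.
  successors (bounded g zero Y X wY wX X⊆) (refl , Xms) wY′ with proj₂ (X⊆ _ Xms)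
  ... | ()
  successors (bounded g (suc b) Y X wY wX@(wqᶜ hX) X⊆) (refl , Xms) wY′ =
    (bounded f (suc b) Y (X ∖ᶜ context ms) wY (hX Xms) (λ c (Xc , _) → X⊆ c Xc) ∷
     bounded f b Z (Over Z b) wZ (wq-Over wZ) (λ _ z → z) ∷ []) ,
    fewer-words Xms ∷ fewer-holes ≤-refl ∷ [] , cov
    where
    Z : Tree → Set
    Z a = Y a ⊎ Undominated a
    wZ : WQ Z
    wZ = wq-∪ wY wY′
    cov : Covers (bounded g (suc b) Y X wY wX X⊆) _
    cov ms′ (refl , Xms′) h n with sublist? _≤ᴹ?_ (context ms) (context ms′)
    ... | no  ≰ = _ , (zero , refl) , ms′ , refl , (refl , Xms′ , ≰) , (λ z → z)
    ... | yes e with fewer-or-dom ms′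
    ...   | inj₂ d  = ⊥-elim (n (same (embed-aligned ms ms′ (λ z → z) d e)))
    ...   | inj₁ lt with X⊆ _ Xms′
    ...     | Yms′ , s≤s le = _ , (suc zero , refl) , remark ms′ , word-remark ms′ ,
          (refl , remark-closed inj₁ ms′ (λ a∈ nd → inj₂ (undominated (h a∈) nd)) Yms′ , ≤-trans lt le) ,
          ∈-remark ms′

-- The outer induction is on `_⊰_`, the inner one on the derivation of `t`. The inner one comes
-- first: it makes the residuals at the hole letters of `t` wqo, from which the smaller codes are
-- built.
wq-Gen : ∀ {ps} → Acc _⊰_ ps → WQ (Gen ps)
wq-Gen-∖ : ∀ {ps t} → Acc _⊰_ ps → Gen ps t → WQ (Gen ps ∖ t)

wq-Gen a = wq (wq-Gen-∖ a)

wq-Gen-∖ {ps} (acc r) (gen o {f} ms sh h)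
  with successors {ps} {f} {ms} (lookup ps o) sh (wq-Undominated {f = f} (λ y∈ → wq-Gen-∖ (acc r) (h y∈)))
... | qs , qs≺ , cov = wq-⊆ (cover-Gen {ps} {ms = ms} o cov) (wq-Gen (r (replace-⊰ ps o qs≺)))

all-free : List Code
all-free = free clique ∷ free cycle ∷ []

Gen-all : ∀ t → Gen all-free t
Gen-all* : ∀ ts → ∃[ ms ] (word ms ≡ ts × All (_≡ nothing) (context ms) ×
                           (∀ {a} → inj₂ a ∈ₗ ms → Gen all-free a))

Gen-all (node f ts) with Gen-all* ts
Gen-all (node clique ts) | ms , refl , p , h = gen zero ms (refl , p) h
Gen-all (node cycle ts)  | ms , refl , p , h = gen (suc zero) ms (refl , p) h

Gen-all* []       = [] , refl , [] , λ ()
Gen-all* (t ∷ ts) with Gen-all* ts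
... | ms , refl , p , h = inj₂ t ∷ ms , refl , refl ∷ p ,
  λ { (here refl) → Gen-all t ; (there q) → h q }

kruskal : (s : ℕ → Tree) → ¬ (∀ i j → i < j → ¬ (s i ⊑ s j))
kruskal s = no-bad-sequence (wq-Gen (⊰-wellFounded all-free)) s (λ i → Gen-all (s i))

-- Contraction maps

Path : {V : Set} → (V → V → Set) → (V → Set) → V → V → Set
Path E P = Star (λ x y → E x y × P x × P y)

Conn : {V : Set} → (V → V → Set) → (V → Set) → Set
Conn E P = ∀ {x y} → P x → P y → Path E P x y

path-⊆ : ∀ {V : Set} {E : V → V → Set} {P Q : V → Set} → (∀ {x} → P x → Q x) →
         ∀ {x y} → Path E P x y → Path E Q x y
path-⊆ P⊆Q = Star.map λ (e , p , q) → e , P⊆Q p , P⊆Q q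

path-reverse : ∀ {V : Set} {E : V → V → Set} {P : V → Set} → (∀ {x y} → E x y → E y x) →
               ∀ {x y} → Path E P x y → Path E P y x
path-reverse s = Star.reverse λ (e , p , q) → s e , q , p

-- A whole contraction sequence as one map with nonempty connected fibres. Edges are relations and
-- vertex sets predicates, so that graphs, parts of graphs and quotients by partitions are all
-- covered.
record Con {V W : Set} (E : V → V → Set) (A : V → Set) (F : W → W → Set) (B : W → Set) : Set where
  field
    f     : V → W
    into  : ∀ {x} → A x → B (f x)
    onto  : ∀ {b} → B b → ∃[ x ] (A x × f x ≡ b)
    fibre : ∀ {x y} → A x → A y → f x ≡ f y → Path E (λ z → A z × f z ≡ f y) x y
    edge→ : ∀ {x y} → A x → A y → E x y → f x ≢ f y → F (f x) (f y)
    edge← : ∀ {a b} → B a → B b → F a b → ∃[ x ] ∃[ y ] (A x × A y × f x ≡ a × f y ≡ b × E x y)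

-- A path in a fibre of `d` is lifted edge by edge; the loose ends of consecutive lifts lie in a
-- common fibre of `c`, which is connected.
con-trans : ∀ {U V W : Set} {E : U → U → Set} {F : V → V → Set} {H : W → W → Set} {A B C} →
            Con E A F B → Con F B H C → Con E A H C
con-trans {E = E} {F} {A = A} {B} c d = record
  { f     = D.f ∘ C.f
  ; into  = D.into ∘ C.into
  ; onto  = λ Cz → let (y , By , eq) = D.onto Cz ; (x , Ax , eq′) = C.onto By
                   in x , Ax , trans (cong D.f eq′) eq
  ; fibre = λ Ax Ay eq → lift (D.fibre (C.into Ax) (C.into Ay) eq) Ax Ay refl refl refl
  ; edge→ = λ Ax Ay e ne → D.edge→ (C.into Ax) (C.into Ay) (C.edge→ Ax Ay e (ne ∘ cong D.f)) ne
  ; edge← = λ Ca Cb e →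
      let (p , q , Bp , Bq , pa , qb , e′) = D.edge← Ca Cb e
          (x , y , Ax , Ay , xp , yq , e″) = C.edge← Bp Bq e′
      in x , y , Ax , Ay , trans (cong D.f xp) pa , trans (cong D.f yq) qb , e″
  }
  where
  module C = Con c
  module D = Con d
  lift : ∀ {a b z} → Path F (λ w → B w × D.f w ≡ z) a b → ∀ {x y} → A x → A y →
         C.f x ≡ a → C.f y ≡ b → D.f b ≡ z → Path E (λ w → A w × D.f (C.f w) ≡ z) x y
  lift ε Ax Ay refl yb bz =
    path-⊆ (λ (Aw , eq) → Aw , trans (cong D.f (trans eq yb)) bz) (C.fibre Ax Ay (sym yb))
  lift ((e , (Ba , az) , (Bb , bz)) ◅ p) Ax Ay refl yb yz with C.edge← Ba Bb e
  ... | x′ , y′ , Ax′ , Ay′ , eq , refl , e′ =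
    path-⊆ (λ (Aw , eqw) → Aw , trans (cong D.f (trans eqw eq)) az) (C.fibre Ax Ax′ (sym eq))
    ◅◅ ((e′ , (Ax′ , trans (cong D.f eq) az) , (Ay′ , bz)) ◅ lift p Ay′ Ay refl yb yz)

Everything : ∀ {V : Set} → V → Set
Everything _ = ⊤

Model : Graph → Graph → Set
Model G H = Con (Edge G) Everything (Edge H) Everything

edge-sym : ∀ G {x y} → Edge G x y → Edge G y x
edge-sym G {x} {y} e = trans (adj-sym G y x) e

edge-≢ : ∀ G {x y} → Edge G x y → x ≢ y
edge-≢ G {x} e refl with trans (sym e) (adj-irr G x)
... | ()

edge? : ∀ G x y → Dec (Edge G x y)
edge? G x y = adj G x y ≟ᵇ true

bool-≡ : ∀ {b c} → (b ≡ true → c ≡ true) → (c ≡ true → b ≡ true) → b ≡ c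
bool-≡ {false} {false} _ _ = refl
bool-≡ {false} {true}  _ g = g refl
bool-≡ {true}  {false} f _ = sym (f refl)
bool-≡ {true}  {true}  _ _ = refl

does-true : ∀ {P : Set} (d : Dec P) → does d ≡ true → P
does-true (yes p) _ = p

module FromRelation {m : ℕ} (R : Fin m → Fin m → Set) (R? : ∀ x y → Dec (R x y))
  (R-sym : ∀ {x y} → R x y → R y x) (R-irr : ∀ {x} → ¬ R x x) where

  graph : Graph
  graph = record
    { n       = m
    ; adj     = λ x y → does (R? x y)
    ; adj-sym = λ x y → bool-≡ (λ e → dec-true (R? y x) (R-sym (does-true (R? x y) e)))
                               (λ e → dec-true (R? x y) (R-sym (does-true (R? y x) e)))
    ; adj-irr = λ x → bool-≡ (λ e → ⊥-elim (R-irr (does-true (R? x x) e))) (λ ())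
    }

  edge⁺ : ∀ {x y} → R x y → Edge graph x y
  edge⁺ {x} {y} = dec-true (R? x y)

  edge⁻ : ∀ {x y} → Edge graph x y → R x y
  edge⁻ {x} {y} = does-true (R? x y)

model-iso : ∀ {G H} → Iso G H → Model G H
model-iso {H = H} i = record
  { f     = to
  ; into  = λ _ → tt
  ; onto  = λ {b} _ → from b , tt , to-from b
  ; fibre = λ {x} {y} _ _ eq → subst (Path _ _ x) (trans (sym (from-to x)) (trans (cong from eq) (from-to y))) ε
  ; edge→ = λ {x} {y} _ _ e _ → trans (sym (adj-pres x y)) e
  ; edge← = λ {a} {b} _ _ e → from a , from b , tt , tt , to-from a , to-from b ,
      trans (adj-pres _ _) (subst₂ (Edge H) (sym (to-from a)) (sym (to-from b)) e)
  }
  where open Iso i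

model-contract : ∀ {G H} → ContractEdge G H → Model G H
model-contract {G} c = record
  { f     = f
  ; into  = λ _ → tt
  ; onto  = λ {b} _ → proj₁ (f-surj b) , tt , proj₂ (f-surj b)
  ; fibre = λ _ _ → fibre _ _
  ; edge→ = λ {x} {y} _ _ e ne → edge-from (f x) (f y) ne x y refl refl e
  ; edge← = λ {a} {b} _ _ e → let (_ , x , y , xa , yb , e′) = edge-to a b e in x , y , tt , tt , xa , yb , e′
  }
  where
  open ContractEdge c
  fibre : ∀ x y → f x ≡ f y → Path (Edge G) (λ z → ⊤ × f z ≡ f y) x y
  fibre x y eq with f-only-uv x y eq
  ... | inj₁ refl                 = ε
  ... | inj₂ (inj₁ (refl , refl)) = (uv-edge , (tt , eq) , (tt , refl)) ◅ ε
  ... | inj₂ (inj₂ (refl , refl)) = (edge-sym G uv-edge , (tt , eq) , (tt , refl)) ◅ ε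

model-id : ∀ {G} → Model G G
model-id {G} = model-iso {G} {G} (record { to = id ; from = id ; from-to = λ _ → refl ; to-from = λ _ → refl ; adj-pres = λ _ _ → refl })

≼⇒model : ∀ {G H} → H ≼ G → Model G H
≼⇒model {G} ε            = model-id {G}
≼⇒model (iso i ◅ s)      = con-trans (model-iso i) (≼⇒model s)
≼⇒model (contract c ◅ s) = con-trans (model-contract c) (≼⇒model s)

module _ (G H : Graph) (M : Model G H) where
  open Con M

  Collision : Set
  Collision = ∃[ x ] ∃[ y ] (x ≢ y × f x ≡ f y)

  collision? : Dec Collision
  collision? = any? λ x → any? λ y → ¬? (x ≟ y) ×-dec (f x ≟ f y)

  injective : ¬ Collision → ∀ {x y} → f x ≡ f y → x ≡ y
  injective ¬c {x} {y} eq with x ≟ y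
  ... | yes x≡y = x≡y
  ... | no  x≢y = ⊥-elim (¬c (x , y , x≢y , eq))

  section : Fin (n H) → Fin (n G)
  section b = proj₁ (onto {b} tt)

  f-section : ∀ b → f (section b) ≡ b
  f-section b = proj₂ (proj₂ (onto {b} tt))

  section-injective : ∀ {a b} → section a ≡ section b → a ≡ b
  section-injective {a} {b} eq = trans (sym (f-section a)) (trans (cong f eq) (f-section b))

  module _ (¬c : ¬ Collision) where
    private
      pres : ∀ x y → adj G x y ≡ adj H (f x) (f y)
      pres x y = bool-≡ (λ e → edge→ tt tt e (λ eq → edge-≢ G e (injective ¬c eq))) back
        where
        back : Edge H (f x) (f y) → Edge G x y
        back e with edge← tt tt e
        ... | _ , _ , _ , _ , p , q , e′ = subst₂ (Edge G) (injective ¬c p) (injective ¬c q) e′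

    model⇒iso : Iso G H
    model⇒iso = record
      { to = f ; from = section ; from-to = λ x → injective ¬c (f-section (f x))
      ; to-from = f-section ; adj-pres = pres }

    model⇒iso⁻¹ : Iso H G
    model⇒iso⁻¹ = record
      { to = section ; from = f ; from-to = f-section
      ; to-from = λ x → injective ¬c (f-section (f x))
      ; adj-pres = λ a b → trans (sym (cong₂ (adj H) (f-section a) (f-section b)))
                                 (sym (pres (section a) (section b))) }

  missed⇒< : ∀ {x₀} → (∀ b → section b ≢ x₀) → n H < n G
  missed⇒< {x₀} miss = injective⇒≤ {f = λ { zero → x₀ ; (suc a) → section a }} λ
    { {zero}  {zero}  _ → refl
    ; {zero}  {suc b} q → ⊥-elim (miss b (sym q))
    ; {suc a} {zero}  q → ⊥-elim (miss a q)
    ; {suc a} {suc b} q → cong suc (section-injective q) }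

  -- The section hits at most one of two colliding vertices, so it misses the other and is not onto.
  collision⇒< : Collision → n H < n G
  collision⇒< (u , v , u≢v , eq) with section (f u) ≟ u
  ... | yes p = missed⇒< {v} λ { b refl → u≢v (trans (sym p) (cong section (trans eq (f-section b)))) }
  ... | no ¬p = missed⇒< {u} λ { b refl → ¬p (cong section (f-section b)) }

  no-collision⇒≤ : ¬ Collision → n G ≤ n H
  no-collision⇒≤ ¬c = injective⇒≤ (injective ¬c)

-- From contraction maps back to edge contractions

module ContractPair {m : ℕ} (ad : Fin (suc m) → Fin (suc m) → Bool)
  (sy : ∀ x y → ad x y ≡ ad y x) (ir : ∀ x → ad x x ≡ false)
  (u v : Fin (suc m)) (uv : ad u v ≡ true) where

  G : Graph
  G = record { n = suc m ; adj = ad ; adj-sym = sy ; adj-irr = ir }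

  v≢u : v ≢ u
  v≢u refl = edge-≢ G uv refl

  -- Vertex `v` is deleted from the index set and sent where `u` goes, so `u` stands for the merged
  -- vertex.
  c : Fin (suc m) → Fin m
  c x with v ≟ x
  ... | yes _   = punchOut v≢u
  ... | no  v≢x = punchOut v≢x

  c-punchIn : ∀ a → c (punchIn v a) ≡ a
  c-punchIn a with v ≟ punchIn v a
  ... | yes p = ⊥-elim (punchInᵢ≢i v a (sym p))
  ... | no  _ = punchOut-punchIn v

  punchIn-c : ∀ x → x ≢ v → punchIn v (c x) ≡ x
  punchIn-c x x≢v with v ≟ x
  ... | yes p = ⊥-elim (x≢v (sym p))
  ... | no  q = punchIn-punchOut q

  punchIn-cv : punchIn v (c v) ≡ u
  punchIn-cv with v ≟ v
  ... | yes _ = punchIn-punchOut v≢u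
  ... | no  q = ⊥-elim (q refl)

  cu≡cv : c u ≡ c v
  cu≡cv = punchIn-injective v _ _ (trans (punchIn-c u (λ p → v≢u (sym p))) (sym punchIn-cv))

  R : Fin m → Fin m → Set
  R a b = a ≢ b × ∃[ x ] ∃[ y ] (c x ≡ a × c y ≡ b × Edge G x y)

  open FromRelation R
    (λ a b → ¬? (a ≟ b) ×-dec any? λ x → any? λ y → (c x ≟ a) ×-dec (c y ≟ b) ×-dec edge? G x y)
    (λ (ne , x , y , p , q , e) → (ne ∘ sym) , y , x , q , p , edge-sym G e)
    (λ (ne , _) → ne refl)

  contracted : ContractEdge G graph
  contracted = record
    { u = u ; v = v ; uv-edge = uv ; f = c
    ; f-surj = λ a → punchIn v a , c-punchIn a
    ; f-uv = cu≡cv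
    ; f-only-uv = only
    ; edge-to = λ a b e → edge⁻ e
    ; edge-from = λ a b ne x y p q e → edge⁺ (ne , x , y , p , q , e)
    }
    where
    only : ∀ x y → c x ≡ c y → x ≡ y ⊎ ((x ≡ u × y ≡ v) ⊎ (x ≡ v × y ≡ u))
    only x y eq with x ≟ v | y ≟ v
    ... | yes p | yes q = inj₁ (trans p (sym q))
    ... | yes refl | no q = inj₂ (inj₂ (refl , trans (sym (punchIn-c y q)) (trans (cong (punchIn v) (sym eq)) punchIn-cv)))
    ... | no p | yes refl = inj₂ (inj₁ (trans (sym (punchIn-c x p)) (trans (cong (punchIn v) eq) punchIn-cv) , refl))
    ... | no p | no q = inj₁ (trans (sym (punchIn-c x p)) (trans (cong (punchIn v) eq) (punchIn-c y q)))

  module _ {H : Graph} (M : Model G H) (fuv : Con.f M u ≡ Con.f M v) where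
    open Con M

    f-c : ∀ x → f (punchIn v (c x)) ≡ f x
    f-c x with x ≟ v
    ... | yes refl = trans (cong f punchIn-cv) fuv
    ... | no  x≢v  = cong f (punchIn-c x x≢v)

    push : ∀ {z x y} → Path (Edge G) (λ w → ⊤ × f w ≡ z) x y →
           Path (Edge graph) (λ w → ⊤ × f (punchIn v w) ≡ z) (c x) (c y)
    push ε = ε
    push {x = x} (_◅_ {j = w} (e , (_ , p) , (_ , q)) s) with c x ≟ c w
    ... | yes eq = subst (λ a → Path _ _ a _) (sym eq) (push s)
    ... | no  ne = (edge⁺ (ne , x , w , refl , refl , e) , (tt , trans (f-c x) p) , (tt , trans (f-c w) q)) ◅ push s

    -- Both ends of the contracted edge lie in one fibre, so the map factors. Fibres stay connected
    -- because `push` carries their paths over, dropping the steps that collapse.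
    quotient-model : Model graph H
    quotient-model = record
      { f     = λ a → f (punchIn v a)
      ; into  = λ _ → tt
      ; onto  = λ b → let (x , _ , eq) = onto b in c x , tt , trans (f-c x) eq
      ; fibre = λ {a} {b} _ _ eq →
          subst₂ (Path (Edge graph) _) (c-punchIn a) (c-punchIn b) (push (fibre tt tt eq))
      ; edge→ = λ _ _ e ne → descend (edge⁻ e) ne
      ; edge← = λ {a} {b} _ _ e →
          let (x , y , _ , _ , p , q , e′) = edge← tt tt e
              p′ = trans (f-c x) p
              q′ = trans (f-c y) q
          in c x , c y , tt , tt , p′ , q′ ,
             edge⁺ ((λ eq → edge-≢ H e (trans (sym p′) (trans (cong (λ z → f (punchIn v z)) eq) q′))) ,
                    x , y , refl , refl , e′)
      }
      where
      descend : ∀ {a b} → R a b → f (punchIn v a) ≢ f (punchIn v b) →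
                Edge H (f (punchIn v a)) (f (punchIn v b))
      descend (_ , x , y , refl , refl , e) ne =
        subst₂ (Edge H) (sym (f-c x)) (sym (f-c y))
          (edge→ tt tt e (λ eq → ne (trans (f-c x) (trans eq (sym (f-c y))))))

-- A collision yields a nontrivial path inside a fibre; its first edge can be contracted. This costs
-- a vertex each time, and a map without collisions is an isomorphism.
model⇒≼ : ∀ {G H} → Model G H → H ≼ G
model⇒≼ {G} {H} = go (n G) G refl
  where
  go : ∀ m G → n G ≡ m → Model G H → H ≼ G
  go m G eq M with collision? G H M
  ... | no ¬c = iso (model⇒iso G H M ¬c) ◅ ε
  go zero record { n = zero } refl M | yes (() , _)
  go (suc m) G@record { n = suc m ; adj = ad ; adj-sym = sy ; adj-irr = ir } refl M | yes (x , y , x≢y , eq)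
    with Con.fibre M {x} {y} tt tt eq
  ... | ε = ⊥-elim (x≢y refl)
  ... | _◅_ {j = w} (e , (_ , p) , (_ , q)) _ =
    contract C.contracted ◅ go m _ refl (C.quotient-model {H} M (trans p (sym q)))
    where module C = ContractPair ad sy ir x w e

≼⇒≽⊎< : ∀ {G H} → H ≼ G → G ≼ H ⊎ n H < n G
≼⇒≽⊎< {G} {H} H≼G with collision? G H (≼⇒model H≼G)
... | yes c  = inj₂ (collision⇒< G H (≼⇒model H≼G) c)
... | no  ¬c = inj₁ (iso (model⇒iso⁻¹ G H (≼⇒model H≼G) ¬c) ◅ ε)

-- Coding rooted graphs by trees

Next : ∀ {k} → Fin k → Fin k → Set
Next i j = toℕ j ≡ suc (toℕ i)

PathAdj : ∀ {k} → Fin k → Fin k → Set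
PathAdj i j = Next i j ⊎ Next j i

CycAdj : ∀ {k} → Fin k → Fin k → Set
CycAdj {k} i j = PathAdj i j ⊎ (toℕ i ≡ 0 × suc (toℕ j) ≡ k) ⊎ (toℕ j ≡ 0 × suc (toℕ i) ≡ k)

-- Only consulted at distinct indices: hence the constant relation for cliques, and cycles on at
-- most three indices agree with cliques.
Skel : Label → ∀ {k} → Fin k → Fin k → Set
Skel clique i j = ⊤
Skel cycle  i j = CycAdj i j

interval-path : ∀ {k} (i j : Fin k) {P : Fin k → Set} → toℕ i ≤ toℕ j →
  (∀ {m} → toℕ i ≤ toℕ m → toℕ m ≤ toℕ j → P m) → Path PathAdj P i j
interval-path {k} i j {P} i≤j h = go _ i (m+[n∸m]≡n i≤j) (λ p q → h p q)
  where
  go : ∀ d i → toℕ i + d ≡ toℕ j → (∀ {m} → toℕ i ≤ toℕ m → toℕ m ≤ toℕ j → P m) → Path PathAdj P i j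
  go zero i eq h = subst (Path PathAdj P i) (toℕ-injective (trans (sym (+-identityʳ _)) eq)) ε
  go (suc d) i eq h =
    (inj₁ i′≡ , h ≤-refl (≤-trans (m≤m+n _ _) (≤-reflexive eq)) ,
     h (≤-trans (n≤1+n _) (≤-reflexive (sym i′≡))) (≤-trans (≤-reflexive i′≡) i<j)) ◅
    go d i′ (trans (cong (_+ d) i′≡) eq′) (λ p q → h (≤-trans (n≤1+n _) (≤-trans (≤-reflexive (sym i′≡)) p)) q)
    where
    eq′ : suc (toℕ i + d) ≡ toℕ j
    eq′ = trans (sym (+-suc _ d)) eq
    i<j : toℕ i < toℕ j
    i<j = ≤-trans (s≤s (m≤m+n (toℕ i) d)) (≤-reflexive eq′)
    i′ : Fin k
    i′ = fromℕ< (≤-trans (s≤s i<j) (toℕ<n j))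
    i′≡ : toℕ i′ ≡ suc (toℕ i)
    i′≡ = toℕ-fromℕ< _

PathAdj-sym : ∀ {k} {i j : Fin k} → PathAdj i j → PathAdj j i
PathAdj-sym (inj₁ p) = inj₂ p
PathAdj-sym (inj₂ p) = inj₁ p

PathAdj-≢ : ∀ {k} {i j : Fin k} → PathAdj i j → i ≢ j
PathAdj-≢ (inj₁ p) refl = 1+n≢n (sym p)
PathAdj-≢ (inj₂ p) refl = 1+n≢n (sym p)

SkelStep : Label → ∀ {k} → Fin k → Fin k → Set
SkelStep f i j = i ≢ j × Skel f i j

cycle-path : ∀ {k} {P : Fin k → Set} {i j} → Path PathAdj P i j → Path (SkelStep cycle) P i j
cycle-path = Star.map λ (e , p , q) → (PathAdj-≢ e , inj₁ e) , p , q

skel-path : ∀ f {k} (i j : Fin k) → Path (SkelStep f) Everything i j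
skel-path clique i j with i ≟ j
... | yes refl = ε
... | no i≢j   = ((i≢j , tt) , tt , tt) ◅ ε
skel-path cycle i j with ≤-total (toℕ i) (toℕ j)
... | inj₁ i≤j = cycle-path (interval-path i j i≤j λ _ _ → tt)
... | inj₂ j≤i = cycle-path (path-reverse PathAdj-sym (interval-path j i j≤i λ _ _ → tt))

-- Rep G t A a: the part of G induced by A, rooted at a, is coded by t.  The children of a node
-- are the parts attached to the vertices of one block; the first one is attached to the root and
-- contains the remaining blocks at the root.
data Rep (G : Graph) : Tree → (Fin (n G) → Set) → Fin (n G) → Set₁

-- The relation `Q` is left open because the record also describes unfinished blocks: a path of
-- pieces, before a root closes it to a cycle.
record Pieces (G : Graph) (A : Fin (n G) → Set) (k : ℕ) (Q : Fin k → Fin k → Set) : Set₁ where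
  inductive
  constructor pieces
  field
    π     : Fin (n G) → Fin k
    ρ     : Fin k → Fin (n G)
    t     : Fin k → Tree
    rep   : ∀ i → Rep G (t i) (λ x → A x × π x ≡ i) (ρ i)
    edge→ : ∀ {x y} → A x → A y → Edge G x y → π x ≢ π y →
            x ≡ ρ (π x) × y ≡ ρ (π y) × Q (π x) (π y)
    edge← : ∀ {i j} → i ≢ j → Q i j → Edge G (ρ i) (ρ j)

data Rep G where
  leaf   : ∀ {f A a} → A a → (∀ {x} → A x → x ≡ a) → Rep G (node f []) A a
  branch : ∀ {f ts A a k} (P : Pieces G A (suc k) (Skel f)) →
           ts ≡ tabulate (Pieces.t P) → a ≡ Pieces.ρ P zero → Rep G (node f ts) A a

rep-root : ∀ {G t A a} → Rep G t A a → A a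
rep-root (leaf Aa _) = Aa
rep-root (branch (pieces π ρ t rep _ _) _ refl) = proj₁ (rep-root (rep zero))

rep-path : ∀ {G t A a} → Rep G t A a → ∀ {x} → A x → Path (Edge G) A x a
rep-path (leaf Aa only) Ax = subst (Path _ _ _) (only Ax) ε
rep-path {G} {A = A} (branch {f} (pieces π ρ t rep edge→ edge←) _ refl) {x} Ax =
  path-⊆ proj₁ (rep-path (rep (π x)) (Ax , refl)) ◅◅
  Star.gmap ρ (λ { {i} {j} ((i≢j , q) , _) → edge← i≢j q , proj₁ (rep-root (rep i)) , proj₁ (rep-root (rep j)) })
    (skel-path f (π x) zero)

rep-resp : ∀ {G t A B a} → (∀ {x} → A x → B x) → (∀ {x} → B x → A x) → Rep G t A a → Rep G t B a
rep-resp to from (leaf Aa only) = leaf (to Aa) (only ∘ from)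
rep-resp to from (branch (pieces π ρ t rep edge→ edge←) eq eq′) =
  branch (pieces π ρ t (λ i → rep-resp (λ (Ax , e) → to Ax , e) (λ (Bx , e) → from Bx , e) (rep i))
            (λ Bx By → edge→ (from Bx) (from By)) edge←) eq eq′

-- Sublists of children as contractions of skeletons

record Lin {k l : ℕ} (T : Fin k → Tree) (U : Fin l → Tree) : Set where
  field
    φ     : Fin l → Fin (suc k)
    σ     : Fin k → Fin l
    φσ    : ∀ i → φ (σ i) ≡ suc i
    emb   : ∀ i → T i ⊑ U (σ i)
    step  : ∀ {p q} → Next p q → toℕ (φ q) ≡ toℕ (φ p) ⊎ toℕ (φ q) ≡ suc (toℕ (φ p))
    first : ∀ q → toℕ q ≡ 0 → toℕ (φ q) ≤ 1
    last  : ∀ q → suc (toℕ q) ≡ l → toℕ (φ q) ≡ k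
    empty : l ≡ 0 → k ≡ 0
    least : ∀ {p} i → Next p (σ i) → toℕ (φ p) ≡ toℕ i
    mono  : ∀ {p q} → toℕ p ≤ toℕ q → toℕ (φ p) ≤ toℕ (φ q)

  σ-first : ∀ i → toℕ (σ i) ≡ 0 → toℕ i ≡ 0
  σ-first i eq with subst (λ z → toℕ z ≤ 1) (φσ i) (first (σ i) eq)
  ... | s≤s z≤n′ = ≤-antisym z≤n′ z≤n

-- φ q = 0 means that position q comes before the image of the first element,
-- and φ q = i + 1 that the last embedded element before (or at) q is the i-th.
lin : ∀ k l (T : Fin k → Tree) (U : Fin l → Tree) → Sublist _⊑_ (tabulate T) (tabulate U) → Lin T U
lin zero zero T U [] = record
  { φ = λ () ; σ = λ () ; φσ = λ () ; emb = λ () ; step = λ { {()} } ; first = λ () ; last = λ ()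
  ; empty = λ _ → refl ; least = λ () ; mono = λ { {()} } }
lin k (suc l) T U (_ ∷ʳ s) = record
  { φ = φ ; σ = suc ∘ L.σ ; φσ = L.φσ ; emb = L.emb ; step = λ {p} {q} → step p q ; first = first
  ; last = last ; empty = λ () ; least = λ {p} → least p ; mono = λ {p} {q} → mono p q }
  where
  module L = Lin (lin k l T (U ∘ suc) s)
  φ : Fin (suc l) → Fin (suc k)
  φ zero    = zero
  φ (suc q) = L.φ q
  step : ∀ p q → Next p q → toℕ (φ q) ≡ toℕ (φ p) ⊎ toℕ (φ q) ≡ suc (toℕ (φ p))
  step zero (suc q) eq with toℕ (L.φ q) | L.first q (suc-injective eq)
  ... | 0 | _ = inj₁ refl
  ... | 1 | _ = inj₂ refl
  ... | suc (suc _) | s≤s ()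
  step (suc p) (suc q) eq = L.step (suc-injective eq)
  first : ∀ q → toℕ q ≡ 0 → toℕ (φ q) ≤ 1
  first zero _ = z≤n
  last : ∀ q → suc (toℕ q) ≡ suc l → toℕ (φ q) ≡ k
  last zero    eq = sym (L.empty (sym (suc-injective eq)))
  last (suc q) eq = L.last q (suc-injective eq)
  least : ∀ p i → Next p (suc (L.σ i)) → toℕ (φ p) ≡ toℕ i
  least zero    i eq = sym (L.σ-first i (suc-injective eq))
  least (suc p) i eq = L.least i (suc-injective eq)
  mono : ∀ p q → toℕ p ≤ toℕ q → toℕ (φ p) ≤ toℕ (φ q)
  mono zero    q       _        = z≤n
  mono (suc p) (suc q) (s≤s le) = L.mono le
lin (suc k) (suc l) T U (r ∷ s) = record
  { φ = φ ; σ = σ ; φσ = φσ ; emb = emb ; step = λ {p} {q} → step p q ; first = first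
  ; last = last ; empty = λ () ; least = λ {p} → least p ; mono = λ {p} {q} → mono p q }
  where
  module L = Lin (lin k l (T ∘ suc) (U ∘ suc) s)
  φ : Fin (suc l) → Fin (suc (suc k))
  φ zero    = suc zero
  φ (suc q) = suc (L.φ q)
  σ : Fin (suc k) → Fin (suc l)
  σ zero    = zero
  σ (suc i) = suc (L.σ i)
  φσ : ∀ i → φ (σ i) ≡ suc i
  φσ zero    = refl
  φσ (suc i) = cong suc (L.φσ i)
  emb : ∀ i → T i ⊑ U (σ i)
  emb zero    = r
  emb (suc i) = L.emb i
  step : ∀ p q → Next p q → toℕ (φ q) ≡ toℕ (φ p) ⊎ toℕ (φ q) ≡ suc (toℕ (φ p))
  step zero (suc q) eq with toℕ (L.φ q) | L.first q (suc-injective eq)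
  ... | 0 | _ = inj₁ refl
  ... | 1 | _ = inj₂ refl
  ... | suc (suc _) | s≤s ()
  step (suc p) (suc q) eq with L.step {p} {q} (suc-injective eq)
  ... | inj₁ e = inj₁ (cong suc e)
  ... | inj₂ e = inj₂ (cong suc e)
  first : ∀ q → toℕ q ≡ 0 → toℕ (φ q) ≤ 1
  first zero _ = ≤-refl
  last : ∀ q → suc (toℕ q) ≡ suc l → toℕ (φ q) ≡ suc k
  last zero    eq = cong suc (sym (L.empty (sym (suc-injective eq))))
  last (suc q) eq = cong suc (L.last q (suc-injective eq))
  least : ∀ p i → Next p (σ i) → toℕ (φ p) ≡ toℕ i
  least p       zero    ()
  least zero    (suc i) eq = cong suc (sym (L.σ-first i (suc-injective eq)))
  least (suc p) (suc i) eq = cong suc (L.least i (suc-injective eq))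
  mono : ∀ p q → toℕ p ≤ toℕ q → toℕ (φ p) ≤ toℕ (φ q)
  mono zero    zero    _        = ≤-refl
  mono zero    (suc q) _        = s≤s z≤n
  mono (suc p) (suc q) (s≤s le) = s≤s (L.mono le)

-- A contraction of skeletons, with a section σ choosing the positions whose pieces survive.
record SkelMap (f : Label) {k l : ℕ} (T : Fin (suc k) → Tree) (U : Fin (suc l) → Tree) : Set where
  field
    φ      : Fin (suc l) → Fin (suc k)
    σ      : Fin (suc k) → Fin (suc l)
    φσ     : ∀ i → φ (σ i) ≡ i
    emb    : ∀ i → T i ⊑ U (σ i)
    φ-zero : φ zero ≡ zero
    to-σ   : ∀ q → Path (SkelStep f) (λ p → φ p ≡ φ q) q (σ (φ q))
    adj→   : ∀ {p q} → Skel f p q → φ p ≢ φ q → Skel f (φ p) (φ q)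
    adj←   : ∀ {i j} → i ≢ j → Skel f i j → ∃[ p ] ∃[ q ] (φ p ≡ i × φ q ≡ j × Skel f p q)

-- Turns the count `φ` of `Lin` into an index. The truncation merges the positions before the first
-- embedded child with that child, so that position zero, the root, goes to index zero.
predᶠ : ∀ {k} → Fin (suc (suc k)) → Fin (suc k)
predᶠ zero    = zero
predᶠ (suc i) = i

predᶠ-mono : ∀ {k} {i j : Fin (suc (suc k))} → toℕ i ≤ toℕ j → toℕ (predᶠ i) ≤ toℕ (predᶠ j)
predᶠ-mono {i = zero}          le       = z≤n
predᶠ-mono {i = suc i} {suc j} (s≤s le) = le

predᶠ-suc : ∀ {k} (i : Fin (suc (suc k))) {m} → toℕ i ≡ suc m → toℕ (predᶠ i) ≡ m
predᶠ-suc (suc i) eq = suc-injective eq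

predᶠ-first : ∀ {k} (i : Fin (suc (suc k))) → toℕ i ≤ 1 → predᶠ i ≡ zero
predᶠ-first zero           _        = refl
predᶠ-first (suc zero)     _        = refl
predᶠ-first (suc (suc i)) (s≤s ())

-- The index map is monotone with steps of at most one, so its fibres are intervals and connected
-- along the path. First and last positions go to first and last indices, which preserves the
-- closing edge of a cycle.
skelMap : ∀ f {k l} (T : Fin (suc k) → Tree) (U : Fin (suc l) → Tree) →
          Sublist _⊑_ (tabulate T) (tabulate U) → SkelMap f T U
skelMap f {k} {l} T U s = record
  { φ = φ ; σ = L.σ ; φσ = φσ ; emb = L.emb ; φ-zero = φ-first zero refl
  ; to-σ = to-σ f ; adj→ = adj→ f ; adj← = adj← f }
  where
  module L = Lin (lin (suc k) (suc l) T U s)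
  φ : Fin (suc l) → Fin (suc k)
  φ = predᶠ ∘ L.φ
  φσ : ∀ i → φ (L.σ i) ≡ i
  φσ i = cong predᶠ (L.φσ i)
  φ-first : ∀ q → toℕ q ≡ 0 → φ q ≡ zero
  φ-first q eq = predᶠ-first (L.φ q) (L.first q eq)
  φ-last : ∀ q → suc (toℕ q) ≡ suc l → suc (toℕ (φ q)) ≡ suc k
  φ-last q eq = cong suc (predᶠ-suc (L.φ q) (L.last q eq))
  between : ∀ {p q r} → toℕ p ≤ toℕ q → toℕ q ≤ toℕ r → φ p ≡ φ r → φ q ≡ φ r
  between {p} {q} {r} p≤q q≤r eq = toℕ-injective (≤-antisym (predᶠ-mono (L.mono q≤r))
    (≤-trans (≤-reflexive (cong toℕ (sym eq))) (predᶠ-mono (L.mono p≤q))))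
  to-σ : ∀ f q → Path (SkelStep f) (λ p → φ p ≡ φ q) q (L.σ (φ q))
  to-σ clique q with q ≟ L.σ (φ q)
  ... | yes eq = subst (Path _ _ q) eq ε
  ... | no  ne = ((ne , tt) , refl , φσ (φ q)) ◅ ε
  to-σ cycle q with ≤-total (toℕ q) (toℕ (L.σ (φ q)))
  ... | inj₁ le = cycle-path (interval-path _ _ le λ p p′ → trans (between p p′ (sym (φσ _))) (φσ _))
  ... | inj₂ ge = cycle-path (path-reverse PathAdj-sym (interval-path _ _ ge λ p p′ → between p p′ (φσ _)))
  next : ∀ {p q} → Next p q → φ p ≢ φ q → Next (φ p) (φ q)
  next {p} {q} e ne with L.φ p | L.φ q | L.step {p} {q} e
  ... | x     | y         | inj₁ eq = ⊥-elim (ne (cong predᶠ (toℕ-injective (sym eq))))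
  ... | zero  | suc zero  | inj₂ _  = ⊥-elim (ne refl)
  ... | suc x | suc y     | inj₂ eq = suc-injective eq
  adj→ : ∀ f {p q} → Skel f p q → φ p ≢ φ q → Skel f (φ p) (φ q)
  adj→ clique _ _ = tt
  adj→ cycle {p} {q} (inj₁ (inj₁ e)) ne = inj₁ (inj₁ (next {p} {q} e ne))
  adj→ cycle {p} {q} (inj₁ (inj₂ e)) ne = inj₁ (inj₂ (next {q} {p} e (ne ∘ sym)))
  adj→ cycle {p} {q} (inj₂ (inj₁ (e , e′))) ne = inj₂ (inj₁ (cong toℕ (φ-first p e) , φ-last q e′))
  adj→ cycle {p} {q} (inj₂ (inj₂ (e , e′))) ne = inj₂ (inj₂ (cong toℕ (φ-first q e) , φ-last p e′))
  -- The position directly before `σ j` has not yet counted `j`, so it carries the preceding index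
  -- and witnesses the edge.
  unnext : ∀ {i j} → Next i j → ∃[ p ] (φ p ≡ i × Next p (L.σ j))
  unnext {i} {j} e with L.σ j | (λ p → L.least {p} j) | L.σ-first j
  ... | zero  | _ | σ0 = ⊥-elim (1+n≢0 (trans (sym e) (σ0 refl)))
  ... | suc q | least | _ = inject₁ q ,
    toℕ-injective (predᶠ-suc (L.φ (inject₁ q)) (trans (least _ (cong suc (sym (toℕ-inject₁ q)))) e)) ,
    cong suc (sym (toℕ-inject₁ q))
  adj← : ∀ f {i j} → i ≢ j → Skel f i j → ∃[ p ] ∃[ q ] (φ p ≡ i × φ q ≡ j × Skel f p q)
  adj← clique {i} {j} _ _ = L.σ i , L.σ j , φσ i , φσ j , tt
  adj← cycle {i} {j} _ (inj₁ (inj₁ e)) with unnext e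
  ... | p , eq , e′ = p , L.σ j , eq , φσ j , inj₁ (inj₁ e′)
  adj← cycle {i} {j} _ (inj₁ (inj₂ e)) with unnext e
  ... | p , eq , e′ = L.σ i , p , φσ i , eq , inj₁ (inj₂ e′)
  adj← cycle {i} {j} _ (inj₂ (inj₁ (e , e′))) =
    zero , fromℕ l , trans (φ-first zero refl) (toℕ-injective (sym e)) ,
    toℕ-injective (suc-injective (trans (φ-last (fromℕ l) (cong suc (toℕ-fromℕ l))) (sym e′))) ,
    inj₂ (inj₁ (refl , cong suc (toℕ-fromℕ l)))
  adj← cycle {i} {j} _ (inj₂ (inj₂ (e , e′))) =
    fromℕ l , zero ,
    toℕ-injective (suc-injective (trans (φ-last (fromℕ l) (cong suc (toℕ-fromℕ l))) (sym e′))) ,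
    trans (φ-first zero refl) (toℕ-injective (sym e)) ,
    inj₂ (inj₂ (refl , cong suc (toℕ-fromℕ l)))

-- Tree embedding implies rooted contraction

RootedCon : (G : Graph) (A : Fin (n G) → Set) → Fin (n G) → (H : Graph) (B : Fin (n H) → Set) → Fin (n H) → Set
RootedCon G A a H B b = Σ (Con (Edge G) A (Edge H) B) λ c → Con.f c a ≡ b

con-point : ∀ {G A a} {H : Graph} {B : Fin (n H) → Set} {b} → (∀ {x} → A x → Path (Edge G) A x a) → A a →
            B b → (∀ {x} → B x → x ≡ b) → RootedCon G A a H B b
con-point {G} {A} {a} {H} {B} {b} path Aa Bb only = record
  { f     = λ _ → b
  ; into  = λ _ → Bb
  ; onto  = λ Bx → a , Aa , sym (only Bx)
  ; fibre = λ Ax Ay _ → path-⊆ (λ Az → Az , refl) (path Ax ◅◅ path-reverse (edge-sym G) (path Ay))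
  ; edge→ = λ _ _ _ ne → ⊥-elim (ne refl)
  ; edge← = λ Bx By e → ⊥-elim (edge-≢ H e (trans (only Bx) (sym (only By))))
  } , refl

module _ {G : Graph} {A : Fin (n G) → Set} {k Q} (P : Pieces G A k Q) where
  open Pieces P

  ρ∈ : ∀ i → A (ρ i)
  ρ∈ i = proj₁ (rep-root (rep i))

  πρ : ∀ i → π (ρ i) ≡ i
  πρ i = proj₂ (rep-root (rep i))

module _ {G : Graph} {A : Fin (n G) → Set} {k} {f} (P : Pieces G A (suc k) (Skel f)) where
  open Pieces P

  -- The contraction behind `down`: all other pieces collapse to `ρ i`. They are joined to it along
  -- the roots, all of which have this same image.
  con-piece : ∀ i → RootedCon G A (ρ zero) G (λ x → A x × π x ≡ i) (ρ i)
  con-piece i = record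
    { f     = g
    ; into  = λ {x} → into x
    ; onto  = λ {b} (Ab , eq) → b , Ab , g-in b eq
    ; fibre = λ {x} {y} Ax Ay eq → path-⊆ (λ (Az , e) → Az , trans e eq) (to-g x Ax) ◅◅
        subst (λ z → Path _ _ z y) (sym eq) (path-reverse (edge-sym G) (to-g y Ay))
    ; edge→ = λ {x} {y} → edge x y
    ; edge← = λ {a} {b} (Aa , ea) (Ab , eb) e → a , b , Aa , Ab , g-in a ea , g-in b eb , e
    } , g-ρ zero
    where
    g : Fin (n G) → Fin (n G)
    g x with π x ≟ i
    ... | yes _ = x
    ... | no  _ = ρ i
    g-in : ∀ x → π x ≡ i → g x ≡ x
    g-in x eq with π x ≟ i
    ... | yes _ = refl
    ... | no ne = ⊥-elim (ne eq)
    g-out : ∀ x → π x ≢ i → g x ≡ ρ i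
    g-out x ne with π x ≟ i
    ... | yes eq = ⊥-elim (ne eq)
    ... | no _   = refl
    g-ρ : ∀ j → g (ρ j) ≡ ρ i
    g-ρ j with π (ρ j) ≟ i
    ... | yes eq = cong ρ (trans (sym (πρ P j)) eq)
    ... | no _   = refl
    into : ∀ x → A x → A (g x) × π (g x) ≡ i
    into x Ax with π x ≟ i
    ... | yes eq = Ax , eq
    ... | no _   = ρ∈ P i , πρ P i
    to-g : ∀ x → A x → Path (Edge G) (λ z → A z × g z ≡ g x) x (g x)
    to-g x Ax with π x ≟ i
    ... | yes eq = ε
    ... | no ne  =
      path-⊆ (λ {z} (Az , eq) → Az , g-out z (ne ∘ trans (sym eq))) (rep-path (rep (π x)) (Ax , refl)) ◅◅
      Star.gmap ρ (λ { {p} {q} ((p≢q , s) , _) → edge← p≢q s , (ρ∈ P p , g-ρ p) , (ρ∈ P q , g-ρ q) })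
        (skel-path f (π x) i)
    edge : ∀ x y → A x → A y → Edge G x y → g x ≢ g y → Edge G (g x) (g y)
    edge x y Ax Ay e ne with π x ≟ i | π y ≟ i
    ... | yes _ | yes _ = e
    ... | no _  | no _  = ⊥-elim (ne refl)
    ... | yes p | no q  = ⊥-elim (ne (trans (proj₁ (edge→ Ax Ay e λ eq → q (trans (sym eq) p))) (cong ρ p)))
    ... | no p  | yes q = ⊥-elim (ne (sym (trans (proj₁ (proj₂ (edge→ Ax Ay e λ eq → p (trans eq q)))) (cong ρ q))))

module _ {G H : Graph} {A : Fin (n G) → Set} {B : Fin (n H) → Set} {k l} {f}
  (P : Pieces G A (suc l) (Skel f)) (R : Pieces H B (suc k) (Skel f))
  (S : SkelMap f (Pieces.t R) (Pieces.t P)) where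

  private
    module P = Pieces P
    module R = Pieces R
    open SkelMap S

  -- Chosen pieces are contracted as given; every other piece collapses to the root of the target
  -- piece with which it is merged. Since all roots over one index share their image, the fibre over
  -- it is connected through a skeleton path to the chosen piece.
  con-pieces : (∀ i → RootedCon G (λ x → A x × P.π x ≡ σ i) (P.ρ (σ i)) H (λ x → B x × R.π x ≡ i) (R.ρ i)) →
               RootedCon G A (P.ρ zero) H B (R.ρ zero)
  con-pieces cs = record
    { f     = F
    ; into  = λ {x} Ax → proj₁ (F-piece x Ax)
    ; onto  = onto
    ; fibre = λ {x} {y} → fibre x y
    ; edge→ = λ {x} {y} → edge→ x y
    ; edge← = λ {a} {b} → edge← a b
    } , trans (F-ρ zero) (cong R.ρ φ-zero)
    where
    module C i = Con (proj₁ (cs i))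
    pm : Fin (suc l) → Fin (n G) → Fin (n H)
    pm q x with σ (φ q) ≟ q
    ... | yes _ = C.f (φ q) x
    ... | no  _ = R.ρ (φ q)
    F : Fin (n G) → Fin (n H)
    F x = pm (P.π x) x
    pm-out : ∀ q x → σ (φ q) ≢ q → pm q x ≡ R.ρ (φ q)
    pm-out q x ne with σ (φ q) ≟ q
    ... | yes eq = ⊥-elim (ne eq)
    ... | no  _  = refl
    pm-in : ∀ q x → σ (φ q) ≡ q → pm q x ≡ C.f (φ q) x
    pm-in q x eq with σ (φ q) ≟ q
    ... | yes _ = refl
    ... | no ne = ⊥-elim (ne eq)
    F-σ : ∀ i x → P.π x ≡ σ i → F x ≡ C.f i x
    F-σ i x eq = trans (cong (λ q → pm q x) eq)
      (trans (pm-in (σ i) x (cong σ (φσ i))) (cong (λ j → C.f j x) (φσ i)))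
    F-out : ∀ x q → P.π x ≡ q → σ (φ q) ≢ q → F x ≡ R.ρ (φ q)
    F-out x _ refl ne = pm-out _ x ne
    F-ρ : ∀ q → F (P.ρ q) ≡ R.ρ (φ q)
    F-ρ q = trans (cong (λ p → pm p (P.ρ q)) (πρ P q)) (by-cases (σ (φ q) ≟ q))
      where
      by-cases : Dec (σ (φ q) ≡ q) → pm q (P.ρ q) ≡ R.ρ (φ q)
      by-cases (no ne)  = pm-out q _ ne
      by-cases (yes eq) = trans (pm-in q _ eq) (trans (cong (C.f (φ q) ∘ P.ρ) (sym eq)) (proj₂ (cs (φ q))))
    F-piece : ∀ x → A x → B (F x) × R.π (F x) ≡ φ (P.π x)
    F-piece x Ax with σ (φ (P.π x)) ≟ P.π x
    ... | yes eq = C.into (φ (P.π x)) (Ax , sym eq)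
    ... | no _   = ρ∈ R _ , πρ R _
    onto : ∀ {b} → B b → ∃[ x ] (A x × F x ≡ b)
    onto {b} Bb with C.onto (R.π b) (Bb , refl)
    ... | x , (Ax , eq) , eq′ = x , Ax , trans (F-σ _ x eq) eq′
    within : ∀ i {x y} → A x → A y → P.π x ≡ σ i → P.π y ≡ σ i → F x ≡ F y →
             Path (Edge G) (λ z → A z × F z ≡ F y) x y
    within i {x} {y} Ax Ay px py eq =
      path-⊆ (λ {z} ((Az , pz) , e) → Az , trans (F-σ i z pz) (trans e (sym (F-σ i y py))))
        (C.fibre i (Ax , px) (Ay , py) (trans (sym (F-σ i x px)) (trans eq (F-σ i y py))))
    hub : ∀ x → A x → F x ≡ R.ρ (φ (P.π x)) →
          Path (Edge G) (λ z → A z × F z ≡ R.ρ (φ (P.π x))) x (P.ρ (σ (φ (P.π x))))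
    hub x Ax eq with σ (φ (P.π x)) ≟ P.π x
    ... | yes e = path-⊆ (λ (Az , e′) → Az , trans e′ F-hub)
            (within (φ (P.π x)) Ax (ρ∈ P _) (sym e) (πρ P _) (trans (F-σ _ x (sym e)) (trans eq (sym F-hub))))
      where
      F-hub : F (P.ρ (σ (φ (P.π x)))) ≡ R.ρ (φ (P.π x))
      F-hub = trans (F-ρ _) (cong R.ρ (φσ _))
    ... | no ne =
      path-⊆ (λ {z} (Az , pz) → Az , F-out z (P.π x) pz ne) (rep-path (P.rep (P.π x)) (Ax , refl)) ◅◅
      Star.gmap P.ρ (λ { {p} {q} ((p≢q , s) , ep , eq) → P.edge← p≢q s ,
          (ρ∈ P p , trans (F-ρ p) (cong R.ρ ep)) , (ρ∈ P q , trans (F-ρ q) (cong R.ρ eq)) })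
        (to-σ (P.π x))
    fibre : ∀ x y → A x → A y → F x ≡ F y → Path (Edge G) (λ z → A z × F z ≡ F y) x y
    fibre x y Ax Ay eq = by-cases (σ (φ (P.π x)) ≟ P.π x) (σ (φ (P.π y)) ≟ P.π y)
      where
      φ≡ : φ (P.π x) ≡ φ (P.π y)
      φ≡ = trans (sym (proj₂ (F-piece x Ax))) (trans (cong R.π eq) (proj₂ (F-piece y Ay)))
      via-hub : F x ≡ R.ρ (φ (P.π x)) → F y ≡ R.ρ (φ (P.π y)) → Path (Edge G) (λ z → A z × F z ≡ F y) x y
      via-hub ex ey =
        path-⊆ (λ (Az , e) → Az , trans e (trans (cong R.ρ φ≡) (sym ey)))
          (subst (λ i → Path (Edge G) (λ z → A z × F z ≡ R.ρ (φ (P.π x))) x (P.ρ (σ i))) φ≡ (hub x Ax ex)) ◅◅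
        path-⊆ (λ (Az , e) → Az , trans e (sym ey)) (path-reverse (edge-sym G) (hub y Ay ey))
      by-cases : Dec (σ (φ (P.π x)) ≡ P.π x) → Dec (σ (φ (P.π y)) ≡ P.π y) →
                 Path (Edge G) (λ z → A z × F z ≡ F y) x y
      by-cases (yes p) (yes q) = within (φ (P.π y)) Ax Ay (trans (sym p) (cong σ φ≡)) (sym q) eq
      by-cases (no p)  _       = let ex = F-out x _ refl p in
        via-hub ex (trans (sym eq) (trans ex (cong R.ρ φ≡)))
      by-cases (yes _) (no q)  = let ey = F-out y _ refl q in
        via-hub (trans eq (trans ey (cong R.ρ (sym φ≡)))) ey
    edge→ : ∀ x y → A x → A y → Edge G x y → F x ≢ F y → Edge H (F x) (F y)
    edge→ x y Ax Ay e ne with P.π x ≟ P.π y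
    ... | no px≢py with P.edge→ Ax Ay e px≢py
    ...   | xρ , yρ , s = subst₂ (Edge H) (sym Fx) (sym Fy) (R.edge← ne′ (adj→ s ne′))
      where
      Fx : F x ≡ R.ρ (φ (P.π x))
      Fx = trans (cong F xρ) (F-ρ _)
      Fy : F y ≡ R.ρ (φ (P.π y))
      Fy = trans (cong F yρ) (F-ρ _)
      ne′ : φ (P.π x) ≢ φ (P.π y)
      ne′ eq = ne (trans Fx (trans (cong R.ρ eq) (sym Fy)))
    edge→ x y Ax Ay e ne | yes eq = by-cases (σ (φ (P.π y)) ≟ P.π y)
      where
      by-cases : Dec (σ (φ (P.π y)) ≡ P.π y) → Edge H (F x) (F y)
      by-cases (no p)  = ⊥-elim (ne (trans (F-out x _ eq p) (sym (F-out y _ refl p))))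
      by-cases (yes p) = subst₂ (Edge H) (sym Fx) (sym Fy)
        (C.edge→ (φ (P.π y)) (Ax , px) (Ay , sym p) e (λ q → ne (trans Fx (trans q (sym Fy)))))
        where
        px : P.π x ≡ σ (φ (P.π y))
        px = trans eq (sym p)
        Fx : F x ≡ C.f (φ (P.π y)) x
        Fx = F-σ _ x px
        Fy : F y ≡ C.f (φ (P.π y)) y
        Fy = F-σ _ y (sym p)
    edge← : ∀ a b → B a → B b → Edge H a b → ∃[ x ] ∃[ y ] (A x × A y × F x ≡ a × F y ≡ b × Edge G x y)
    edge← a b Ba Bb e with R.π a ≟ R.π b
    ... | yes eq with C.edge← (R.π b) (Ba , eq) (Bb , refl) e
    ...   | x , y , (Ax , px) , (Ay , py) , ex , ey , e′ =
      x , y , Ax , Ay , trans (F-σ _ x px) ex , trans (F-σ _ y py) ey , e′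
    edge← a b Ba Bb e | no ne with R.edge→ Ba Bb e ne
    ... | aρ , bρ , s with adj← ne s
    ...   | p , q , ep , eq , s′ = P.ρ p , P.ρ q , ρ∈ P p , ρ∈ P q ,
      trans (F-ρ p) (trans (cong R.ρ ep) (sym aρ)) , trans (F-ρ q) (trans (cong R.ρ eq) (sym bρ)) ,
      P.edge← (λ p≡q → ne (trans (sym ep) (trans (cong φ p≡q) eq))) s′

rootedCon-trans : ∀ {G₁ G₂ G₃ A₁ A₂ A₃ a₁ a₂ a₃} → RootedCon G₁ A₁ a₁ G₂ A₂ a₂ → RootedCon G₂ A₂ a₂ G₃ A₃ a₃ →
                  RootedCon G₁ A₁ a₁ G₃ A₃ a₃
rootedCon-trans (c , refl) (d , eq) = con-trans c d , eq

rep-mono : ∀ {G H t u A a B b} → t ⊑ u → Rep H t B b → Rep G u A a → RootedCon G A a H B b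
rep-mono {G} {H} (same s) (leaf Bb only) r = con-point {G} {H = H} (rep-path r) (rep-root r) Bb only
rep-mono (same ()) (branch R refl refl) (leaf _ _)
rep-mono {G} {H} (same {f} s) (branch R@(pieces π′ ρ′ t′ rep′ _ _) refl refl) (branch P@(pieces π ρ t rep _ _) refl refl) =
  con-pieces P R S λ i → rep-mono (SkelMap.emb S i) (rep′ i) (rep (SkelMap.σ S i))
  where S = skelMap f t′ t s
rep-mono {G} {H} (down d) r (branch P@(pieces π ρ t rep _ _) refl refl) with tabulate⁻ d
... | i , t⊑ = rootedCon-trans {G} {G} {H} (con-piece P i) (rep-mono t⊑ r (rep i))
rep-mono (down ()) r (leaf _ _)

-- Diamonds in connected partitions

Touch : {W C : Set} → (W → W → Set) → (W → C) → C → C → Set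
Touch F γ i j = ∃[ p ] ∃[ q ] (γ p ≡ i × γ q ≡ j × F p q)

module _ {W : Set} {F : W → W → Set} (F-sym : ∀ {p q} → F p q → F q p) where

  touch-sym : ∀ {C : Set} {γ : W → C} {i j} → Touch F γ i j → Touch F γ j i
  touch-sym (p , q , ep , eq , e) = q , p , eq , ep , F-sym e

  conn-hub : ∀ {P : W → Set} h → (∀ {x} → P x → Path F P x h) → Conn F P
  conn-hub h to-h Px Py = to-h Px ◅◅ path-reverse F-sym (to-h Py)

  fibre-hub : ∀ {C : Set} {γ : W → C} (h : C → W) → (∀ p → Path F (λ r → γ r ≡ γ p) p (h (γ p))) →
              ∀ {p q} → γ p ≡ γ q → Path F (λ r → γ r ≡ γ q) p q
  fibre-hub {γ = γ} h to-h {p} {q} eq =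
    path-⊆ (λ e → trans e eq) (subst (λ c → Path F (λ r → γ r ≡ γ p) p (h c)) eq (to-h p)) ◅◅
    path-reverse F-sym (to-h q)

  -- Colours 0 and 1 are the central edge, 2 and 3 the two nonadjacent tips. Every diamond below is
  -- given by such a colouring.
  con-diamond : (γ : W → Fin 4) → (∀ {p q} → γ p ≡ γ q → Path F (λ r → γ r ≡ γ q) p q) →
    Touch F γ 0F 1F → Touch F γ 0F 2F → Touch F γ 0F 3F → Touch F γ 1F 2F → Touch F γ 1F 3F →
    ¬ Touch F γ 2F 3F → Con F Everything (Edge diamond) Everything
  con-diamond γ fib t₀₁ t₀₂ t₀₃ t₁₂ t₁₃ ¬t₂₃ = record
    { f     = γ
    ; into  = λ _ → tt
    ; onto  = λ {b} _ → onto b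
    ; fibre = λ _ _ eq → path-⊆ (λ e → tt , e) (fib eq)
    ; edge→ = λ {x} {y} _ _ e ne → adjacent _ _ ne (x , y , refl , refl , e)
    ; edge← = λ {a} {b} _ _ e → let (p , q , ep , eq , e′) = touch a b e in p , q , tt , tt , ep , eq , e′
    }
    where
    onto : ∀ b → ∃[ x ] (⊤ × γ x ≡ b)
    onto 0F = let (p , _ , e , _) = t₀₁ in p , tt , e
    onto 1F = let (_ , q , _ , e , _) = t₀₁ in q , tt , e
    onto 2F = let (_ , q , _ , e , _) = t₀₂ in q , tt , e
    onto 3F = let (_ , q , _ , e , _) = t₀₃ in q , tt , e
    adjacent : ∀ i j → i ≢ j → Touch F γ i j → Edge diamond i j
    adjacent 0F 0F ne _ = ⊥-elim (ne refl)
    adjacent 0F 1F _  _ = refl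
    adjacent 0F 2F _  _ = refl
    adjacent 0F 3F _  _ = refl
    adjacent 1F 0F _  _ = refl
    adjacent 1F 1F ne _ = ⊥-elim (ne refl)
    adjacent 1F 2F _  _ = refl
    adjacent 1F 3F _  _ = refl
    adjacent 2F 0F _  _ = refl
    adjacent 2F 1F _  _ = refl
    adjacent 2F 2F ne _ = ⊥-elim (ne refl)
    adjacent 2F 3F _  t = ⊥-elim (¬t₂₃ t)
    adjacent 3F 0F _  _ = refl
    adjacent 3F 1F _  _ = refl
    adjacent 3F 2F _  t = ⊥-elim (¬t₂₃ (touch-sym t))
    adjacent 3F 3F ne _ = ⊥-elim (ne refl)
    touch : ∀ i j → Edge diamond i j → Touch F γ i j
    touch 0F 1F _ = t₀₁
    touch 0F 2F _ = t₀₂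
    touch 0F 3F _ = t₀₃
    touch 1F 0F _ = touch-sym t₀₁
    touch 1F 2F _ = t₁₂
    touch 1F 3F _ = t₁₃
    touch 2F 0F _ = touch-sym t₀₂
    touch 2F 1F _ = touch-sym t₁₂
    touch 3F 0F _ = touch-sym t₀₃
    touch 3F 1F _ = touch-sym t₁₃
    touch 2F 2F ()
    touch 2F 3F ()
    touch 3F 2F ()
    touch 3F 3F ()

second : ∀ {k} → 2 ≤ k → Σ (Fin (suc k)) λ i → toℕ i ≡ 1
second {suc k} _ = 1F , refl

before-last : ∀ {k} → 2 ≤ k → Σ (Fin (suc k)) λ i → Next i (fromℕ k)
before-last {suc k} _ = inject₁ (fromℕ k) , cong suc (sym (toℕ-inject₁ (fromℕ k)))

-- The parts of a connected partition: two adjacent sides inj₁ true, inj₁ false and a family inj₂ i.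
module Quotient {k : ℕ} (F : Bool ⊎ Fin (suc k) → Bool ⊎ Fin (suc k) → Set)
  (F-sym : ∀ {p q} → F p q → F q p)
  (no-diamond : ¬ Con F Everything (Edge diamond) Everything)
  (sides : F (inj₁ true) (inj₁ false))
  (N? : ∀ b i → Dec (F (inj₁ b) (inj₂ i)))
  (meets : ∀ b → ∃[ i ] F (inj₁ b) (inj₂ i)) where

  N : Bool → Fin (suc k) → Set
  N b i = F (inj₁ b) (inj₂ i)

  side-adj : ∀ b → F (inj₁ b) (inj₁ (not b))
  side-adj true  = sides
  side-adj false = F-sym sides

  pick : Bool → Bool → Fin 4 → Fin 4 → Fin 4
  pick true  true  x y = x
  pick false false x y = x
  pick true  false x y = y
  pick false true  x y = y

  pick-same : ∀ b {x y} → pick b b x y ≡ x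
  pick-same true  = refl
  pick-same false = refl

  pick-not : ∀ b {x y} → pick b (not b) x y ≡ y
  pick-not true  = refl
  pick-not false = refl

  pick-cases : ∀ b c x y → (c ≡ b × pick b c x y ≡ x) ⊎ (c ≡ not b × pick b c x y ≡ y)
  pick-cases true  true  x y = inj₁ (refl , refl)
  pick-cases true  false x y = inj₂ (refl , refl)
  pick-cases false true  x y = inj₂ (refl , refl)
  pick-cases false false x y = inj₁ (refl , refl)

  -- With `i` and `j` adjacent, the four parts form a 4-cycle, which is not a diamond and has to be
  -- kept as an outcome.
  Mutual : (i j : Fin (suc k)) → Set
  Mutual i j = (∀ l → l ≡ i ⊎ l ≡ j) × N true i × ¬ N true j × N false j × ¬ N false i

  module Clique (adj : ∀ {i j} → i ≢ j → F (inj₂ i) (inj₂ j))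
    (covered : ∀ i → N true i ⊎ N false i) where

    other : ∀ {b i} → ¬ N b i → N (not b) i
    other {true}  {i} ¬N with covered i
    ... | inj₁ p = ⊥-elim (¬N p)
    ... | inj₂ p = p
    other {false} {i} ¬N with covered i
    ... | inj₁ p = p
    ... | inj₂ p = ⊥-elim (¬N p)

    -- The central edge joins side `not b` to the union of all pieces other than `i`; the tips are
    -- side `b` and piece `i`.
    no-second-neighbour : ∀ b i j j′ → ¬ N b i → i ≢ j → N (not b) j → N b j′ → ⊥
    no-second-neighbour b i j j′ ¬Ni i≢j Nj Nj′ = no-diamond (con-diamond F-sym γ (fibre-hub F-sym h to-h)
        (inj₁ (not b) , inj₂ j , pick-not b , γ-≢ (i≢j ∘ sym) , Nj)
        (inj₁ (not b) , inj₁ b , pick-not b , pick-same b , F-sym (side-adj b))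
        (inj₁ (not b) , inj₂ i , pick-not b , γ-i , other ¬Ni)
        (inj₂ j′ , inj₁ b , γ-≢ (λ { refl → ¬Ni Nj′ }) , pick-same b , F-sym Nj′)
        (inj₂ j , inj₂ i , γ-≢ (i≢j ∘ sym) , γ-i , adj (i≢j ∘ sym))
        apart)
      where
      colour : ∀ {m} → Dec (m ≡ i) → Fin 4
      colour (yes _) = 3F
      colour (no  _) = 1F
      γ : Bool ⊎ Fin (suc k) → Fin 4
      γ (inj₁ c) = pick b c 2F 0F
      γ (inj₂ m) = colour (m ≟ i)
      γ-≢ : ∀ {m} → m ≢ i → γ (inj₂ m) ≡ 1F
      γ-≢ {m} ne with m ≟ i
      ... | yes eq = ⊥-elim (ne eq)
      ... | no  _  = refl
      γ-i : γ (inj₂ i) ≡ 3F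
      γ-i with i ≟ i
      ... | yes _ = refl
      ... | no ne = ⊥-elim (ne refl)
      h : Fin 4 → Bool ⊎ Fin (suc k)
      h 0F = inj₁ (not b)
      h 1F = inj₂ j
      h 2F = inj₁ b
      h 3F = inj₂ i
      to-h : ∀ p → Path F (λ r → γ r ≡ γ p) p (h (γ p))
      to-h (inj₁ c) with pick-cases b c 2F 0F
      ... | inj₁ (refl , eq) rewrite eq = ε
      ... | inj₂ (refl , eq) rewrite eq = ε
      to-h (inj₂ m) with m ≟ i
      ... | yes refl = ε
      ... | no m≢i with m ≟ j
      ...   | yes refl = ε
      ...   | no m≢j = (adj m≢j , γ-≢ m≢i , γ-≢ (i≢j ∘ sym)) ◅ ε
      apart : ¬ Touch F γ 2F 3F
      apart (inj₁ c , inj₂ m , ep , eq , e) with pick-cases b c 2F 0F | m ≟ i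
      ... | inj₁ (refl , _) | yes refl = ¬Ni e
      ... | inj₂ (refl , eq′) | _ with trans (sym ep) eq′
      ...   | ()
      apart (inj₁ c , inj₂ m , ep , () , e) | inj₁ _ | no _
      apart (inj₁ c , inj₁ d , ep , eq , e) with pick-cases b d 2F 0F
      ... | inj₁ (_ , eq′) with trans (sym eq) eq′
      ...   | ()
      apart (inj₁ c , inj₁ d , ep , eq , e) | inj₂ (_ , eq′) with trans (sym eq) eq′
      ...   | ()
      apart (inj₂ m , q , ep , eq , e) with m ≟ i
      apart (inj₂ m , q , () , eq , e) | yes _
      apart (inj₂ m , q , () , eq , e) | no _

    -- The central edge joins piece `i` to side `b` enlarged by all pieces except `i` and `l`; the
    -- tips are side `not b` and piece `l`. The enlarged class is connected because side `b` must
    -- see every piece that `not b` does not.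
    no-third-piece : ∀ b i j l → ¬ N b i → (∀ m → m ≢ i → ¬ N (not b) m) → i ≢ j → l ≢ i → l ≢ j → ⊥
    no-third-piece b i j l ¬Ni ¬N i≢j l≢i l≢j = no-diamond (con-diamond F-sym γ (fibre-hub F-sym h to-h)
        (inj₂ j , inj₂ i , γ-≢ (i≢j ∘ sym) (l≢j ∘ sym) , γ-i , adj (i≢j ∘ sym))
        (inj₁ b , inj₁ (not b) , pick-same b , pick-not b , side-adj b)
        (inj₁ b , inj₂ l , pick-same b , γ-l , Nb l≢i)
        (inj₂ i , inj₁ (not b) , γ-i , pick-not b , F-sym (other ¬Ni))
        (inj₂ i , inj₂ l , γ-i , γ-l , adj (l≢i ∘ sym))
        apart)
      where
      Nb : ∀ {m} → m ≢ i → N b m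
      Nb {m} m≢i with N? b m
      ... | yes p = p
      ... | no ¬p = ⊥-elim (¬N m m≢i (other ¬p))
      colour : ∀ {m} → Dec (m ≡ i) → Dec (m ≡ l) → Fin 4
      colour (yes _) _       = 1F
      colour (no  _) (yes _) = 3F
      colour (no  _) (no _)  = 0F
      γ : Bool ⊎ Fin (suc k) → Fin 4
      γ (inj₁ c) = pick b c 0F 2F
      γ (inj₂ m) = colour (m ≟ i) (m ≟ l)
      γ-i : γ (inj₂ i) ≡ 1F
      γ-i with i ≟ i
      ... | yes _ = refl
      ... | no ne = ⊥-elim (ne refl)
      γ-l : γ (inj₂ l) ≡ 3F
      γ-l with l ≟ i | l ≟ l
      ... | yes e | _     = ⊥-elim (l≢i e)
      ... | no _  | yes _ = refl
      ... | no _  | no ne = ⊥-elim (ne refl)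
      γ-≢ : ∀ {m} → m ≢ i → m ≢ l → γ (inj₂ m) ≡ 0F
      γ-≢ {m} ne ne′ with m ≟ i | m ≟ l
      ... | yes e | _     = ⊥-elim (ne e)
      ... | no _  | yes e = ⊥-elim (ne′ e)
      ... | no _  | no _  = refl
      h : Fin 4 → Bool ⊎ Fin (suc k)
      h 0F = inj₁ b
      h 1F = inj₂ i
      h 2F = inj₁ (not b)
      h 3F = inj₂ l
      to-h : ∀ p → Path F (λ r → γ r ≡ γ p) p (h (γ p))
      to-h (inj₁ c) with pick-cases b c 0F 2F
      ... | inj₁ (refl , eq) rewrite eq = ε
      ... | inj₂ (refl , eq) rewrite eq = ε
      to-h (inj₂ m) with m ≟ i | m ≟ l
      ... | yes refl | _        = ε
      ... | no _     | yes refl = ε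
      ... | no m≢i   | no m≢l   = (F-sym (Nb m≢i) , γ-≢ m≢i m≢l , pick-same b) ◅ ε
      apart : ¬ Touch F γ 2F 3F
      apart (inj₁ c , inj₂ m , ep , eq , e) with pick-cases b c 0F 2F | m ≟ i | m ≟ l
      ... | inj₂ (refl , _)   | no m≢i | yes refl = ¬N m m≢i e
      ... | inj₁ (refl , eq′) | _ | _ with trans (sym ep) eq′
      ...   | ()
      apart (inj₁ c , inj₂ m , ep , () , e) | inj₂ _ | yes _ | _
      apart (inj₁ c , inj₂ m , ep , () , e) | inj₂ _ | no _  | no _
      apart (inj₁ c , inj₁ d , ep , eq , e) with pick-cases b d 0F 2F
      ... | inj₁ (_ , eq′) with trans (sym eq) eq′
      ...   | ()
      apart (inj₁ c , inj₁ d , ep , eq , e) | inj₂ (_ , eq′) with trans (sym eq) eq′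
      ...   | ()
      apart (inj₂ m , q , ep , eq , e) with m ≟ i | m ≟ l
      apart (inj₂ m , q , () , eq , e) | yes _ | _
      apart (inj₂ m , q , () , eq , e) | no _  | yes _
      apart (inj₂ m , q , () , eq , e) | no _  | no _

    one-sided : ∀ b i → ¬ N b i → ∃[ i′ ] ∃[ j′ ] (i′ ≢ j′ × Mutual i′ j′)
    one-sided b i ¬Ni with meets b
    ... | j , Nj with any? (λ m → ¬? (m ≟ i) ×-dec N? (not b) m)
    ...   | yes (m , m≢i , Nm) = ⊥-elim (no-second-neighbour b i m j ¬Ni (m≢i ∘ sym) Nm Nj)
    ...   | no none with any? (λ l → ¬? (l ≟ i) ×-dec ¬? (l ≟ j))
    ...     | yes (l , l≢i , l≢j) =
      ⊥-elim (no-third-piece b i j l ¬Ni (λ m m≢i Nm → none (m , m≢i , Nm)) (λ { refl → ¬Ni Nj }) l≢i l≢j)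
    ...     | no no-third = outcome b ¬Ni Nj (λ m m≢i Nm → none (m , m≢i , Nm))
      where
      i≢j : i ≢ j
      i≢j refl = ¬Ni Nj
      two : ∀ l → l ≡ i ⊎ l ≡ j
      two l with l ≟ i | l ≟ j
      ... | yes e | _     = inj₁ e
      ... | no _  | yes e = inj₂ e
      ... | no p  | no q  = ⊥-elim (no-third (l , p , q))
      swap : ∀ {A B : Set} → A ⊎ B → B ⊎ A
      swap (inj₁ x) = inj₂ x
      swap (inj₂ y) = inj₁ y
      outcome : ∀ b → ¬ N b i → N b j → (∀ m → m ≢ i → ¬ N (not b) m) → ∃[ i′ ] ∃[ j′ ] (i′ ≢ j′ × Mutual i′ j′)
      outcome true  ¬Ni Nj ¬N = j , i , i≢j ∘ sym , (swap ∘ two) , Nj , ¬Ni , other {true} ¬Ni , ¬N j (i≢j ∘ sym)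
      outcome false ¬Ni Nj ¬N = i , j , i≢j , two , other {false} ¬Ni , ¬N j (i≢j ∘ sym) , Nj , ¬Ni

    cases : (∀ b i → N b i) ⊎ (∃[ i ] ∃[ j ] (i ≢ j × Mutual i j))
    cases with all? (N? true) | all? (N? false)
    ... | yes p | yes q = inj₁ λ { true → p ; false → q }
    ... | no ¬p | _     = let (i , ¬Ni) = ¬∀⟶∃¬ _ _ (N? true) ¬p in inj₂ (one-sided true i ¬Ni)
    ... | yes _ | no ¬q = let (i , ¬Ni) = ¬∀⟶∃¬ _ _ (N? false) ¬q in inj₂ (one-sided false i ¬Ni)

  -- The bound `k≥2` provides an inner piece, which becomes a tip in `four`.
  module LongPath (k≥2 : 2 ≤ k) (adj : ∀ {i j} → PathAdj i j → F (inj₂ i) (inj₂ j))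
    (ends : ∀ {b i} → N b i → i ≡ zero ⊎ i ≡ fromℕ k)
    (covered-first : N true zero ⊎ N false zero) (covered-last : N true (fromℕ k) ⊎ N false (fromℕ k)) where

    last : Fin (suc k)
    last = fromℕ k

    last≢zero : last ≢ zero
    last≢zero eq with ≤-trans (≤-trans k≥2 (≤-reflexive (sym (toℕ-fromℕ k)))) (≤-reflexive (cong toℕ eq))
    ... | ()

    one : Fin (suc k)
    one = proj₁ (second k≥2)

    one≡ : toℕ one ≡ 1
    one≡ = proj₂ (second k≥2)

    one≢zero : one ≢ zero
    one≢zero eq with trans (sym one≡) (cong toℕ eq)
    ... | ()

    one≢last : one ≢ last
    one≢last eq with ≤-trans k≥2 (≤-reflexive (trans (sym (toℕ-fromℕ k)) (trans (cong toℕ (sym eq)) one≡)))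
    ... | s≤s ()

    segment : ∀ {P : Bool ⊎ Fin (suc k) → Set} i j → toℕ i ≤ toℕ j →
              (∀ {m} → toℕ i ≤ toℕ m → toℕ m ≤ toℕ j → P (inj₂ m)) → Path F P (inj₂ i) (inj₂ j)
    segment i j i≤j h = Star.gmap inj₂ (λ (e , p , q) → adj e , p , q) (interval-path i j i≤j h)

    positive : ∀ {m : Fin (suc k)} → m ≢ zero → 1 ≤ toℕ m
    positive {zero}  ne = ⊥-elim (ne refl)
    positive {suc m} ne = s≤s z≤n

    ≤last : ∀ (m : Fin (suc k)) → toℕ m ≤ toℕ last
    ≤last = ≤fromℕ

    one-path : F (inj₂ zero) (inj₂ one)
    one-path = adj (inj₁ one≡)

    -- Side b sees both ends, the other side only one of them; d tells which of the first part and
    -- the union of the other parts becomes the vertex 1 of the diamond (the other one becomes 3).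
    module Three (b : Bool) where
      block : Bool → Fin 4
      block true  = 1F
      block false = 3F
      colour : Bool → Fin (suc k) → Fin 4
      colour d zero    = block d
      colour d (suc _) = block (not d)
      γ : Bool → Bool ⊎ Fin (suc k) → Fin 4
      γ d (inj₁ c) = pick b c 0F 2F
      γ d (inj₂ m) = colour d m
      γ-≢ : ∀ d {m} → m ≢ zero → γ d (inj₂ m) ≡ block (not d)
      γ-≢ d {zero}  ne = ⊥-elim (ne refl)
      γ-≢ d {suc m} ne = refl
      h : Bool → Fin 4 → Bool ⊎ Fin (suc k)
      h _     0F = inj₁ b
      h _     2F = inj₁ (not b)
      h true  1F = inj₂ zero
      h true  3F = inj₂ last
      h false 3F = inj₂ zero
      h false 1F = inj₂ last
      to-last : ∀ d m → m ≢ zero → Path F (λ r → γ d r ≡ block (not d)) (inj₂ m) (inj₂ last)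
      to-last d m ne = segment m last (≤last m)
        (λ {m′} le _ → γ-≢ d {m′} λ { refl → no-≤ (≤-trans (positive ne) le) })
        where
        no-≤ : ¬ (1 ≤ 0)
        no-≤ ()
      to-h : ∀ d p → Path F (λ r → γ d r ≡ γ d p) p (h d (γ d p))
      to-h d (inj₁ c) with pick-cases b c 0F 2F
      to-h true  (inj₁ c) | inj₁ (refl , eq) rewrite eq = ε
      to-h false (inj₁ c) | inj₁ (refl , eq) rewrite eq = ε
      to-h true  (inj₁ c) | inj₂ (refl , eq) rewrite eq = ε
      to-h false (inj₁ c) | inj₂ (refl , eq) rewrite eq = ε
      to-h true  (inj₂ zero)    = ε
      to-h false (inj₂ zero)    = ε
      to-h true  (inj₂ (suc m)) = to-last true (suc m) λ ()
      to-h false (inj₂ (suc m)) = to-last false (suc m) λ ()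
      no-three : ∀ d → N b zero → N b last → Touch F (γ d) 1F 2F → ¬ Touch F (γ d) 2F 3F → ⊥
      no-three true N0 Nl t₁₂ ¬t₂₃ = no-diamond (con-diamond F-sym (γ true) (fibre-hub F-sym (h true) (to-h true))
        (inj₁ b , inj₂ zero , pick-same b , refl , N0)
        (inj₁ b , inj₁ (not b) , pick-same b , pick-not b , side-adj b)
        (inj₁ b , inj₂ last , pick-same b , γ-≢ true last≢zero , Nl)
        t₁₂ (inj₂ zero , inj₂ one , refl , γ-≢ true one≢zero , one-path) ¬t₂₃)
      no-three false N0 Nl t₁₂ ¬t₂₃ = no-diamond (con-diamond F-sym (γ false) (fibre-hub F-sym (h false) (to-h false))
        (inj₁ b , inj₂ last , pick-same b , γ-≢ false last≢zero , Nl)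
        (inj₁ b , inj₁ (not b) , pick-same b , pick-not b , side-adj b)
        (inj₁ b , inj₂ zero , pick-same b , refl , N0)
        t₁₂ (inj₂ one , inj₂ zero , γ-≢ false one≢zero , refl , F-sym one-path) ¬t₂₃)

    three-last : ∀ b → N b zero → N b last → N (not b) zero → ¬ N (not b) last → ⊥
    three-last b N0 Nl N0′ ¬Nl′ = T.no-three true N0 Nl
        (inj₂ zero , inj₁ (not b) , refl , pick-not b , F-sym N0′) apart
      where
      module T = Three b
      apart : ¬ Touch F (T.γ true) 2F 3F
      apart (inj₁ c , q , ep , eq , e) with pick-cases b c 0F 2F
      apart (inj₁ c , q , ep , eq , e) | inj₁ (_ , eq′) with trans (sym ep) eq′
      ... | ()
      apart (inj₁ c , inj₁ d , ep , eq , e) | inj₂ _ with pick-cases b d 0F 2F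
      apart (inj₁ c , inj₁ d , ep , eq , e) | inj₂ _ | inj₁ (_ , eq′) with trans (sym eq) eq′
      ... | ()
      apart (inj₁ c , inj₁ d , ep , eq , e) | inj₂ _ | inj₂ (_ , eq′) with trans (sym eq) eq′
      ... | ()
      apart (inj₁ c , inj₂ (suc m) , ep , eq , e) | inj₂ (refl , _) with ends e
      ... | inj₂ p = ¬Nl′ (subst (N (not b)) p e)
      apart (inj₂ zero , q , () , _)
      apart (inj₂ (suc m) , q , () , _)

    three-first : ∀ b → N b zero → N b last → N (not b) last → ¬ N (not b) zero → ⊥
    three-first b N0 Nl Nl′ ¬N0′ = T.no-three false N0 Nl
        (inj₂ last , inj₁ (not b) , T.γ-≢ false last≢zero , pick-not b , F-sym Nl′) apart
      where
      module T = Three b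
      apart : ¬ Touch F (T.γ false) 2F 3F
      apart (inj₁ c , q , ep , eq , e) with pick-cases b c 0F 2F
      apart (inj₁ c , q , ep , eq , e) | inj₁ (_ , eq′) with trans (sym ep) eq′
      ... | ()
      apart (inj₁ c , inj₁ d , ep , eq , e) | inj₂ _ with pick-cases b d 0F 2F
      apart (inj₁ c , inj₁ d , ep , eq , e) | inj₂ _ | inj₁ (_ , eq′) with trans (sym eq) eq′
      ... | ()
      apart (inj₁ c , inj₁ d , ep , eq , e) | inj₂ _ | inj₂ (_ , eq′) with trans (sym eq) eq′
      ... | ()
      apart (inj₁ c , inj₂ zero , ep , eq , e) | inj₂ (refl , _) = ¬N0′ e
      apart (inj₂ zero , q , () , _)
      apart (inj₂ (suc m) , q , () , _)

    -- The central edge joins the last piece to the union of the first piece and side `false`; the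
    -- tips are the inner pieces and side `true`, apart because only end pieces meet the sides.
    four : N true zero → N true last → N false zero → N false last → ⊥
    four T0 Tl F0 Fl = no-diamond (con-diamond F-sym γ (fibre-hub F-sym h to-h)
        (inj₁ false , inj₂ last , refl , γ-last , Fl)
        (inj₂ zero , inj₂ one , refl , γ-mid one≢zero one≢last , one-path)
        (inj₂ zero , inj₁ true , refl , refl , F-sym T0)
        t₁₂ (inj₂ last , inj₁ true , γ-last , refl , F-sym Tl) apart)
      where
      colour : ∀ {m : Fin (suc k)} → Dec (m ≡ zero) → Dec (m ≡ last) → Fin 4
      colour (yes _) _       = 0F
      colour (no  _) (yes _) = 1F
      colour (no  _) (no _)  = 2F
      γ : Bool ⊎ Fin (suc k) → Fin 4
      γ (inj₁ true)  = 3F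
      γ (inj₁ false) = 0F
      γ (inj₂ m)     = colour (m ≟ zero) (m ≟ last)
      γ-last : γ (inj₂ last) ≡ 1F
      γ-last with last ≟ zero | last ≟ last
      ... | yes e | _     = ⊥-elim (last≢zero e)
      ... | no _  | yes _ = refl
      ... | no _  | no ne = ⊥-elim (ne refl)
      γ-mid : ∀ {m} → m ≢ zero → m ≢ last → γ (inj₂ m) ≡ 2F
      γ-mid {m} ne ne′ with m ≟ zero | m ≟ last
      ... | yes e | _     = ⊥-elim (ne e)
      ... | no _  | yes e = ⊥-elim (ne′ e)
      ... | no _  | no _  = refl
      h : Fin 4 → Bool ⊎ Fin (suc k)
      h 0F = inj₂ zero
      h 1F = inj₂ last
      h 2F = inj₂ one
      h 3F = inj₁ true
      from-one : ∀ m → m ≢ zero → m ≢ last → Path F (λ r → γ r ≡ 2F) (inj₂ one) (inj₂ m)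
      from-one m ne ne′ = segment one m (≤-trans (≤-reflexive one≡) (positive ne))
        λ {m′} le le′ → γ-mid {m′}
          (λ { refl → no-≤ (≤-trans (≤-reflexive (sym one≡)) le) })
          (λ { refl → ne′ (toℕ-injective (≤-antisym (≤last m) le′)) })
        where
        no-≤ : ¬ (1 ≤ 0)
        no-≤ ()
      to-h : ∀ p → Path F (λ r → γ r ≡ γ p) p (h (γ p))
      to-h (inj₁ true)  = ε
      to-h (inj₁ false) = (F0 , refl , refl) ◅ ε
      to-h (inj₂ m) with m ≟ zero | m ≟ last
      ... | yes refl | _        = ε
      ... | no _     | yes refl = ε
      ... | no m≢0   | no m≢l   = path-reverse F-sym (from-one m m≢0 m≢l)
      t₁₂ : Touch F γ 1F 2F
      t₁₂ with before-last k≥2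
      ... | m , e = inj₂ last , inj₂ m , γ-last , γ-mid m≢0 (PathAdj-≢ (inj₁ e)) , adj (inj₂ e)
        where
        m≢0 : m ≢ zero
        m≢0 refl with ≤-trans k≥2 (≤-reflexive (trans (sym (toℕ-fromℕ k)) e))
        ... | s≤s ()
      apart : ¬ Touch F γ 2F 3F
      apart (inj₁ true  , _ , () , _)
      apart (inj₁ false , _ , () , _)
      apart (inj₂ m , q , ep , eq , e) with m ≟ zero | m ≟ last
      apart (inj₂ m , q , () , eq , e) | yes _ | _
      apart (inj₂ m , q , () , eq , e) | no _ | yes _
      apart (inj₂ m , inj₁ true , ep , eq , e) | no p | no q′ with ends (F-sym e)
      ... | inj₁ r = p r
      ... | inj₂ r = q′ r
      apart (inj₂ m , inj₂ l , ep , eq , e) | no _ | no _ with l ≟ zero | l ≟ last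
      apart (inj₂ m , inj₂ l , ep , () , e) | no _ | no _ | yes _ | _
      apart (inj₂ m , inj₂ l , ep , () , e) | no _ | no _ | no _ | yes _
      apart (inj₂ m , inj₂ l , ep , () , e) | no _ | no _ | no _ | no _

    Split : Fin (suc k) → Fin (suc k) → Set
    Split i j = N true i × ¬ N true j × N false j × ¬ N false i

    meets-end : ∀ b → ¬ N b zero → ¬ N b last → ⊥
    meets-end b n₀ n₁ with meets b
    ... | i , Ni with ends Ni
    ...   | inj₁ refl = n₀ Ni
    ...   | inj₂ refl = n₁ Ni

    cases : Split zero last ⊎ Split last zero
    cases with N? true zero | N? true last | N? false zero | N? false last
    ... | yes a | yes b | yes c | yes d = ⊥-elim (four a b c d)
    ... | yes a | yes b | yes c | no d  = ⊥-elim (three-last true a b c d)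
    ... | yes a | yes b | no c  | yes d = ⊥-elim (three-first true a b d c)
    ... | yes a | no b  | yes c | yes d = ⊥-elim (three-last false c d a b)
    ... | no a  | yes b | yes c | yes d = ⊥-elim (three-first false c d b a)
    ... | yes a | no b  | no c  | yes d = inj₁ (a , b , d , c)
    ... | no a  | yes b | yes c | no d  = inj₂ (b , a , c , d)
    ... | no a  | no b  | _     | _     = ⊥-elim (meets-end true a b)
    ... | _     | _     | no c  | no d  = ⊥-elim (meets-end false c d)
    ... | yes _ | no b  | yes _ | no d  = ⊥-elim ([ b , d ]′ covered-last)
    ... | no a  | yes _ | no c  | yes _ = ⊥-elim ([ a , c ]′ covered-first)

-- The structure of graphs without diamond contraction

pieces-map : ∀ {G A k} {Q Q′ : Fin k → Fin k → Set} →
  (∀ {i j} → i ≢ j → Q i j → Q′ i j) → (∀ {i j} → i ≢ j → Q′ i j → Q i j) → Pieces G A k Q → Pieces G A k Q′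
pieces-map to from (pieces π ρ t rep edge→ edge←) = pieces π ρ t rep
  (λ Ax Ay e ne → let (p , q , r) = edge→ Ax Ay e ne in p , q , to ne r)
  (λ ne q → edge← ne (from ne q))

pieces-reverse : ∀ {G A k} {Q : Fin k → Fin k → Set} →
  Pieces G A k Q → Pieces G A k (λ i j → Q (opposite i) (opposite j))
pieces-reverse {Q = Q} (pieces π ρ t rep edge→ edge←) = pieces (opposite ∘ π) (ρ ∘ opposite) (t ∘ opposite)
  (λ i → rep-resp (λ (Ax , e) → Ax , trans (cong opposite e) (opposite-involutive i))
                  (λ (Ax , e) → Ax , trans (sym (opposite-involutive _)) (cong opposite e)) (rep (opposite i)))
  (λ Ax Ay e ne → let (p , q , r) = edge→ Ax Ay e (ne ∘ cong opposite) in
     trans p (cong ρ (sym (opposite-involutive _))) , trans q (cong ρ (sym (opposite-involutive _))) ,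
     subst₂ Q (sym (opposite-involutive _)) (sym (opposite-involutive _)) r)
  (λ ne → edge← (λ eq → ne (trans (sym (opposite-involutive _)) (trans (cong opposite eq) (opposite-involutive _)))))

PathAdj-suc : ∀ {k} {i j : Fin k} → PathAdj i j → PathAdj (suc i) (suc j)
PathAdj-suc (inj₁ e) = inj₁ (cong suc e)
PathAdj-suc (inj₂ e) = inj₂ (cong suc e)

PathAdj-pred : ∀ {k} {i j : Fin k} → PathAdj (suc i) (suc j) → PathAdj i j
PathAdj-pred (inj₁ e) = inj₁ (suc-injective e)
PathAdj-pred (inj₂ e) = inj₂ (suc-injective e)

Next-opposite : ∀ {k} {i j : Fin k} → Next i j → Next (opposite j) (opposite i)
Next-opposite {k} {i} {j} e = trans (opposite-prop i)
  (trans (cong (k ∸_) (sym e)) (trans (∸-suc (toℕ<n j)) (cong suc (sym (opposite-prop j)))))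
  where
  ∸-suc : ∀ {m k} → m < k → k ∸ m ≡ suc (k ∸ suc m)
  ∸-suc {zero}  (s≤s _) = refl
  ∸-suc {suc m} (s≤s p) = ∸-suc p

PathAdj-opposite : ∀ {k} {i j : Fin k} → PathAdj i j → PathAdj (opposite i) (opposite j)
PathAdj-opposite {i = i} {j} (inj₁ e) = inj₂ (Next-opposite {i = i} {j} e)
PathAdj-opposite {i = i} {j} (inj₂ e) = inj₁ (Next-opposite {i = j} {i} e)

pieces-path-reverse : ∀ {G A k} → Pieces G A k PathAdj → Pieces G A k PathAdj
pieces-path-reverse P = pieces-map
  (λ {i} {j} _ e → subst₂ PathAdj (opposite-involutive i) (opposite-involutive j) (PathAdj-opposite e))
  (λ _ → PathAdj-opposite) (pieces-reverse P)

pieces-single : ∀ {G t A a} {Q : Fin 1 → Fin 1 → Set} → Rep G t A a → Pieces G A 1 Q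
pieces-single {t = t} {a = a} r = pieces (λ _ → zero) (λ _ → a) (λ _ → t)
  (λ { zero → rep-resp (λ Ax → Ax , refl) proj₁ r }) (λ _ _ _ ne → ⊥-elim (ne refl))
  (λ { {zero} {zero} ne _ → ⊥-elim (ne refl) })

-- Puts a rooted piece on `A` in front of the pieces of `M`. Used both to close a block at its root
-- and to lengthen an unfinished one.
module Cons {G : Graph} {A M K : Fin (n G) → Set} (M? : ∀ x → Dec (M x))
  (M⊆K : ∀ {x} → M x → K x) (A⊆K : ∀ {x} → A x → K x) (A∌M : ∀ {x} → A x → ¬ M x)
  (K⊆ : ∀ {x} → K x → ¬ M x → A x)
  {s a k} {Q : Fin k → Fin k → Set} (r : Rep G s A a) (P : Pieces G M k Q)
  (Q′ : Fin (suc k) → Fin (suc k) → Set) (Q′-sym : ∀ {i j} → Q′ i j → Q′ j i)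
  (Q→Q′ : ∀ {i j} → Q i j → Q′ (suc i) (suc j)) (Q′→Q : ∀ {i j} → Q′ (suc i) (suc j) → Q i j)
  (cross : ∀ {x y} → A x → M y → Edge G x y → x ≡ a × y ≡ Pieces.ρ P (Pieces.π P y) × Q′ zero (suc (Pieces.π P y)))
  (link : ∀ {i} → Q′ zero (suc i) → Edge G a (Pieces.ρ P i)) where

  open Pieces P

  position : ∀ {x} → Dec (M x) → Fin (suc k)
  position {x} (yes _) = suc (π x)
  position     (no _)  = zero

  π′ : Fin (n G) → Fin (suc k)
  π′ x = position (M? x)

  π′-M : ∀ {x} → M x → π′ x ≡ suc (π x)
  π′-M {x} Mx with M? x
  ... | yes _ = refl
  ... | no ¬M = ⊥-elim (¬M Mx)

  π′-A : ∀ {x} → A x → π′ x ≡ zero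
  π′-A {x} Ax with M? x
  ... | yes Mx = ⊥-elim (A∌M Ax Mx)
  ... | no _   = refl

  ρ′ : Fin (suc k) → Fin (n G)
  ρ′ zero    = a
  ρ′ (suc i) = ρ i

  t′ : Fin (suc k) → Tree
  t′ zero    = s
  t′ (suc i) = t i

  rep′ : ∀ i → Rep G (t′ i) (λ x → K x × π′ x ≡ i) (ρ′ i)
  rep′ zero = rep-resp (λ Ax → A⊆K Ax , π′-A Ax) back r
    where
    back : ∀ {x} → K x × π′ x ≡ zero → A x
    back {x} (Kx , eq) with M? x
    back (Kx , ()) | yes _
    back (Kx , eq) | no ¬M = K⊆ Kx ¬M
  rep′ (suc i) = rep-resp (λ (Mx , eq) → M⊆K Mx , trans (π′-M Mx) (cong suc eq)) back (rep i)
    where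
    back : ∀ {x} → K x × π′ x ≡ suc i → M x × π x ≡ i
    back {x} (Kx , eq) with M? x
    back (Kx , refl) | yes Mx = Mx , refl
    back (Kx , ())   | no _

  edge′→ : ∀ {x y} → K x → K y → Edge G x y → π′ x ≢ π′ y → x ≡ ρ′ (π′ x) × y ≡ ρ′ (π′ y) × Q′ (π′ x) (π′ y)
  edge′→ {x} {y} Kx Ky e ne with M? x | M? y
  ... | yes Mx | yes My = let (p , q , z) = edge→ Mx My e (ne ∘ cong suc) in p , q , Q→Q′ z
  ... | no ¬Mx | yes My = cross (K⊆ Kx ¬Mx) My e
  ... | yes Mx | no ¬My = let (p , q , z) = cross (K⊆ Ky ¬My) Mx (edge-sym G e) in q , p , Q′-sym z
  ... | no _   | no _   = ⊥-elim (ne refl)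

  edge′← : ∀ {i j} → i ≢ j → Q′ i j → Edge G (ρ′ i) (ρ′ j)
  edge′← {zero}  {zero}  ne _ = ⊥-elim (ne refl)
  edge′← {zero}  {suc j} _  q = link q
  edge′← {suc i} {zero}  _  q = edge-sym G (link (Q′-sym q))
  edge′← {suc i} {suc j} ne q = edge← (ne ∘ cong suc) (Q′→Q q)

  cons : Pieces G K (suc k) Q′
  cons = pieces π′ ρ′ t′ rep′ edge′→ edge′←

  cons-boundary : ∀ {x} → M x → x ≡ ρ (π x) → x ≡ ρ′ (π′ x)
  cons-boundary Mx eq = trans eq (cong ρ′ (sym (π′-M Mx)))

  cons-root : a ≡ ρ′ (π′ a)
  cons-root = cong ρ′ (sym (π′-A (rep-root r)))

two-elements : ∀ {k} (i j : Fin (suc k)) → i ≢ j → (∀ l → l ≡ i ⊎ l ≡ j) → k ≡ 1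
two-elements {zero}        zero zero ne h = ⊥-elim (ne refl)
two-elements {suc zero}    i j ne h = refl
two-elements {suc (suc k)} i j ne h with h 0F | h 1F | h 2F
... | inj₁ refl | inj₁ () | _
... | inj₁ refl | inj₂ refl | inj₁ ()
... | inj₁ refl | inj₂ refl | inj₂ ()
... | inj₂ refl | inj₁ refl | inj₁ ()
... | inj₂ refl | inj₁ refl | inj₂ ()
... | inj₂ refl | inj₂ () | _

_∸ˢ_ : ∀ {m} → Subset m → Subset m → Subset m
p ∸ˢ q = p ∩ ∁ q

module _ {m : ℕ} {p q : Subset m} where

  ∈∸⁺ : ∀ {x} → x ∈ p → x ∉ q → x ∈ p ∸ˢ q
  ∈∸⁺ x∈p x∉q = x∈p∩q⁺ (x∈p , x∉p⇒x∈∁p x∉q)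

  ∈∸⁻ : ∀ {x} → x ∈ p ∸ˢ q → x ∈ p × x ∉ q
  ∈∸⁻ x∈ = let (x∈p , x∈∁q) = x∈p∩q⁻ p (∁ q) x∈ in x∈p , x∈∁p⇒x∉p x∈∁q

  ∸-< : ∀ {x} → x ∈ p → x ∈ q → ∣ p ∸ˢ q ∣ < ∣ p ∣
  ∸-< x∈p x∈q = p⊂q⇒∣p∣<∣q∣ ((proj₁ ∘ ∈∸⁻) , _ , x∈p , λ x∈ → proj₂ (∈∸⁻ x∈) x∈q)

module Structure (G : Graph) (connected : ∀ x y → Star (Edge G) x y) (no-diamond : ¬ (diamond ≼ G)) where

  private
    V : Set
    V = Fin (n G)
    E : V → V → Set
    E = Edge G
    Sub : Set
    Sub = Subset (n G)

  E-sym : ∀ {x y} → E x y → E y x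
  E-sym = edge-sym G

  crossing : ∀ {P x y} (C : Sub) → Path E P x y → x ∈ C → y ∉ C →
             ∃[ u ] ∃[ v ] (P u × P v × u ∈ C × v ∉ C × E u v)
  crossing C ε x∈ y∉ = ⊥-elim (y∉ x∈)
  crossing C (_◅_ {j = z} (e , Px , Pz) p) x∈ y∉ with z ∈? C
  ... | yes z∈ = crossing C p z∈ y∉
  ... | no z∉  = _ , z , Px , Pz , x∈ , z∉ , e

  -- For `D` inside `S` without `a`: a union of components of `S` minus `a`. Separate from
  -- `Component` because two components are also removed at once.
  Closed : Sub → V → Sub → Set
  Closed S a D = ∀ {u v} → u ∈ D → v ∈ S → v ≢ a → E u v → v ∈ D

  record Component (S : Sub) (a x : V) (C : Sub) : Set where
    field
      start  : x ∈ C
      inside : C ⊆ S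
      avoids : a ∉ C
      conn   : Conn E (_∈ C)
      closed : Closed S a C

  component : ∀ S a x → x ∈ S → x ≢ a → ∃[ C ] Component S a x C
  -- The first argument is fuel: the set built so far plus the fuel is at least as large as `S`, so
  -- it cannot run out while a vertex is missing.
  component S a x x∈S x≢a = grow ∣ S ∣ ⁅ x ⁆ (m≤n+m _ _) (x∈⁅x⁆ x)
      (λ z∈ → subst (_∈ S) (sym (x∈⁅y⁆⇒x≡y x z∈)) x∈S)
      (λ a∈ → x≢a (sym (x∈⁅y⁆⇒x≡y x a∈)))
      (conn-hub E-sym x λ z∈ → subst (Path E _ _) (x∈⁅y⁆⇒x≡y x z∈) ε)
    where
    grow : ∀ m C → ∣ S ∣ ≤ ∣ C ∣ + m → x ∈ C → C ⊆ S → a ∉ C → Conn E (_∈ C) → ∃[ C ] Component S a x C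
    grow m C le x∈C C⊆S a∉C conn
      with any? (λ u → any? λ v → (u ∈? C) ×-dec (v ∈? S) ×-dec ¬? (v ∈? C) ×-dec ¬? (v ≟ a) ×-dec edge? G u v)
    ... | no none = C , record
      { start = x∈C ; inside = C⊆S ; avoids = a∉C ; conn = conn ; closed = closed }
      where
      closed : Closed S a C
      closed {u} {v} u∈ v∈S v≢a e with v ∈? C
      ... | yes v∈ = v∈
      ... | no v∉  = ⊥-elim (none (u , v , u∈ , v∈S , v∉ , v≢a , e))
    grow zero C le x∈C C⊆S a∉C conn | yes (u , v , u∈ , v∈S , v∉ , v≢a , e) =
      ⊥-elim (<-irrefl refl (≤-trans (p⊂q⇒∣p∣<∣q∣ (C⊆S , v , v∈S , v∉)) (≤-trans le (≤-reflexive (+-identityʳ _)))))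
    grow (suc m) C le x∈C C⊆S a∉C conn | yes (u , v , u∈ , v∈S , v∉ , v≢a , e) =
      grow m (C ∪ ⁅ v ⁆)
        (≤-trans le (≤-trans (≤-reflexive (+-suc _ m)) (+-monoˡ-≤ m (p⊂q⇒∣p∣<∣q∣ (old , v , new , v∉)))))
        (old x∈C)
        (λ z∈ → [ C⊆S , (λ { refl → v∈S }) ]′ (split z∈))
        (λ a∈ → [ a∉C , (λ { refl → v≢a refl }) ]′ (split a∈))
        (conn-hub E-sym u λ z∈ → [ (λ z∈C → path-⊆ old (conn z∈C u∈)) ,
                                   (λ { refl → (E-sym e , new , old u∈) ◅ ε }) ]′ (split z∈))
      where
      old : ∀ {z} → z ∈ C → z ∈ C ∪ ⁅ v ⁆
      old z∈ = x∈p∪q⁺ (inj₁ z∈)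
      new : v ∈ C ∪ ⁅ v ⁆
      new = x∈p∪q⁺ (inj₂ (x∈⁅x⁆ v))
      split : ∀ {z} → z ∈ C ∪ ⁅ v ⁆ → z ∈ C ⊎ z ≡ v
      split z∈ with x∈p∪q⁻ C ⁅ v ⁆ z∈
      ... | inj₁ p = inj₁ p
      ... | inj₂ p = inj₂ (x∈⁅y⁆⇒x≡y v p)

  attached : ∀ {S a x C} → Component S a x C → Conn E (_∈ S) → a ∈ S → ∃[ u ] (u ∈ C × E u a)
  attached {S} {a} {x} {C} comp conn a∈S 
    with crossing C (conn (Component.inside comp (Component.start comp)) a∈S) (Component.start comp) (Component.avoids comp)
  ... | u , v , _ , v∈S , u∈C , v∉C , e with v ≟ a
  ...   | yes refl = u , u∈C , e
  ...   | no v≢a   = ⊥-elim (v∉C (Component.closed comp u∈C v∈S v≢a e))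

  rest-path : ∀ {S a D} → Closed S a D → ∀ {y} → Path E (_∈ S) y a → y ∉ D → Path E (_∈ (S ∸ˢ D)) y a
  rest-path closed ε y∉ = ε
  rest-path {a = a} {D} closed {y} (_◅_ {j = z} (e , y∈S , z∈S) p) y∉ with y ≟ a | z ∈? D
  ... | yes refl | _      = ε
  ... | no y≢a   | yes z∈ = ⊥-elim (y∉ (closed z∈ y∈S y≢a (E-sym e)))
  ... | no _     | no z∉  = (e , ∈∸⁺ y∈S y∉ , ∈∸⁺ z∈S z∉) ◅ rest-path closed p z∉

  rest-conn : ∀ {S a D} → Closed S a D → Conn E (_∈ S) → a ∈ S → Conn E (_∈ (S ∸ˢ D))
  rest-conn {a = a} closed conn a∈S = conn-hub E-sym a λ y∈ →
    let (y∈S , y∉D) = ∈∸⁻ y∈ in rest-path closed (conn y∈S a∈S) y∉D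

  -- The part `A` meets the rest of the graph only at `a`. The field `outside` makes the complement
  -- of a component of `A` minus `a` connected, as `HangOK` demands.
  record PieceOK (A : Sub) (a : V) : Set where
    field
      root    : a ∈ A
      conn    : Conn E (_∈ A)
      attach  : ∀ {x y} → x ∈ A → y ∉ A → E x y → x ≡ a
      outside : ∀ {y} → y ∉ A → Path E (λ x → x ∉ A ⊎ x ≡ a) y a

  record HangOK (K : Sub) : Set where
    field
      inner    : ∃[ x ] x ∈ K
      outer    : ∃[ y ] y ∉ K
      conn-in  : Conn E (_∈ K)
      conn-out : Conn E (_∉ K)

  Bd : Sub → V → Set
  Bd K x = x ∈ K × ∃[ y ] (y ∉ K × E x y)

  -- One or two pieces count as a clique. A path has at least three, so closing it with a root piece
  -- gives a cycle of length at least four.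
  data Hang (K : Sub) : Set₁ where
    cliq : ∀ {k} (P : Pieces G (_∈ K) (suc k) (Skel clique)) → (∀ {x} → Bd K x → x ≡ Pieces.ρ P (Pieces.π P x)) →
           (∀ i → Bd K (Pieces.ρ P i)) → Hang K
    path : ∀ {k} (P : Pieces G (_∈ K) (suc (suc (suc k))) PathAdj) →
           (∀ {x} → Bd K x → x ≡ Pieces.ρ P zero ⊎ x ≡ Pieces.ρ P (fromℕ (suc (suc k)))) →
           Bd K (Pieces.ρ P zero) → Bd K (Pieces.ρ P (fromℕ (suc (suc k)))) → Hang K

  Coded : Sub → V → Set₁
  Coded A a = ∃[ t ] Rep G t (_∈ A) a

  module Glue {A a x K} (ok : PieceOK A a) (comp : Component A a x K) where
    module O = PieceOK ok
    module C = Component comp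

    A′ : Sub
    A′ = A ∸ˢ K

    leaves : ∀ {u v} → u ∈ K → v ∉ K → E u v → v ≡ a
    leaves {u} {v} u∈ v∉ e with v ≟ a | v ∈? A
    ... | yes p  | _      = p
    ... | no v≢a | yes v∈ = ⊥-elim (v∉ (C.closed u∈ v∈ v≢a e))
    ... | no _   | no v∉A with O.attach (C.inside u∈) v∉A e
    ...   | refl = ⊥-elim (C.avoids u∈)

    a∈A′ : a ∈ A′
    a∈A′ = ∈∸⁺ O.root C.avoids

    to-root : ∀ {y} → y ∉ K → Path E (_∉ K) y a
    to-root {y} y∉ with y ∈? A
    ... | yes y∈A = path-⊆ (proj₂ ∘ ∈∸⁻) (rest-path C.closed (O.conn y∈A O.root) y∉)
    ... | no y∉A  = path-⊆ [ (λ z∉A z∈K → z∉A (C.inside z∈K)) , (λ { refl → C.avoids }) ]′ (O.outside y∉A)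

    hangOK : HangOK K
    hangOK = record { inner = x , C.start ; outer = a , C.avoids ; conn-in = C.conn
                    ; conn-out = conn-hub E-sym a to-root }

    rest-attach : ∀ {u v} → u ∈ A′ → v ∉ A′ → E u v → u ≡ a
    rest-attach {u} {v} u∈ v∉ e with ∈∸⁻ u∈ | v ∈? K
    ... | u∈A , u∉K | yes v∈K = leaves v∈K u∉K (E-sym e)
    ... | u∈A , u∉K | no v∉K  = O.attach u∈A (λ v∈A → v∉ (∈∸⁺ v∈A v∉K)) e

    restOK : PieceOK A′ a
    restOK = record
      { root    = a∈A′
      ; conn    = rest-conn C.closed O.conn O.root
      ; attach  = rest-attach
      ; outside = outside
      }
      where
      outside : ∀ {y} → y ∉ A′ → Path E (λ x → x ∉ A′ ⊎ x ≡ a) y a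
      outside {y} y∉ with y ∈? K | attached comp O.conn O.root
      ... | no y∉K | _ = path-⊆ [ (λ z∉A → inj₁ (z∉A ∘ proj₁ ∘ ∈∸⁻)) , inj₂ ]′
        (O.outside (λ y∈A → y∉ (∈∸⁺ y∈A y∉K)))
      ... | yes y∈K | u , u∈K , e =
        path-⊆ (λ z∈K → inj₁ (λ z∈ → proj₂ (∈∸⁻ z∈) z∈K)) (C.conn y∈K u∈K) ◅◅
        ((e , inj₁ (λ u∈ → proj₂ (∈∸⁻ u∈) u∈K) , inj₂ refl) ◅ ε)

    touches : ∀ {u} → Bd K u → E a u
    touches (u∈ , v , v∉ , e) with leaves u∈ v∉ e
    ... | refl = E-sym e

    boundary : ∀ {u v} → u ∈ A′ → v ∈ K → E u v → u ≡ a × Bd K v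
    boundary u∈ v∈ e =
      let u∉K = proj₂ (∈∸⁻ u∈) in leaves v∈ u∉K (E-sym e) , v∈ , _ , u∉K , E-sym e

    -- Edges leaving `K` all end in `a`, so `a` sees exactly the boundary of `K`: all roots of a
    -- clique, or the two ends of a path.
    code : Hang K → Coded A′ a → Coded A a
    code (cliq {k} P bd bd-ρ) (s , r) =
      _ , branch {f = clique}
        (Cons.cons (_∈? K) C.inside (proj₁ ∘ ∈∸⁻) (proj₂ ∘ ∈∸⁻) ∈∸⁺ r P (Skel clique) (λ z → z) (λ z → z) (λ z → z)
          (λ u∈ v∈ e → let (p , q) = boundary u∈ v∈ e in p , bd q , tt)
          (λ {i} _ → touches (bd-ρ i)))
        refl refl
    code (path {k} P bd bd-first bd-last) (s , r) =
      _ , branch {f = cycle}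
        (Cons.cons (_∈? K) C.inside (proj₁ ∘ ∈∸⁻) (proj₂ ∘ ∈∸⁻) ∈∸⁺ r P CycAdj CycAdj-sym (inj₁ ∘ PathAdj-suc) CycAdj-pred
          (λ u∈ v∈ e → let (p , q) = boundary u∈ v∈ e ; (q₁ , q₂) = ends (bd q) in p , q₁ , q₂)
          link)
        refl refl
      where
      open Pieces P
      CycAdj-sym : ∀ {k} {i j : Fin k} → CycAdj i j → CycAdj j i
      CycAdj-sym (inj₁ (inj₁ e))  = inj₁ (inj₂ e)
      CycAdj-sym (inj₁ (inj₂ e))  = inj₁ (inj₁ e)
      CycAdj-sym (inj₂ (inj₁ e))  = inj₂ (inj₂ e)
      CycAdj-sym (inj₂ (inj₂ e))  = inj₂ (inj₁ e)
      CycAdj-pred : ∀ {k} {i j : Fin k} → CycAdj (suc i) (suc j) → PathAdj i j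
      CycAdj-pred (inj₁ e)               = PathAdj-pred e
      CycAdj-pred (inj₂ (inj₁ (() , _)))
      CycAdj-pred (inj₂ (inj₂ (() , _)))
      ends : ∀ {v} → v ≡ ρ zero ⊎ v ≡ ρ (fromℕ (suc (suc k))) → v ≡ ρ (π v) × CycAdj zero (suc (π v))
      ends (inj₁ refl) rewrite πρ P zero = refl , inj₁ (inj₁ refl)
      ends (inj₂ refl) rewrite πρ P (fromℕ (suc (suc k))) =
        refl , inj₂ (inj₁ (refl , cong (λ z → suc (suc (suc (suc z)))) (toℕ-fromℕ k)))
      link : ∀ {i} → CycAdj zero (suc i) → E a (ρ i)
      link {i} (inj₁ (inj₁ e)) = subst (E a ∘ ρ) (toℕ-injective (sym (suc-injective e))) (touches bd-first)
      link {i} (inj₂ (inj₁ (_ , e))) = subst (E a ∘ ρ)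
        (toℕ-injective (trans (toℕ-fromℕ (suc (suc k))) (sym (suc-injective (suc-injective e))))) (touches bd-last)

  conn-everything : ∀ {x y} → Path E Everything x y
  conn-everything = Star.map (λ e → e , tt , tt) (connected _ _)

  -- K splits at a ∈ ∂K into the component M of K - a meeting the rest of ∂K, and A = K - M.
  module Peel {K a x M} (ok : HangOK K) (bd-a : Bd K a) (bd-x : Bd K x) (comp : Component K a x M)
    (only : ∀ {y} → Bd K y → y ≡ a ⊎ y ∈ M) where
    module O = HangOK ok
    module C = Component comp

    A : Sub
    A = K ∸ˢ M

    a∈K : a ∈ K
    a∈K = proj₁ bd-a

    o : V
    o = proj₁ (proj₂ bd-a)

    o∉K : o ∉ K
    o∉K = proj₁ (proj₂ (proj₂ bd-a))

    a-o : E a o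
    a-o = proj₂ (proj₂ (proj₂ bd-a))

    a∈A : a ∈ A
    a∈A = ∈∸⁺ a∈K C.avoids

    link-M : ∃[ u ] (u ∈ M × E u a)
    link-M = attached comp O.conn-in a∈K

    A-conn : Conn E (_∈ A)
    A-conn = rest-conn C.closed O.conn-in a∈K

    attach : ∀ {u v} → u ∈ A → v ∉ A → E u v → u ≡ a
    attach {u} {v} u∈ v∉ e with ∈∸⁻ u∈ | v ∈? K
    ... | u∈K , u∉M | no v∉K = [ id , (λ u∈M → ⊥-elim (u∉M u∈M)) ]′ (only (u∈K , v , v∉K , e))
    ... | u∈K , u∉M | yes v∈K with u ≟ a | v ∈? M
    ...   | yes p  | _       = p
    ...   | no _   | no v∉M  = ⊥-elim (v∉ (∈∸⁺ v∈K v∉M))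
    ...   | no u≢a | yes v∈M = ⊥-elim (u∉M (C.closed v∈M u∈K u≢a (E-sym e)))

    outside-a : ∀ {y} → y ∉ K → Path E (λ z → z ∉ K ⊎ z ≡ a) y a
    outside-a y∉ = path-⊆ inj₁ (O.conn-out y∉ o∉K) ◅◅ ((E-sym a-o , inj₁ o∉K , inj₂ refl) ◅ ε)

    pieceOK : PieceOK A a
    pieceOK = record { root = a∈A ; conn = A-conn ; attach = attach ; outside = outside }
      where
      outside : ∀ {y} → y ∉ A → Path E (λ z → z ∉ A ⊎ z ≡ a) y a
      outside {y} y∉ with y ∈? K | y ∈? M | link-M
      ... | no y∉K | _ | _ = path-⊆ [ (λ z∉K → inj₁ (z∉K ∘ proj₁ ∘ ∈∸⁻)) , inj₂ ]′ (outside-a y∉K)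
      ... | yes y∈K | no y∉M | _ = ⊥-elim (y∉ (∈∸⁺ y∈K y∉M))
      ... | yes y∈K | yes y∈M | u , u∈M , e =
        path-⊆ (λ z∈M → inj₁ (λ z∈ → proj₂ (∈∸⁻ z∈) z∈M)) (C.conn y∈M u∈M) ◅◅
        ((e , inj₁ (λ u∈ → proj₂ (∈∸⁻ u∈) u∈M) , inj₂ refl) ◅ ε)

    hangOK : HangOK M
    hangOK = record { inner = x , C.start ; outer = a , C.avoids ; conn-in = C.conn
                    ; conn-out = conn-hub E-sym a to-a }
      where
      to-a : ∀ {y} → y ∉ M → Path E (_∉ M) y a
      to-a {y} y∉ with y ∈? K
      ... | yes y∈K = path-⊆ (proj₂ ∘ ∈∸⁻) (A-conn (∈∸⁺ y∈K y∉) a∈A)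
      ... | no y∉K  = path-⊆ [ (λ z∉K z∈M → z∉K (C.inside z∈M)) , (λ { refl → C.avoids }) ]′ (outside-a y∉K)

    x∈M : x ∈ M
    x∈M = C.start

    -- The graph is partitioned into the outside of `K`, the part `A` and the pieces of `M`. All are
    -- connected, so a diamond contraction of the quotient is one of `G`.
    module Fan {k} {Q : Fin (suc k) → Fin (suc k) → Set} (P : Pieces G (_∈ M) (suc k) Q)
      (bd : ∀ {y} → Bd M y → y ≡ Pieces.ρ P (Pieces.π P y)) where
      open Pieces P

      part : ∀ {y} → Dec (y ∈ M) → Dec (y ∈ K) → Bool ⊎ Fin (suc k)
      part {y} (yes _) _       = inj₂ (π y)
      part     (no _)  (yes _) = inj₁ true
      part     (no _)  (no _)  = inj₁ false

      κ : V → Bool ⊎ Fin (suc k)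
      κ y = part (y ∈? M) (y ∈? K)

      Part : Bool ⊎ Fin (suc k) → V → Set
      Part (inj₁ true)  y = y ∈ A
      Part (inj₁ false) y = y ∉ K
      Part (inj₂ i)     y = y ∈ M × π y ≡ i

      κ⁻ : ∀ p {y} → κ y ≡ p → Part p y
      κ⁻ p {y} eq with y ∈? M | y ∈? K
      κ⁻ _ refl | yes y∈M | _       = y∈M , refl
      κ⁻ _ refl | no y∉M  | yes y∈K = ∈∸⁺ y∈K y∉M
      κ⁻ _ refl | no y∉M  | no y∉K  = y∉K

      κ⁺ : ∀ p {y} → Part p y → κ y ≡ p
      κ⁺ p {y} h with y ∈? M | y ∈? K
      κ⁺ (inj₁ true)  h | yes y∈M | _       = ⊥-elim (proj₂ (∈∸⁻ h) y∈M)
      κ⁺ (inj₁ false) h | yes y∈M | _       = ⊥-elim (h (C.inside y∈M))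
      κ⁺ (inj₂ i) (_ , refl) | yes y∈M | _  = refl
      κ⁺ (inj₁ true)  h | no y∉M  | yes y∈K = refl
      κ⁺ (inj₁ false) h | no y∉M  | yes y∈K = ⊥-elim (h y∈K)
      κ⁺ (inj₂ i)     h | no y∉M  | yes y∈K = ⊥-elim (y∉M (proj₁ h))
      κ⁺ (inj₁ true)  h | no y∉M  | no y∉K  = ⊥-elim (y∉K (proj₁ (∈∸⁻ h)))
      κ⁺ (inj₁ false) h | no y∉M  | no y∉K  = refl
      κ⁺ (inj₂ i)     h | no y∉M  | no y∉K  = ⊥-elim (y∉M (proj₁ h))

      Part-conn : ∀ p → Conn E (Part p)
      Part-conn (inj₁ true)  = A-conn
      Part-conn (inj₁ false) = O.conn-out
      Part-conn (inj₂ i)     = conn-hub E-sym (ρ i) (rep-path (rep i))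

      F : Bool ⊎ Fin (suc k) → Bool ⊎ Fin (suc k) → Set
      F = Touch E κ

      con-parts : Con E Everything F Everything
      con-parts = record
        { f     = κ
        ; into  = λ _ → tt
        ; onto  = λ {p} _ → onto p
        ; fibre = λ {u} {v} _ _ eq → path-⊆ (λ h → tt , κ⁺ (κ v) h) (Part-conn (κ v) (κ⁻ (κ v) eq) (κ⁻ (κ v) refl))
        ; edge→ = λ {u} {v} _ _ e _ → u , v , refl , refl , e
        ; edge← = λ _ _ (u , v , p , q , e) → u , v , tt , tt , p , q , e
        }
        where
        onto : ∀ p → ∃[ y ] (⊤ × κ y ≡ p)
        onto (inj₁ true)  = a , tt , κ⁺ (inj₁ true) a∈A
        onto (inj₁ false) = o , tt , κ⁺ (inj₁ false) o∉K
        onto (inj₂ i)     = ρ i , tt , κ⁺ (inj₂ i) (ρ∈ P i , πρ P i)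

      F? : ∀ p q → Dec (F p q)
      F? p q = any? λ u → any? λ v → ≡-dec _≟ᵇ_ _≟_ (κ u) p ×-dec ≡-dec _≟ᵇ_ _≟_ (κ v) q ×-dec edge? G u v

      touch-out : ∀ {y z} → y ∉ K → z ∈ M → E y z → F (inj₁ false) (inj₂ (π z))
      touch-out y∉ z∈ e = _ , _ , κ⁺ (inj₁ false) y∉ , κ⁺ (inj₂ _) (z∈ , refl) , e

      touch-a : ∀ {z} → z ∈ M → E a z → F (inj₁ true) (inj₂ (π z))
      touch-a z∈ e = _ , _ , κ⁺ (inj₁ true) a∈A , κ⁺ (inj₂ _) (z∈ , refl) , e

      meets : ∀ b → ∃[ i ] F (inj₁ b) (inj₂ i)
      meets true  = let (u , u∈ , e) = link-M in π u , touch-a u∈ (E-sym e)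
      meets false = let (_ , y , y∉ , e) = bd-x in π x , touch-out y∉ x∈M (E-sym e)

      open Quotient F (touch-sym E-sym)
        (λ c → no-diamond (model⇒≼ (con-trans con-parts c)))
        (_ , _ , κ⁺ (inj₁ true) a∈A , κ⁺ (inj₁ false) o∉K , a-o)
        (λ b i → F? (inj₁ b) (inj₂ i)) meets public

      Bd-M : ∀ {b i} → N b i → Bd M (ρ i)
      Bd-M {b} {i} (u , v , p , q , e) with κ⁻ (inj₂ i) q
      ... | v∈ , refl = subst (Bd M) (bd bd-v) bd-v
        where
        u∉M : ∀ b {u} → Part (inj₁ b) u → u ∉ M
        u∉M true  u∈A = proj₂ (∈∸⁻ u∈A)
        u∉M false u∉K = u∉K ∘ C.inside
        bd-v : Bd M v
        bd-v = v∈ , u , u∉M b (κ⁻ (inj₁ b) p) , E-sym e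

      -- Edges from `A` to `M` can only start at `a` and end at piece roots, so contact of the parts
      -- is already an edge between two known vertices.
      N-true : ∀ {i} → N true i → E a (ρ i)
      N-true {i} (u , v , p , q , e) with κ⁻ (inj₂ i) q | κ⁻ (inj₁ true) p
      ... | v∈ , refl | u∈A = subst₂ E
        (attach u∈A (λ v∈A → proj₂ (∈∸⁻ v∈A) v∈) e)
        (bd (v∈ , u , proj₂ (∈∸⁻ u∈A) , E-sym e)) e

      N-false : ∀ {i} → N false i → Bd K (ρ i)
      N-false {i} (u , v , p , q , e) with κ⁻ (inj₂ i) q | κ⁻ (inj₁ false) p
      ... | v∈ , refl | u∉K = subst (Bd K)
        (bd (v∈ , u , (u∉K ∘ C.inside) , E-sym e)) (C.inside v∈ , u , u∉K , E-sym e)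

      covered : ∀ {i} → Bd M (ρ i) → N true i ⊎ N false i
      covered {i} (ρ∈M , y , y∉M , e) with y ∈? K
      ... | yes y∈K = inj₁ (y , ρ i , κ⁺ (inj₁ true) (∈∸⁺ y∈K y∉M) , κ⁺ (inj₂ i) (ρ∈M , πρ P i) , E-sym e)
      ... | no y∉K  = inj₂ (y , ρ i , κ⁺ (inj₁ false) y∉K , κ⁺ (inj₂ i) (ρ∈M , πρ P i) , E-sym e)

      near : ∀ {i} → (∀ m → N true m → m ≡ i) → ∀ {z} → z ∈ M → E a z → z ≡ ρ i
      near h z∈ e = trans (bd (z∈ , a , C.avoids , E-sym e)) (cong ρ (h _ (touch-a z∈ e)))

      far : ∀ {j} → (∀ m → N false m → m ≡ j) → ∀ {z} → Bd K z → z ∈ M → z ≡ ρ j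
      far h (_ , y , y∉ , e) z∈ = trans (bd (z∈ , y , (y∉ ∘ C.inside) , e)) (cong ρ (h _ (touch-out y∉ z∈ (E-sym e))))

      edge-ρ : ∀ {i j} → i ≢ j → Q i j → F (inj₂ i) (inj₂ j)
      edge-ρ {i} {j} ne q = ρ i , ρ j , κ⁺ (inj₂ i) (ρ∈ P i , πρ P i) , κ⁺ (inj₂ j) (ρ∈ P j , πρ P j) , edge← ne q

    to-A : ∀ {u} → u ∈ A → u ∈ K × u ∉ M
    to-A = ∈∸⁻

    extend-path : ∀ {k} (P : Pieces G (_∈ M) (suc (suc k)) PathAdj) → Coded A a →
      (∀ {z} → z ∈ M → E a z → z ≡ Pieces.ρ P zero) → E a (Pieces.ρ P zero) →
      (∀ {z} → Bd K z → z ∈ M → z ≡ Pieces.ρ P (fromℕ (suc k))) → Bd K (Pieces.ρ P (fromℕ (suc k))) → Hang K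
    extend-path {k} P (s , r) near a-first far bd-last = path cons ends bd-a bd-last
      where
      open Pieces P
      cross : ∀ {u v} → u ∈ A → v ∈ M → E u v → u ≡ a × v ≡ ρ (π v) × PathAdj zero (suc (π v))
      cross u∈ v∈ e with attach u∈ (λ v∈A → proj₂ (∈∸⁻ v∈A) v∈) e
      ... | refl with near v∈ e
      ...   | refl rewrite πρ P zero = refl , refl , inj₁ refl
      link : ∀ {i} → PathAdj zero (suc i) → E a (ρ i)
      link (inj₁ e) = subst (E a ∘ ρ) (toℕ-injective (sym (suc-injective e))) a-first
      open Cons {A = _∈ A} {K = _∈ K} (_∈? M) C.inside (proj₁ ∘ to-A) (proj₂ ∘ to-A) ∈∸⁺ r P PathAdj PathAdj-sym
        PathAdj-suc PathAdj-pred cross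
        link
        using (cons)
      ends : ∀ {z} → Bd K z → z ≡ a ⊎ z ≡ ρ (fromℕ (suc k))
      ends bd-z with only bd-z
      ... | inj₁ p   = inj₁ p
      ... | inj₂ z∈M = inj₂ (far bd-z z∈M)

    extend-path′ : ∀ {k} (P : Pieces G (_∈ M) (suc (suc k)) PathAdj) → Coded A a →
      (∀ {z} → z ∈ M → E a z → z ≡ Pieces.ρ P (fromℕ (suc k))) → E a (Pieces.ρ P (fromℕ (suc k))) →
      (∀ {z} → Bd K z → z ∈ M → z ≡ Pieces.ρ P zero) → Bd K (Pieces.ρ P zero) → Hang K
    extend-path′ {k} P c near a-last far bd-first =
      extend-path (pieces-path-reverse P) c near a-last
        (λ bd-z z∈ → trans (far bd-z z∈) (cong ρ (sym first≡)))
        (subst (Bd K ∘ ρ) (sym first≡) bd-first)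
      where
      open Pieces P
      first≡ : opposite (fromℕ (suc k)) ≡ zero
      first≡ = opposite-involutive {suc (suc k)} zero

    -- If both sides see every piece of a clique, the piece of `a` extends it. In the mutual case
    -- the clique has two pieces and becomes a path of three, the piece of `a` next to the one it
    -- sees. A longer path is extended at the end that `a` sees, after reversal if necessary.
    grow : Hang M → Coded A a → Hang K
    grow (cliq {k} P bd bd-ρ) c@(s , r) 
      with Fan.Clique.cases P bd (λ ne → Fan.edge-ρ P bd ne tt) (λ i → Fan.covered P bd (bd-ρ i))
    ... | inj₁ all = cliq cons boundary bd-ρ′
      where
      open Fan P bd using (N-true; N-false)
      open Pieces P
      cross : ∀ {u v} → u ∈ A → v ∈ M → E u v → u ≡ a × v ≡ ρ (π v) × ⊤
      cross {u} u∈ v∈ e = attach u∈ (λ v∈A → proj₂ (∈∸⁻ v∈A) v∈) e ,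
        bd (v∈ , u , proj₂ (∈∸⁻ u∈) , E-sym e) , tt
      open Cons {A = _∈ A} {K = _∈ K} (_∈? M) C.inside (proj₁ ∘ to-A) (proj₂ ∘ to-A) ∈∸⁺ r P (Skel clique)
        (λ z → z) (λ z → z) (λ z → z) cross (λ {i} _ → N-true (all true i))
      boundary : ∀ {z} → Bd K z → z ≡ ρ′ (π′ z)
      boundary bd-z@(_ , y , y∉ , e) with only bd-z
      ... | inj₁ refl = cons-root
      ... | inj₂ z∈M  = cons-boundary z∈M (bd (z∈M , y , (y∉ ∘ C.inside) , e))
      bd-ρ′ : ∀ i → Bd K (ρ′ i)
      bd-ρ′ zero    = bd-a
      bd-ρ′ (suc i) = N-false (all false i)
    ... | inj₂ (i , j , i≢j , two , Ai , ¬Aj , Rj , ¬Ri) with two-elements i j i≢j two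
    ...   | refl = two-pieces i j i≢j
        (near (λ m Nm → [ id , (λ { refl → ⊥-elim (¬Aj Nm) }) ]′ (two m))) (N-true Ai)
        (far (λ m Nm → [ (λ { refl → ⊥-elim (¬Ri Nm) }) , id ]′ (two m))) (N-false Rj)
      where
      open Fan P bd
      open Pieces P
      P₂ : Pieces G (_∈ M) 2 PathAdj
      P₂ = pieces-map
        (λ { {0F} {0F} ne _ → ⊥-elim (ne refl) ; {0F} {1F} _ _ → inj₁ refl
           ; {1F} {0F} _ _ → inj₂ refl ; {1F} {1F} ne _ → ⊥-elim (ne refl) })
        (λ _ _ → tt) P
      two-pieces : ∀ i j → i ≢ j → (∀ {z} → z ∈ M → E a z → z ≡ ρ i) → E a (ρ i) →
        (∀ {z} → Bd K z → z ∈ M → z ≡ ρ j) → Bd K (ρ j) → Hang K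
      two-pieces 0F 0F ne = ⊥-elim (ne refl)
      two-pieces 0F 1F ne = extend-path P₂ c
      two-pieces 1F 0F ne = extend-path′ P₂ c
      two-pieces 1F 1F ne = ⊥-elim (ne refl)
    grow (path {k} P bd bd-first bd-last) c = result cases
      where
      open Pieces P
      last′ : Fin (suc (suc (suc k)))
      last′ = fromℕ (suc (suc k))
      bd′ : ∀ {y} → Bd M y → y ≡ ρ (π y)
      bd′ bd-y with bd bd-y
      ... | inj₁ refl = cong ρ (sym (πρ P zero))
      ... | inj₂ refl = cong ρ (sym (πρ P last′))
      open Fan P bd′
      ends : ∀ {b i} → N b i → i ≡ zero ⊎ i ≡ last′
      ends {b} {i} Ni with bd (Bd-M Ni)
      ... | inj₁ eq = inj₁ (trans (sym (πρ P i)) (trans (cong π eq) (πρ P zero)))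
      ... | inj₂ eq = inj₂ (trans (sym (πρ P i)) (trans (cong π eq) (πρ P last′)))
      open LongPath (s≤s (s≤s z≤n)) (λ e → edge-ρ (PathAdj-≢ e) e) ends (covered bd-first) (covered bd-last)
        using (cases; Split)
      result : Split zero last′ ⊎ Split last′ zero → Hang K
      result (inj₁ (A₀ , ¬Aₗ , Rₗ , ¬R₀)) = extend-path P c
        (near (λ m Nm → [ id , (λ { refl → ⊥-elim (¬Aₗ Nm) }) ]′ (ends Nm))) (N-true A₀)
        (far (λ m Nm → [ (λ { refl → ⊥-elim (¬R₀ Nm) }) , id ]′ (ends Nm))) (N-false Rₗ)
      result (inj₂ (Aₗ , ¬A₀ , R₀ , ¬Rₗ)) = extend-path′ P c
        (near (λ m Nm → [ (λ { refl → ⊥-elim (¬A₀ Nm) }) , id ]′ (ends Nm))) (N-true Aₗ)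
        (far (λ m Nm → [ id , (λ { refl → ⊥-elim (¬Rₗ Nm) }) ]′ (ends Nm))) (N-false R₀)

  -- Two components of K - a meeting ∂K give a diamond with centre edge between V - K and the part of a.
  two-components : ∀ {K a x y M Z} → HangOK K → Bd K a → Bd K x → Bd K y →
    Component K a x M → Component K a y Z → y ∉ M → ⊥
  two-components {K} {a} {x} {y} {M} {Z} ok bd-a@(a∈K , o , o∉K , a-o) bd-x bd-y compM compZ y∉M =
    no-diamond (model⇒≼ (con-diamond E-sym γ fibre
      (o , a , γ⁺ 0F o∉K , γ⁺ 1F a∈A , E-sym a-o)
      (let (x∈K , z , z∉K , e) = bd-x in z , x , γ⁺ 0F z∉K , γ⁺ 2F CM.start , E-sym e)
      (let (y∈K , z , z∉K , e) = bd-y in z , y , γ⁺ 0F z∉K , γ⁺ 3F CZ.start , E-sym e)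
      (let (u , u∈ , e) = attached compM O.conn-in a∈K in a , u , γ⁺ 1F a∈A , γ⁺ 2F u∈ , E-sym e)
      (let (u , u∈ , e) = attached compZ O.conn-in a∈K in a , u , γ⁺ 1F a∈A , γ⁺ 3F u∈ , E-sym e)
      apart))
    where
    module O = HangOK ok
    module CM = Component compM
    module CZ = Component compZ

    disjoint : ∀ {w} → w ∈ M → w ∉ Z
    disjoint w∈M w∈Z with crossing M (CZ.conn w∈Z CZ.start) w∈M y∉M
    ... | u , v , _ , v∈Z , u∈M , v∉M , e =
      v∉M (CM.closed u∈M (CZ.inside v∈Z) (λ { refl → CZ.avoids v∈Z }) e)

    D : Sub
    D = M ∪ Z

    D-closed : Closed K a D
    D-closed u∈D v∈K v≢a e with x∈p∪q⁻ M Z u∈D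
    ... | inj₁ u∈M = x∈p∪q⁺ (inj₁ (CM.closed u∈M v∈K v≢a e))
    ... | inj₂ u∈Z = x∈p∪q⁺ (inj₂ (CZ.closed u∈Z v∈K v≢a e))

    a∈A : a ∈ (K ∸ˢ D)
    a∈A = ∈∸⁺ a∈K λ a∈D → [ CM.avoids , CZ.avoids ]′ (x∈p∪q⁻ M Z a∈D)

    Part : Fin 4 → V → Set
    Part 0F z = z ∉ K
    Part 1F z = z ∈ (K ∸ˢ D)
    Part 2F z = z ∈ M
    Part 3F z = z ∈ Z

    Part-conn : ∀ i → Conn E (Part i)
    Part-conn 0F = O.conn-out
    Part-conn 1F = rest-conn D-closed O.conn-in a∈K
    Part-conn 2F = CM.conn
    Part-conn 3F = CZ.conn

    classify : ∀ z → ∃[ i ] Part i z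
    classify z with z ∈? K | z ∈? M | z ∈? Z
    ... | no z∉K | _ | _ = 0F , z∉K
    ... | yes _ | yes z∈M | _ = 2F , z∈M
    ... | yes _ | no _ | yes z∈Z = 3F , z∈Z
    ... | yes z∈K | no z∉M | no z∉Z = 1F , ∈∸⁺ z∈K (λ z∈D → [ z∉M , z∉Z ]′ (x∈p∪q⁻ M Z z∈D))

    unique : ∀ i j {z} → Part i z → Part j z → i ≡ j
    unique 0F 0F p q = refl
    unique 0F 1F p q = ⊥-elim (p (proj₁ (∈∸⁻ q)))
    unique 0F 2F p q = ⊥-elim (p (CM.inside q))
    unique 0F 3F p q = ⊥-elim (p (CZ.inside q))
    unique 1F 0F p q = ⊥-elim (q (proj₁ (∈∸⁻ p)))
    unique 1F 1F p q = refl
    unique 1F 2F p q = ⊥-elim (proj₂ (∈∸⁻ p) (x∈p∪q⁺ (inj₁ q)))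
    unique 1F 3F p q = ⊥-elim (proj₂ (∈∸⁻ p) (x∈p∪q⁺ (inj₂ q)))
    unique 2F 0F p q = ⊥-elim (q (CM.inside p))
    unique 2F 1F p q = ⊥-elim (proj₂ (∈∸⁻ q) (x∈p∪q⁺ (inj₁ p)))
    unique 2F 2F p q = refl
    unique 2F 3F p q = ⊥-elim (disjoint p q)
    unique 3F 0F p q = ⊥-elim (q (CZ.inside p))
    unique 3F 1F p q = ⊥-elim (proj₂ (∈∸⁻ q) (x∈p∪q⁺ (inj₂ p)))
    unique 3F 2F p q = ⊥-elim (disjoint q p)
    unique 3F 3F p q = refl

    γ : V → Fin 4
    γ z = proj₁ (classify z)

    γ⁻ : ∀ i {z} → γ z ≡ i → Part i z
    γ⁻ i {z} refl = proj₂ (classify z)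

    γ⁺ : ∀ i {z} → Part i z → γ z ≡ i
    γ⁺ i {z} p = unique _ i (proj₂ (classify z)) p

    fibre : ∀ {p q} → γ p ≡ γ q → Path E (λ r → γ r ≡ γ q) p q
    fibre {p} {q} eq = path-⊆ (γ⁺ (γ q)) (Part-conn (γ q) (γ⁻ (γ q) eq) (γ⁻ (γ q) refl))

    apart : ¬ Touch E γ 2F 3F
    apart (u , v , p , q , e) = disjoint
      (CM.closed (γ⁻ 2F p) (CZ.inside (γ⁻ 3F q)) (λ { refl → CZ.avoids (γ⁻ 3F q) }) e) (γ⁻ 3F q)

  bd? : ∀ K x → Dec (Bd K x)
  bd? K x = (x ∈? K) ×-dec any? λ y → ¬? (y ∈? K) ×-dec edge? G x y

  boundary-nonempty : ∀ {K} → HangOK K → ∃[ a ] Bd K a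
  boundary-nonempty {K} ok with crossing {P = Everything} K conn-everything (proj₂ (HangOK.inner ok)) (proj₂ (HangOK.outer ok))
  ... | u , v , _ , _ , u∈ , v∉ , e = u , u∈ , v , v∉ , e

  nonempty-size : ∀ {A : Sub} {a} → a ∈ A → ¬ (∣ A ∣ ≤ 0)
  nonempty-size {A} {a} a∈ le with ≤-trans (≤-reflexive (sym (∣⁅x⁆∣≡1 a)))
    (≤-trans (p⊆q⇒∣p∣≤∣q∣ (λ z∈ → subst (_∈ A) (sym (x∈⁅y⁆⇒x≡y a z∈)) a∈)) le)
  ... | ()

  CodePieces : ℕ → Set₁
  CodePieces m = ∀ A a → ∣ A ∣ ≤ m → PieceOK A a → Coded A a

  CodeHangs : ℕ → Set₁
  CodeHangs m = ∀ K → ∣ K ∣ ≤ m → HangOK K → Hang K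

  piece-step : ∀ {m} → CodePieces m → CodeHangs m → CodePieces (suc m)
  piece-step code-piece code-hang A a le ok with any? (λ x → (x ∈? A) ×-dec ¬? (x ≟ a))
  ... | no none = node clique _ , leaf (PieceOK.root ok) only
    where
    only : ∀ {x} → x ∈ A → x ≡ a
    only {x} x∈ with x ≟ a
    ... | yes p = p
    ... | no ne = ⊥-elim (none (x , x∈ , ne))
  ... | yes (x , x∈A , x≢a) with component A a x x∈A x≢a
  ...   | K , comp = code (code-hang K (≤-pred (≤-trans K<A le)) hangOK)
                          (code-piece A′ a (≤-pred (≤-trans (∸-< x∈A C.start) le)) restOK)
    where
    open Glue ok comp
    K<A : ∣ K ∣ < ∣ A ∣
    K<A = p⊂q⇒∣p∣<∣q∣ (C.inside , a , O.root , C.avoids)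

  hang-step : ∀ {m} → CodePieces m → CodeHangs m → CodeHangs (suc m)
  hang-step code-piece code-hang K le ok with boundary-nonempty ok
  ... | a , bd-a@(a∈K , o , o∉K , a-o) with any? (λ x → bd? K x ×-dec ¬? (x ≟ a))
  -- With a single boundary vertex, `K` itself is a piece rooted there. Its size has not dropped, so
  -- pieces must be settled before hangs at each size.
  ...   | no none = cliq (pieces-single (proj₂ (piece-step code-piece code-hang K a le whole))) only (λ _ → bd-a)
    where
    module O = HangOK ok
    only : ∀ {x} → Bd K x → x ≡ a
    only {x} bd-x with x ≟ a
    ... | yes p = p
    ... | no ne = ⊥-elim (none (x , bd-x , ne))
    whole : PieceOK K a
    whole = record
      { root = a∈K ; conn = O.conn-in ; attach = λ x∈ y∉ e → only (x∈ , _ , y∉ , e)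
      ; outside = λ y∉ → path-⊆ inj₁ (O.conn-out y∉ o∉K) ◅◅ ((E-sym a-o , inj₁ o∉K , inj₂ refl) ◅ ε) }
  ...   | yes (x , bd-x , x≢a) with component K a x (proj₁ bd-x) x≢a
  ...     | M , compM with any? (λ y → bd? K y ×-dec ¬? (y ≟ a) ×-dec ¬? (y ∈? M))
  ...       | yes (y , bd-y , y≢a , y∉M) =
    let (Z , compZ) = component K a y (proj₁ bd-y) y≢a
    in ⊥-elim (two-components ok bd-a bd-x bd-y compM compZ y∉M)
  ...       | no none = grow (code-hang M (≤-pred (≤-trans M<K le)) hangOK)
                             (code-piece A a (≤-pred (≤-trans (∸-< (proj₁ bd-x) C.start) le)) pieceOK)
    where
    only : ∀ {y} → Bd K y → y ≡ a ⊎ y ∈ M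
    only {y} bd-y with y ≟ a | y ∈? M
    ... | yes p | _     = inj₁ p
    ... | no _  | yes q = inj₂ q
    ... | no p  | no q  = ⊥-elim (none (y , bd-y , p , q))
    open Peel ok bd-a bd-x compM only using (grow; hangOK; pieceOK; A; module C)
    M<K : ∣ M ∣ < ∣ K ∣
    M<K = p⊂q⇒∣p∣<∣q∣ (C.inside , a , proj₁ bd-a , C.avoids)

  code-all : ∀ m → CodePieces m × CodeHangs m
  code-all zero = (λ A a le ok → ⊥-elim (nonempty-size (PieceOK.root ok) le)) ,
                  (λ K le ok → ⊥-elim (nonempty-size (proj₂ (HangOK.inner ok)) le))
  code-all (suc m) = let (p , h) = code-all m in piece-step p h , hang-step p h

  coded : ∀ a → ∃[ t ] Rep G t Everything a
  coded a with proj₁ (code-all ∣ full {n G} ∣) full a ≤-refl record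
    { root = ∈⊤ ; conn = λ _ _ → path-⊆ (λ _ → ∈⊤) conn-everything
    ; attach = λ _ y∉ _ → ⊥-elim (y∉ ∈⊤) ; outside = λ y∉ → ⊥-elim (y∉ ∈⊤) }
  ... | t , r = t , rep-resp (λ _ → tt) (λ _ → ∈⊤) r

-- The two antichains and the theorem

edge-walk : ∀ G x y → Edge G x y → Star (Edge G) x y
edge-walk G x y e = _◅_ {j = y} e ε

walk-reverse : ∀ G {x y} → Star (Edge G) x y → Star (Edge G) y x
walk-reverse G = Star.reverse λ {x} {y} → edge-sym G {x} {y}

no-descent : ∀ m (s : ℕ → ℕ) → s 0 ≤ m → ¬ (∀ i → s (suc i) < s i)
no-descent zero    s le dec with ≤-trans (dec 0) le
... | ()
no-descent (suc m) s le dec = no-descent m (s ∘ suc) (≤-pred (≤-trans (dec 0) le)) (dec ∘ suc)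

≼diamond⇒WQO : ∀ {H} → H ≼ diamond → WQO (Excl H)
≼diamond⇒WQO {H} H≼diamond = decreasing , antichain
  where
  decreasing : ¬ (Σ (ℕ → Graph) λ s → (∀ i → Excl H (s i)) × (∀ i → (s (suc i) ≼ s i) × ¬ (s i ≼ s (suc i))))
  decreasing (s , _ , dec) = no-descent _ (n ∘ s) ≤-refl λ i →
    [ (λ s≼ → ⊥-elim (proj₂ (dec i) s≼)) , id ]′ (≼⇒≽⊎< (proj₁ (dec i)))

  antichain : ¬ (Σ (ℕ → Graph) λ s → (∀ i → Excl H (s i)) × (∀ i j → i ≢ j → ¬ (s i ≼ s j)))
  antichain (s , ex , anti) = kruskal (proj₁ ∘ code) λ i j i<j t⊑u →
      anti i j (<⇒≢ i<j) (model⇒≼ (proj₁ (rep-mono {s j} {s i} t⊑u (proj₂ (code i)) (proj₂ (code j)))))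
    where
    root : ∀ i → Fin (n (s i))
    root i = fromℕ< (proj₁ (proj₁ (ex i)))
    code : ∀ i → ∃[ t ] Rep (s i) t Everything (root i)
    code i = Structure.coded (s i) (proj₂ (proj₁ (ex i)))
      (λ diamond≼ → proj₂ (ex i) (diamond≼ ◅◅ H≼diamond)) (root i)

antichain-in-Excl : ∀ {H} → (s : ℕ → Graph) → (∀ i → Connected (s i)) → (∀ i → ¬ (H ≼ s i)) →
  (∀ i j → s i ≼ s j → i ≡ j) → ¬ WQO (Excl H)
antichain-in-Excl s conn avoid anti (_ , no-antichain) =
  no-antichain (s , (λ i → conn i , avoid i) , λ i j i≢j s≼ → i≢j (anti i j s≼))

module _ (G H : Graph) (M : Model G H) where

  model-size : n H ≤ n G
  model-size = injective⇒≤ (section-injective G H M)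

  injective-size : ¬ Collision G H M → n G ≡ n H
  injective-size ¬c = ≤-antisym (no-collision⇒≤ G H M ¬c) model-size

-- Complete bipartite graphs K₂,ᵣ: the vertices 0 and 1 form one side.

hub : ∀ {r} → Fin (suc (suc r)) → Bool
hub 0F            = true
hub 1F            = true
hub (suc (suc _)) = false

hub? : ∀ {r} (x : Fin (suc (suc r))) → hub x ≡ true ⊎ hub x ≡ false
hub? 0F            = inj₁ refl
hub? 1F            = inj₁ refl
hub? (suc (suc _)) = inj₂ refl

module Bipartite (r : ℕ) where
  open FromRelation {suc (suc r)} (λ x y → hub x ≢ hub y) (λ x y → ¬? (hub x ≟ᵇ hub y)) (λ ne → ne ∘ sym) (λ ne → ne refl) public

K₂ : ℕ → Graph
K₂ r = Bipartite.graph r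

K₂-connected : ∀ r → Connected (K₂ (suc r))
K₂-connected r = s≤s z≤n , λ x y → to-0 x ◅◅ walk-reverse (K₂ (suc r)) (to-0 y)
  where
  open Bipartite (suc r)
  to-0 : ∀ x → Star (Edge graph) x 0F
  to-0 0F            = ε
  to-0 1F            = edge-walk graph 1F 2F (edge⁺ {1F} {2F} λ ()) ◅◅ edge-walk graph 2F 0F (edge⁺ {2F} {0F} λ ())
  to-0 (suc (suc x)) = edge-walk graph (suc (suc x)) 0F (edge⁺ {suc (suc x)} {0F} λ ())

Dominating : (H : Graph) → Fin (n H) → Set
Dominating H c = ∀ x → x ≢ c → Edge H c x

TwoCentres : Graph → Set
TwoCentres H = ∃[ c ] ∃[ d ] (Dominating H c × Dominating H d ×
  (∀ x y → Edge H x y → (x ≡ c ⊎ x ≡ d) ⊎ (y ≡ c ⊎ y ≡ d)))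

dominating? : ∀ H c → Dec (Dominating H c)
dominating? H c = all? λ x → ¬? (x ≟ c) →-dec edge? H c x

two-centres? : ∀ H → Dec (TwoCentres H)
two-centres? H = any? λ c → any? λ d → dominating? H c ×-dec dominating? H d ×-dec
  all? λ x → all? λ y → edge? H x y →-dec (((x ≟ c) ⊎-dec (x ≟ d)) ⊎-dec ((y ≟ c) ⊎-dec (y ≟ d)))

-- A nontrivial fibre contains an edge, merging a hub `u` with some `ℓ` on the other side. The
-- merged vertex reaches that side through `u` and the second hub through `ℓ`; the second hub
-- likewise reaches everything, and every edge has a hub end.
collision⇒two-centres : ∀ r H (M : Model (K₂ r) H) → Collision (K₂ r) H M → TwoCentres H
collision⇒two-centres r H M (x , y , x≢y , eq) with Con.fibre M {x} {y} tt tt eq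
... | ε = ⊥-elim (x≢y refl)
... | _◅_ {j = w} (e , (_ , p) , (_ , q)) _ = merged x w (edge⁻ {x} {w} e) (trans p (sym q))
  where
  open Con M
  open Bipartite r

  f-edge : ∀ {x y} → hub x ≢ hub y → f x ≢ f y → Edge H (f x) (f y)
  f-edge {x} {y} ne = edge→ tt tt (edge⁺ {x} {y} ne)

  centres : ∀ u v ℓ → hub u ≡ true → hub v ≡ true → hub ℓ ≡ false → (∀ z → hub z ≡ true → z ≡ u ⊎ z ≡ v) →
            f u ≡ f ℓ → TwoCentres H
  centres u v ℓ hu hv hℓ hubs uℓ = f u , f v , dom-u , dom-v , edges
    where
    hub≢ : ∀ {x y} → hub x ≡ true → hub y ≡ false → hub {r} x ≢ hub {r} y
    hub≢ p q e with trans (sym p) (trans e q)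
    ... | ()
    dom-u : Dominating H (f u)
    dom-u z z≢ with onto {z} tt
    ... | z′ , _ , refl with hub? z′
    ...   | inj₂ hz = f-edge (hub≢ hu hz) (z≢ ∘ sym)
    ...   | inj₁ hz with hubs z′ hz
    ...     | inj₁ refl = ⊥-elim (z≢ refl)
    ...     | inj₂ refl = subst (λ a → Edge H a (f v)) (sym uℓ)
      (f-edge (hub≢ hv hℓ ∘ sym) (λ e → z≢ (trans (sym e) (sym uℓ))))
    dom-v : Dominating H (f v)
    dom-v z z≢ with onto {z} tt
    ... | z′ , _ , refl with hub? z′
    ...   | inj₂ hz = f-edge (hub≢ hv hz) (z≢ ∘ sym)
    ...   | inj₁ hz with hubs z′ hz
    ...     | inj₂ refl = ⊥-elim (z≢ refl)
    ...     | inj₁ refl = subst (Edge H (f v)) (sym uℓ) (f-edge (hub≢ hv hℓ) (λ e → z≢ (trans uℓ (sym e))))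
    edges : ∀ x y → Edge H x y → (x ≡ f u ⊎ x ≡ f v) ⊎ (y ≡ f u ⊎ y ≡ f v)
    edges x y e with edge← tt tt e
    ... | x′ , y′ , _ , _ , refl , refl , e′ with hub? x′ | hub? y′
    ...   | inj₁ hx | _       = inj₁ ([ inj₁ ∘ cong f , inj₂ ∘ cong f ]′ (hubs x′ hx))
    ...   | inj₂ _  | inj₁ hy = inj₂ ([ inj₁ ∘ cong f , inj₂ ∘ cong f ]′ (hubs y′ hy))
    ...   | inj₂ hx | inj₂ hy = ⊥-elim (edge⁻ {x′} {y′} e′ (trans hx (sym hy)))

  other : ∀ (u : Fin (suc (suc r))) → hub u ≡ true → ∃[ v ] (hub {r} v ≡ true × (∀ z → hub z ≡ true → z ≡ u ⊎ z ≡ v))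
  other 0F _ = 1F , refl , λ { 0F _ → inj₁ refl ; 1F _ → inj₂ refl }
  other 1F _ = 0F , refl , λ { 0F _ → inj₂ refl ; 1F _ → inj₁ refl }

  merged : ∀ x w → hub x ≢ hub w → f x ≡ f w → TwoCentres H
  merged x w ne eq with hub? x | hub? w
  ... | inj₁ hx | inj₁ hw = ⊥-elim (ne (trans hx (sym hw)))
  ... | inj₂ hx | inj₂ hw = ⊥-elim (ne (trans hx (sym hw)))
  ... | inj₁ hx | inj₂ hw = let (v , hv , hubs) = other x hx in centres x v w hx hv hw hubs eq
  ... | inj₂ hx | inj₁ hw = let (v , hv , hubs) = other w hw in centres w v x hw hv hx hubs (sym eq)

K₂-no-dominating : ∀ r c → ¬ Dominating (K₂ (suc (suc r))) c
K₂-no-dominating r c dom = go c dom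
  where
  open Bipartite (suc (suc r))
  go : ∀ c → ¬ Dominating graph c
  go 0F dom = edge⁻ {0F} {1F} (dom 1F (λ ())) refl
  go 1F dom = edge⁻ {1F} {0F} (dom 0F (λ ())) refl
  go 2F dom = edge⁻ {2F} {3F} (dom 3F (λ ())) refl
  go (suc (suc (suc c))) dom = edge⁻ {suc (suc (suc c))} {2F} (dom 2F (λ ())) refl

WQO⇒two-centres : ∀ {H} → WQO (Excl H) → TwoCentres H
WQO⇒two-centres {H} wqo with two-centres? H
... | yes p = p
... | no ¬p = ⊥-elim (antichain-in-Excl s (λ i → K₂-connected _) avoid anti wqo)
  where
  s : ℕ → Graph
  -- More vertices than `H` force a collision in any model of `H`, and at least two non-hubs exclude
  -- a dominating vertex.
  s i = K₂ (suc (suc (n H + i)))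
  avoid : ∀ i → ¬ (H ≼ s i)
  avoid i H≼ with collision? (s i) H (≼⇒model H≼)
  ... | yes c = ¬p (collision⇒two-centres _ H (≼⇒model H≼) c)
  ... | no ¬c = <-irrefl refl (≤-trans (s≤s (m≤m+n (n H) i))
    (≤-trans (m≤n+m _ 3) (≤-reflexive (injective-size (s i) H (≼⇒model H≼) ¬c))))
  anti : ∀ i j → s i ≼ s j → i ≡ j
  anti i j s≼ with collision? (s j) (s i) (≼⇒model s≼)
  ... | yes c = ⊥-elim (K₂-no-dominating _ _ (proj₁ (proj₂ (proj₂ (collision⇒two-centres _ (s i) (≼⇒model s≼) c)))))
  ... | no ¬c = +-cancelˡ-≡ (4 + n H) i j (sym (injective-size (s j) (s i) (≼⇒model s≼) ¬c))

-- Complements of cycles: x and prev x are the consecutive vertices of the cycle on Fin (5 + m).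

module CoCycle (m : ℕ) where

  -- From length five on, the complement of the cycle is connected and the cycle has neither a
  -- triangle nor a 4-cycle.
  N : ℕ
  N = 5 + m

  prev : Fin N → Fin N
  prev zero    = fromℕ (4 + m)
  prev (suc i) = inject₁ i

  prev-injective : ∀ {x y} → prev x ≡ prev y → x ≡ y
  prev-injective {zero}  {zero}  _  = refl
  prev-injective {zero}  {suc y} eq = ⊥-elim (fromℕ≢inject₁ eq)
  prev-injective {suc x} {zero}  eq = ⊥-elim (fromℕ≢inject₁ (sym eq))
  prev-injective {suc x} {suc y} eq = cong suc (inject₁-injective eq)

  next : Fin N → Fin N
  next x with view x
  ... | ‵fromℕ     = zero
  ... | ‵inject₁ i = suc i

  prev-next : ∀ x → prev (next x) ≡ x
  prev-next x with view x
  ... | ‵fromℕ     = refl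
  ... | ‵inject₁ i = refl

  iter : ℕ → Fin N → Fin N
  iter zero    x = x
  iter (suc k) x = prev (iter k x)

  prev-toℕ : ∀ x → ∃[ w ] suc (toℕ (prev x)) ≡ toℕ x + w * N
  prev-toℕ zero    = 1 , cong suc (trans (toℕ-fromℕ (4 + m)) (sym (+-identityʳ (4 + m))))
  prev-toℕ (suc i) = 0 , cong suc (trans (toℕ-inject₁ i) (sym (+-identityʳ _)))

  -- Subtraction modulo `N` without subtraction: `w` counts the passages from index zero to the top
  -- index.
  iter-toℕ : ∀ k x → ∃[ w ] (k + toℕ (iter k x) ≡ toℕ x + w * N)
  iter-toℕ zero    x = 0 , sym (+-identityʳ _)
  iter-toℕ (suc k) x with iter-toℕ k x | prev-toℕ (iter k x)
  ... | w , eq | w′ , eq′ = w′ + w , (begin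
      suc k + toℕ (prev (iter k x))        ≡⟨ sym (+-suc k _) ⟩
      k + suc (toℕ (prev (iter k x)))      ≡⟨ cong (k +_) eq′ ⟩
      k + (toℕ (iter k x) + w′ * N)        ≡⟨ sym (+-assoc k _ _) ⟩
      k + toℕ (iter k x) + w′ * N          ≡⟨ cong (_+ w′ * N) eq ⟩
      toℕ x + w * N + w′ * N               ≡⟨ +-assoc (toℕ x) _ _ ⟩
      toℕ x + (w * N + w′ * N)             ≡⟨ cong (toℕ x +_) (trans (+-comm (w * N) _) (sym (*-distribʳ-+ N w′ w))) ⟩
      toℕ x + (w′ + w) * N                 ∎)
    where open ≡-Reasoning

  iter-≢ : ∀ {k} → 1 ≤ k → k ≤ 4 → ∀ {x} → iter k x ≢ x
  iter-≢ {k} 1≤k k≤4 {x} eq with iter-toℕ k x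
  ... | w , p = absurd w 1≤k k≤4 (+-cancelˡ-≡ (toℕ x) k (w * N)
      (trans (+-comm (toℕ x) k) (trans (cong (λ z → k + toℕ z) (sym eq)) p)))
    where
    absurd : ∀ {k} w → 1 ≤ k → k ≤ 4 → k ≢ w * N
    absurd zero    ()  _   refl
    absurd (suc w) _   k≤4 refl with ≤-trans (≤-trans (m≤m+n 5 m) (m≤m+n N (w * N))) k≤4
    ... | s≤s (s≤s (s≤s (s≤s ())))

  iter₁ : ∀ {x} → prev x ≢ x
  iter₁ = iter-≢ {1} (s≤s z≤n) (s≤s z≤n)

  iter₂ : ∀ {x} → prev (prev x) ≢ x
  iter₂ = iter-≢ {2} (s≤s z≤n) (s≤s (s≤s z≤n))

  iter₃ : ∀ {x} → prev (prev (prev x)) ≢ x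
  iter₃ = iter-≢ {3} (s≤s z≤n) (s≤s (s≤s (s≤s z≤n)))

  iter₄ : ∀ {x} → prev (prev (prev (prev x))) ≢ x
  iter₄ = iter-≢ {4} (s≤s z≤n) ≤-refl

  open FromRelation {N} (λ x y → x ≢ y × prev x ≢ y × prev y ≢ x)
    (λ x y → ¬? (x ≟ y) ×-dec ¬? (prev x ≟ y) ×-dec ¬? (prev y ≟ x))
    (λ (p , q , r) → p ∘ sym , r , q) (λ (p , _) → p refl) public

  Co : Fin N → Fin N → Set
  Co x y = prev x ≡ y ⊎ prev y ≡ x

  co : ∀ {x y} → x ≢ y → ¬ Edge graph x y → Co x y
  co {x} {y} x≢y ¬e = by-cases (prev x ≟ y) (prev y ≟ x)
    where
    by-cases : Dec (prev x ≡ y) → Dec (prev y ≡ x) → Co x y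
    by-cases (yes p) _       = inj₁ p
    by-cases (no _)  (yes q) = inj₂ q
    by-cases (no p)  (no q)  = ⊥-elim (¬e (edge⁺ (x≢y , p , q)))

  co-edge : ∀ {x y} → Co x y → ¬ Edge graph x y
  co-edge {x} {y} (inj₁ p) e = proj₁ (proj₂ (edge⁻ {x} {y} e)) p
  co-edge {x} {y} (inj₂ p) e = proj₂ (proj₂ (edge⁻ {x} {y} e)) p

  no-triangle : ∀ {x y z} → x ≢ y → y ≢ z → x ≢ z → Co x y → Co y z → Co x z → ⊥
  no-triangle ne₁ ne₂ ne₃ (inj₁ refl) (inj₁ refl) (inj₁ q)    = iter₁ (sym q)
  no-triangle ne₁ ne₂ ne₃ (inj₁ refl) (inj₁ refl) (inj₂ q)    = iter₃ q
  no-triangle ne₁ ne₂ ne₃ (inj₁ refl) (inj₂ q)    _           = ne₃ (sym (prev-injective q))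
  no-triangle ne₁ ne₂ ne₃ (inj₂ refl) (inj₁ q)    _           = ne₃ q
  no-triangle ne₁ ne₂ ne₃ (inj₂ refl) (inj₂ refl) (inj₁ q)    = iter₃ q
  no-triangle ne₁ ne₂ ne₃ (inj₂ refl) (inj₂ refl) (inj₂ q)    = iter₁ (sym q)

  no-square : ∀ {x x′ y y′} → x ≢ x′ → y ≢ y′ → Co x y → Co x y′ → Co x′ y → Co x′ y′ → ⊥
  no-square ne ne′ (inj₁ p) (inj₁ q) _ _ = ne′ (trans (sym p) q)
  no-square ne ne′ (inj₂ p) (inj₂ q) _ _ = ne′ (prev-injective (trans p (sym q)))
  no-square ne ne′ (inj₁ refl) (inj₂ q) (inj₁ r) _ = ne (sym (prev-injective r))
  no-square ne ne′ (inj₁ refl) (inj₂ q) (inj₂ r) (inj₂ t) = ne (trans (sym q) t)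
  no-square ne ne′ (inj₁ refl) (inj₂ q) (inj₂ refl) (inj₁ refl) = iter₄ q
  no-square ne ne′ (inj₂ q) (inj₁ refl) _ (inj₁ r) = ne (sym (prev-injective r))
  no-square ne ne′ (inj₂ q) (inj₁ refl) (inj₂ t) (inj₂ r) = ne (trans (sym q) t)
  no-square ne ne′ (inj₂ q) (inj₁ refl) (inj₁ refl) (inj₂ refl) = iter₄ q

  connected : Connected graph
  connected = s≤s z≤n , path
    where
    -- The vertex three steps back is at cyclic distance at least two from both `x` and `prev x`,
    -- hence adjacent to both in the complement.
    detour : ∀ x → Star (Edge graph) x (prev x)
    detour x =
      edge-walk graph x (prev (prev (prev x))) (edge⁺ {x} {prev (prev (prev x))} ((λ e → iter₃ (sym e)) , (λ e → iter₂ (sym e)) , iter₄)) ◅◅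
      edge-walk graph (prev (prev (prev x))) (prev x) (edge⁺ {prev (prev (prev x))} {prev x} (iter₂ , iter₃ , (λ e → iter₁ (sym e))))
    path : ∀ x y → Star (Edge graph) x y
    path x y = by-cases (x ≟ y) (edge? graph x y)
      where
      by-cases : Dec (x ≡ y) → Dec (Edge graph x y) → Star (Edge graph) x y
      by-cases (yes refl) _       = ε
      by-cases (no _)     (yes e) = edge-walk graph x y e
      by-cases (no x≢y)   (no ¬e) with co x≢y ¬e
      ... | inj₁ refl = detour x
      ... | inj₂ refl = walk-reverse graph (detour y)

coCycle : ℕ → Graph
coCycle m = CoCycle.graph m

Independent₃ : Graph → Set
Independent₃ H = ∃[ x ] ∃[ y ] ∃[ z ] ((x ≢ y × y ≢ z × x ≢ z) × (¬ Edge H x y × ¬ Edge H y z × ¬ Edge H x z))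

model-non-edge : ∀ {G H} (M : Model G H) {x y} → ¬ Edge H (Con.f M x) (Con.f M y) → Con.f M x ≢ Con.f M y → ¬ Edge G x y
model-non-edge M ¬e ne e = ¬e (Con.edge→ M tt tt e ne)

independent₃-lift : ∀ G H → Model G H → Independent₃ H → Independent₃ G
independent₃-lift G H M (x , y , z , (p , q , r) , (¬p , ¬q , ¬r)) with Con.onto M {x} tt | Con.onto M {y} tt | Con.onto M {z} tt
... | x′ , _ , refl | y′ , _ , refl | z′ , _ , refl = x′ , y′ , z′ ,
  (p ∘ cong (Con.f M) , q ∘ cong (Con.f M) , r ∘ cong (Con.f M)) ,
  (model-non-edge {G} {H} M ¬p p , model-non-edge {G} {H} M ¬q q , model-non-edge {G} {H} M ¬r r)

coCycle-independent : ∀ m → ¬ Independent₃ (coCycle m)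
coCycle-independent m (x , y , z , (p , q , r) , (¬p , ¬q , ¬r)) = no-triangle p q r (co p ¬p) (co q ¬q) (co r ¬r)
  where open CoCycle m

-- Two vertices with the same image a would be common non-neighbours of preimages of both
-- cyclic neighbours of a, and the cycle has no 4-cycle.
coCycle-injective : ∀ l m (M : Model (coCycle l) (coCycle m)) → ¬ Collision (coCycle l) (coCycle m) M
coCycle-injective l m M (x , x′ , x≢x′ , eq) 
  with Con.onto M {CoCycle.prev m (Con.f M x)} tt | Con.onto M {CoCycle.next m (Con.f M x)} tt
... | y , _ , fy | y′ , _ , fy′ = L.no-square x≢x′ y≢y′
    (common x y refl (inj₁ (sym fy))) (common x y′ refl next-co)
    (common x′ y (sym eq) (inj₁ (sym fy))) (common x′ y′ (sym eq) next-co)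
  where
  module L = CoCycle l
  module R = CoCycle m
  open Con M
  next-co : R.Co (f x) (f y′)
  next-co = inj₂ (trans (cong R.prev fy′) (R.prev-next (f x)))
  y≢y′ : y ≢ y′
  y≢y′ refl = R.iter₂ (trans (cong R.prev (trans (sym fy) fy′)) (R.prev-next (f x)))
  co-≢ : ∀ {a b} → R.Co a b → a ≢ b
  co-≢ (inj₁ p) refl = R.iter₁ p
  co-≢ (inj₂ p) refl = R.iter₁ p
  common : ∀ u v → f u ≡ f x → R.Co (f x) (f v) → L.Co u v
  common u v fu c = L.co (λ { refl → fu≢fv refl }) (model-non-edge {coCycle l} {coCycle m} M (R.co-edge c′) fu≢fv)
    where
    c′ : R.Co (f u) (f v)
    c′ = subst (λ a → R.Co a (f v)) (sym fu) c
    fu≢fv : f u ≢ f v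
    fu≢fv = co-≢ c′

WQO⇒¬independent₃ : ∀ {H} → WQO (Excl H) → ¬ Independent₃ H
WQO⇒¬independent₃ {H} wqo ind = antichain-in-Excl coCycle CoCycle.connected
  (λ i H≼ → coCycle-independent i (independent₃-lift (coCycle i) H (≼⇒model H≼) ind))
  (λ i j s≼ → +-cancelˡ-≡ 5 i j (sym (injective-size (coCycle j) (coCycle i) (≼⇒model s≼)
    (coCycle-injective j i (≼⇒model s≼))))) wqo

-- Graphs with two centres and no independent triple

module Contract (H : Graph) (c d : Fin (n H)) (dom-c : Dominating H c) (dom-d : Dominating H d)
  (edges : ∀ x y → Edge H x y → (x ≡ c ⊎ x ≡ d) ⊎ (y ≡ c ⊎ y ≡ d)) (¬ind : ¬ Independent₃ H) where

  Outer : Fin (n H) → Set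
  Outer z = z ≢ c × z ≢ d

  outer? : ∀ z → Dec (Outer z)
  outer? z = ¬? (z ≟ c) ×-dec ¬? (z ≟ d)

  outer-apart : ∀ {y z} → Outer y → Outer z → ¬ Edge H y z
  outer-apart (y≢c , y≢d) (z≢c , z≢d) e = [ [ y≢c , y≢d ]′ , [ z≢c , z≢d ]′ ]′ (edges _ _ e)

  -- The remaining two vertices of H, with d standing in for a missing one.
  record Tips : Set where
    field
      p q   : Fin (n H)
      p-tip : p ≡ d ⊎ Outer p
      q-tip : q ≡ d ⊎ Outer q
      p≡q⇒d : p ≡ q → p ≡ d
      cover : ∀ z → Outer z → z ≡ p ⊎ z ≡ q

  tips : Tips
  tips with any? outer?
  ... | no none = record { p = d ; q = d ; p-tip = inj₁ refl ; q-tip = inj₁ refl ; p≡q⇒d = λ _ → refl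
                         ; cover = λ z o → ⊥-elim (none (z , o)) }
  ... | yes (x , ox) with any? (λ y → outer? y ×-dec ¬? (y ≟ x))
  ...   | no none = record { p = x ; q = d ; p-tip = inj₂ ox ; q-tip = inj₁ refl ; p≡q⇒d = id ; cover = cover }
    where
    cover : ∀ z → Outer z → z ≡ x ⊎ z ≡ d
    cover z o with z ≟ x
    ... | yes p = inj₁ p
    ... | no ne = ⊥-elim (none (z , o , ne))
  ...   | yes (y , oy , y≢x) = record { p = x ; q = y ; p-tip = inj₂ ox ; q-tip = inj₂ oy
                                      ; p≡q⇒d = λ e → ⊥-elim (y≢x (sym e)) ; cover = cover }
    where
    cover : ∀ z → Outer z → z ≡ x ⊎ z ≡ y
    cover z o with z ≟ x | z ≟ y
    ... | yes p | _     = inj₁ p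
    ... | no _  | yes q = inj₂ q
    ... | no p  | no q  = ⊥-elim (¬ind (x , y , z , (y≢x ∘ sym , q ∘ sym , p ∘ sym) ,
      (outer-apart ox oy , outer-apart oy o , outer-apart ox o)))

  open Tips tips

  g : Fin 4 → Fin (n H)
  g 0F = c
  g 1F = d
  g 2F = p
  g 3F = q

  g-onto : ∀ z → ∃[ i ] g i ≡ z
  g-onto z with z ≟ c | z ≟ d
  ... | yes e | _     = 0F , sym e
  ... | no _  | yes e = 1F , sym e
  ... | no z≢c | no z≢d with cover z (z≢c , z≢d)
  ...   | inj₁ e = 2F , sym e
  ...   | inj₂ e = 3F , sym e

  tip≡d : ∀ {z} → z ≡ d ⊎ Outer z → z ≡ c ⊎ z ≡ d → z ≡ d
  tip≡d (inj₁ e)         _        = e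
  tip≡d (inj₂ (z≢c , _)) (inj₁ e) = ⊥-elim (z≢c e)
  tip≡d (inj₂ _)         (inj₂ e) = e

  step : ∀ {i j} → Edge diamond i j → g i ≡ g j → Path (Edge diamond) (λ r → ⊤ × g r ≡ g j) i j
  step e eq = (e , (tt , eq) , (tt , refl)) ◅ ε

  g-fibre : ∀ i j → g i ≡ g j → Path (Edge diamond) (λ r → ⊤ × g r ≡ g j) i j
  g-fibre 0F 0F eq = ε
  g-fibre 0F 1F eq = step refl eq
  g-fibre 0F 2F eq = step refl eq
  g-fibre 0F 3F eq = step refl eq
  g-fibre 1F 0F eq = step refl eq
  g-fibre 1F 1F eq = ε
  g-fibre 1F 2F eq = step refl eq
  g-fibre 1F 3F eq = step refl eq
  g-fibre 2F 0F eq = step refl eq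
  g-fibre 2F 1F eq = step refl eq
  g-fibre 2F 2F eq = ε
  -- Vertices 2 and 3 are not adjacent, but they share an image only if it is `d`, the image of 1,
  -- through which they are joined.
  g-fibre 2F 3F eq = _◅_ {j = 1F} (refl , (tt , eq) , (tt , d≡q)) ((refl , (tt , d≡q) , (tt , refl)) ◅ ε)
    where
    d≡q : d ≡ q
    d≡q = trans (sym (p≡q⇒d eq)) eq
  g-fibre 3F 0F eq = step refl eq
  g-fibre 3F 1F eq = step refl eq
  g-fibre 3F 2F eq = _◅_ {j = 1F} (refl , (tt , eq) , (tt , d≡p)) ((refl , (tt , d≡p) , (tt , refl)) ◅ ε)
    where
    d≡p : d ≡ p
    d≡p = sym (p≡q⇒d (sym eq))
  g-fibre 3F 3F eq = ε

  g-edge : ∀ i j → Edge diamond i j → g i ≢ g j → Edge H (g i) (g j)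
  g-edge 0F j  _ ne = dom-c (g j) (ne ∘ sym)
  g-edge 1F j  _ ne = dom-d (g j) (ne ∘ sym)
  g-edge 2F 0F _ ne = edge-sym H (dom-c p ne)
  g-edge 2F 1F _ ne = edge-sym H (dom-d p ne)
  g-edge 3F 0F _ ne = edge-sym H (dom-c q ne)
  g-edge 3F 1F _ ne = edge-sym H (dom-d q ne)
  g-edge 2F 2F ()
  g-edge 2F 3F ()
  g-edge 3F 2F ()
  g-edge 3F 3F ()

  Lifted : Fin (n H) → Fin (n H) → Set
  Lifted a b = ∃[ i ] ∃[ j ] (⊤ × ⊤ × g i ≡ a × g j ≡ b × Edge diamond i j)

  lifted : ∀ i j → Edge diamond i j → Lifted (g i) (g j)
  lifted i j e = i , j , tt , tt , refl , refl , e

  g-lift : ∀ i j → Edge H (g i) (g j) → Lifted (g i) (g j)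
  g-lift 0F 0F e = ⊥-elim (edge-≢ H e refl)
  g-lift 0F 1F e = lifted 0F 1F refl
  g-lift 0F 2F e = lifted 0F 2F refl
  g-lift 0F 3F e = lifted 0F 3F refl
  g-lift 1F 0F e = lifted 1F 0F refl
  g-lift 1F 1F e = ⊥-elim (edge-≢ H e refl)
  g-lift 1F 2F e = lifted 1F 2F refl
  g-lift 1F 3F e = lifted 1F 3F refl
  g-lift 2F 0F e = lifted 2F 0F refl
  g-lift 2F 1F e = lifted 2F 1F refl
  g-lift 2F 2F e = ⊥-elim (edge-≢ H e refl)
  -- An edge meets `c` or `d`, and a tip equal to one of these is `d`. The edge therefore lifts with
  -- vertex 1 replacing that tip.
  g-lift 2F 3F e with edges p q e
  ... | inj₁ h = 1F , 3F , tt , tt , sym (tip≡d p-tip h) , refl , refl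
  ... | inj₂ h = 2F , 1F , tt , tt , refl , sym (tip≡d q-tip h) , refl
  g-lift 3F 0F e = lifted 3F 0F refl
  g-lift 3F 1F e = lifted 3F 1F refl
  g-lift 3F 2F e with edges q p e
  ... | inj₁ h = 1F , 2F , tt , tt , sym (tip≡d q-tip h) , refl , refl
  ... | inj₂ h = 3F , 1F , tt , tt , refl , sym (tip≡d p-tip h) , refl
  g-lift 3F 3F e = ⊥-elim (edge-≢ H e refl)

  model : Model diamond H
  model = record
    { f     = g
    ; into  = λ _ → tt
    ; onto  = λ {z} _ → let (i , e) = g-onto z in i , tt , e
    ; fibre = λ {i} {j} _ _ → g-fibre i j
    ; edge→ = λ {i} {j} _ _ → g-edge i j
    ; edge← = λ {a} {b} _ _ e → lift (g-onto a) (g-onto b) e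
    }
    where
    lift : ∀ {a b} → ∃[ i ] g i ≡ a → ∃[ j ] g j ≡ b → Edge H a b → Lifted a b
    lift (i , refl) (j , refl) e = g-lift i j e

theorem5 : (H : Graph) →
    (WQO (Excl H) → H ≼ diamond) × (H ≼ diamond → WQO (Excl H))
theorem5 H = only-if , ≼diamond⇒WQO
  where
  only-if : WQO (Excl H) → H ≼ diamond
  only-if wqo with WQO⇒two-centres wqo
  ... | c , d , dom-c , dom-d , edges =
    model⇒≼ (Contract.model H c d dom-c dom-d edges (WQO⇒¬independent₃ wqo))
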